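{- For any real $\lambda\ge 0$, $\mathrm{MarkSwap}(\lambda)\succeq\mathrm{Poisson}(\lambda)$.
   Context: $D_X\succeq D_Y$ means that $X\sim D_X$ second-order stochastically dominates $Y\sim D_Y$: $\mathbf{E}f(X)\ge\mathbf{E}f(Y)$ for every non-decreasing concave function $f$. For distributions $D_1,D_2$, $D_1+D_2$ is the distribution of $X_1+X_2$ with independent $X_1\sim D_1$, $X_2\sim D_2$; for an integer $k\ge1$, $k\cdot D$ is the distribution of the sum of $k$ independent draws from $D$ (and $0\cdot D$ is the point mass at $0$). $z^+=\max\{z,0\}$; $\lfloor x\rfloor$ and $\{x\}$ are the integer part and fractional part of $x$. $\mathrm{Poisson}(\lambda)$ is the Poisson distribution with mean $\lambda$, $\mathrm{Exp}(1)$ the exponential distribution with rate $1$, $\mathrm{Bern}(p)$ the Bernoulli distribution equal to $1$ with probability $p$. For $\lambda\ge0$, $\mathrm{Swap}(\lambda)$ is the distribution of $S$ generated as follows: sample $T\sim\mathrm{Exp}(1)$, then sample $S\sim\mathrm{Poisson}(\lambda(1-T)^+)$. For $\lambda\in[0,1]$, $\mathrm{MarkSwap}(\lambda)=\mathrm{Bern}\big((1-\tfrac1e)\lambda\big)+\mathrm{Swap}(\lambda)$. For $\lambda>1$, $\mathrm{MarkSwap}(\lambda)=\lfloor\lambda\rfloor\cdot\mathrm{MarkSwap}(1)+\mathrm{MarkSwap}(\{\lambda\})$. -}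

module Defs where

open import Algebra.Bundles using (CommutativeRing; Semiring)
open import Algebra.Structures using (IsCommutativeRing)
open import Axiom.ExcludedMiddle using (ExcludedMiddle)
open import Data.Bool.Base using (if_then_else_)
open import Data.Fin.Base using (Fin; toℕ)
open import Data.Nat.Base as ℕ using (ℕ; zero; suc; _∸_; _!)
open import Data.Product.Base using (∃; _,_; _×_)
open import Level using (0ℓ)
open import Relation.Binary.Bundles using (TotalOrder)
open import Relation.Binary.Structures using (IsTotalOrder)
open import Relation.Nullary.Decidable.Core using (yes; no; does)
open import Relation.Nullary.Negation.Core using (¬_)

import Algebra.Construct.NaturalChoice.Max as Max
import Algebra.Definitions.RawSemiring as RawSemiringDefs
import Relation.Binary.Construct.NonStrictToStrict as ToStrict

-- The real numbers, presented by the usual axioms of a Dedekind-complete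
-- ordered field.  Equality is a setoid equality, so that (given excluded
-- middle) Cauchy sequences of rationals form a model.  The value of 0# ⁻¹ is
-- unspecified.
record CompleteOrderedField : Set₁ where
  infixl 7 _*_
  infixl 6 _+_
  infix  8 -_
  infix  9 _⁻¹
  infix  4 _≈_ _≤_
  field
    Carrier           : Set
    _≈_ _≤_           : Carrier → Carrier → Set
    _+_ _*_           : Carrier → Carrier → Carrier
    -_ _⁻¹            : Carrier → Carrier
    0# 1#             : Carrier
    isCommutativeRing : IsCommutativeRing _≈_ _+_ _*_ -_ 0# 1#
    0≉1               : ¬ (0# ≈ 1#)
    ⁻¹-inverse        : ∀ x → ¬ (x ≈ 0#) → x * x ⁻¹ ≈ 1#
    isTotalOrder      : IsTotalOrder _≈_ _≤_
    +-monoˡ-≤         : ∀ z {x y} → x ≤ y → x + z ≤ y + z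
    *-nonNeg          : ∀ {x y} → 0# ≤ x → 0# ≤ y → 0# ≤ x * y

  UpperBound : (Carrier → Set) → Carrier → Set
  UpperBound P u = ∀ x → P x → x ≤ u

  field
    supremum : (P : Carrier → Set) → ∃ P → ∃ (UpperBound P) →
               ∃ λ s → UpperBound P s × (∀ u → UpperBound P u → s ≤ u)

  commutativeRing : CommutativeRing 0ℓ 0ℓ
  commutativeRing = record { isCommutativeRing = isCommutativeRing }

  totalOrder : TotalOrder 0ℓ 0ℓ 0ℓ
  totalOrder = record { isTotalOrder = isTotalOrder }

module Probability (em : ExcludedMiddle 0ℓ) (R : CompleteOrderedField) where

  open CompleteOrderedField R public
  open CommutativeRing commutativeRing public using (_-_)
  open RawSemiringDefs (Semiring.rawSemiring (CommutativeRing.semiring commutativeRing)) public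
    using (_^_; sum) renaming (_×_ to _×ℝ_)
  open Max totalOrder public using (_⊔_)
  open ToStrict _≈_ _≤_ public using (_<_)

  ℝ : Set
  ℝ = Carrier

  fromℕ : ℕ → ℝ
  fromℕ n = n ×ℝ 1#

  ∣_∣ : ℝ → ℝ
  ∣ x ∣ = x ⊔ (- x)

  _⁺ : ℝ → ℝ
  x ⁺ = x ⊔ 0#

  IsFloor : ℝ → ℕ → Set
  IsFloor x n = fromℕ n ≤ x × x < fromℕ (suc n)

  -- Integer part; meaningful for x ≥ 0 only (0 is returned for x < 0).
  floor : ℝ → ℕ
  floor x with em {∃ (IsFloor x)}
  ... | yes (n , _) = n
  ... | no  _       = 0

  frac : ℝ → ℝ
  frac x = x - fromℕ (floor x)

  _⟶_ : (ℕ → ℝ) → ℝ → Set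
  s ⟶ l = ∀ ε → 0# < ε → ∃ λ N → ∀ n → N ℕ.≤ n → ∣ s n - l ∣ < ε

  -- The limit of a convergent sequence, and 0# for a divergent one.
  lim : (ℕ → ℝ) → ℝ
  lim s with em {∃ λ l → s ⟶ l}
  ... | yes (l , _) = l
  ... | no  _       = 0#

  ∑∞ : (ℕ → ℝ) → ℝ
  ∑∞ a = lim (λ n → sum (λ (i : Fin n) → a (toℕ i)))

  exp : ℝ → ℝ
  exp x = ∑∞ (λ k → x ^ k * fromℕ (k !) ⁻¹)

  -- TaggedPartition b a: a = x₀ ≤ x₁ ≤ ⋯ ≤ xₙ = b, with a tag tᵢ in each
  -- [xᵢ , xᵢ₊₁], listed from the left end.
  data TaggedPartition (b : ℝ) : ℝ → Set where
    end  : ∀ {a} → a ≈ b → TaggedPartition b a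
    cell : ∀ {a} (t x : ℝ) → a ≤ t → t ≤ x → TaggedPartition b x →
           TaggedPartition b a

  data MeshBelow (δ : ℝ) {b : ℝ} : ∀ {a} → TaggedPartition b a → Set where
    end  : ∀ {a} {a≈b : a ≈ b} → MeshBelow δ (end a≈b)
    cell : ∀ {a t x} {a≤t : a ≤ t} {t≤x : t ≤ x} {p : TaggedPartition b x} →
           x - a < δ → MeshBelow δ p → MeshBelow δ (cell t x a≤t t≤x p)

  riemannSum : (ℝ → ℝ) → ∀ {b a} → TaggedPartition b a → ℝ
  riemannSum f         (end _)          = 0#
  riemannSum f {a = a} (cell t x _ _ p) = f t * (x - a) + riemannSum f p

  IsRiemannIntegral : (a b : ℝ) → (ℝ → ℝ) → ℝ → Set
  IsRiemannIntegral a b f I =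
    ∀ ε → 0# < ε → ∃ λ δ → 0# < δ ×
      ((p : TaggedPartition b a) → MeshBelow δ p → ∣ riemannSum f p - I ∣ < ε)

  -- The Riemann integral over [a , b] for a ≤ b, and 0# when it does not exist.
  ∫ : (a b : ℝ) → (ℝ → ℝ) → ℝ
  ∫ a b f with em {∃ (IsRiemannIntegral a b f)}
  ... | yes (I , _) = I
  ... | no  _       = 0#

  -- Improper integral over [0 , ∞).  It is only used for non-negative f, where
  -- integer upper limits suffice.
  ∫₀∞ : (ℝ → ℝ) → ℝ
  ∫₀∞ f = lim (λ n → ∫ 0# (fromℕ n) f)

  -- A distribution on ℕ, given by its probability mass function.
  Dist : Set
  Dist = ℕ → ℝ

  pointMass₀ : Dist
  pointMass₀ zero    = 1#
  pointMass₀ (suc _) = 0#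

  Bern : ℝ → Dist
  Bern p 0             = 1# - p
  Bern p 1             = p
  Bern p (suc (suc _)) = 0#

  Poisson : ℝ → Dist
  Poisson μ k = exp (- μ) * (μ ^ k * fromℕ (k !) ⁻¹)

  infixl 6 _⊞_
  infixr 7 _·_

  -- Law of the sum of independent variables with laws D₁ and D₂.
  _⊞_ : Dist → Dist → Dist
  (D₁ ⊞ D₂) n = sum (λ (i : Fin (suc n)) → D₁ (toℕ i) * D₂ (n ∸ toℕ i))

  _·_ : ℕ → Dist → Dist
  zero  · D = pointMass₀
  suc k · D = D ⊞ k · D

  -- Law of S when T has the Exp(1) law, of density exp (- t) on [0 , ∞), and
  -- S has law κ t conditionally on T = t.
  mixExp₁ : (ℝ → Dist) → Dist
  mixExp₁ κ k = ∫₀∞ (λ t → exp (- t) * κ t k)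

  Swap : ℝ → Dist
  Swap μ = mixExp₁ (λ t → Poisson (μ * (1# - t) ⁺))

  MarkSwap≤1 : ℝ → Dist
  MarkSwap≤1 μ = Bern ((1# - exp 1# ⁻¹) * μ) ⊞ Swap μ

  MarkSwap : ℝ → Dist
  MarkSwap μ =
    if does (em {μ ≤ 1#})
    then MarkSwap≤1 μ
    else floor μ · MarkSwap≤1 1# ⊞ MarkSwap≤1 (frac μ)

  NonDecreasing : (ℝ → ℝ) → Set
  NonDecreasing f = ∀ {x y} → x ≤ y → f x ≤ f y

  Concave : (ℝ → ℝ) → Set
  Concave f = ∀ x y t → 0# ≤ t → t ≤ 1# →
    t * f x + (1# - t) * f y ≤ f (t * x + (1# - t) * y)

  𝐄 : Dist → (ℝ → ℝ) → ℝ
  𝐄 D f = ∑∞ (λ k → D k * f (fromℕ k))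

  infix 4 _⪰_

  -- Second-order stochastic dominance.  For non-decreasing concave f,
  -- f 0# ≤ f (fromℕ k) ≤ f 0# + k (f 1# - f 0#), so the series 𝐄 D f converges
  -- for every probability distribution D on ℕ with finite mean.
  _⪰_ : Dist → Dist → Set
  D₁ ⪰ D₂ = ∀ f → NonDecreasing f → Concave f → 𝐄 D₂ f ≤ 𝐄 D₁ f

{-# OPTIONS --safe #-}
module Submission where

-- Write p k for the Poisson μ probabilities, e⁻¹ = exp (- 1), and let I k be the
-- integral of exp (- t) Poisson (μ (1 - t)) k over [0 , 1].  Then Swap μ has mass
-- I k + e⁻¹ [k = 0] at k, and integration by parts gives
--   p k = (1 - μ) I k + μ I (k - 1) + e⁻¹ [k = 0],
-- that is, p = Bern μ ⊞ I + e⁻¹ pointMass₀, whereas MarkSwap≤1 μ is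
-- Bern ((1 - e⁻¹) μ) ⊞ (I + e⁻¹ pointMass₀).  Hence the expectations of f under
-- MarkSwap≤1 μ and under Poisson μ differ by
--   e⁻¹ μ ((1 - e⁻¹) (f 1 - f 0) - ∑ I k (f (k + 1) - f k)),
-- which is non-negative because f (k + 1) - f k ≤ f 1 - f 0, I k ≥ 0 and
-- ∑ I k = 1 - e⁻¹.  For concave non-decreasing f it suffices to test
-- f x = - (n - x)⁺; that expectation is a double partial sum of the mass
-- function, so dominance passes through ⊞ by finite algebra, and the case μ > 1
-- follows from Poisson x ⊞ Poisson y = Poisson (x + y).

open import Algebra.Bundles using (CommutativeRing)
open import Algebra.Solver.Ring.AlmostCommutativeRing
  using (fromCommutativeRing; _-Raw-AlmostCommutative⟶_)
open import Axiom.ExcludedMiddle using (ExcludedMiddle)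
open import Data.Bool.Base using (if_then_else_)
open import Data.Empty using (⊥-elim)
open import Data.Fin.Base using (Fin; toℕ)
open import Data.Integer.Base as ℤ using (ℤ; -[1+_]; _⊖_) renaming (+_ to pos)
open import Data.Maybe.Base using (Maybe; just; nothing)
open import Data.Nat.Base as ℕ using (ℕ; zero; suc; _!)
open import Data.Product.Base using (∃; _,_; _×_; proj₁; proj₂)
open import Data.Sum.Base using (inj₁; inj₂)
open import Function.Base using (_∘_)
open import Level using (0ℓ)
open import Relation.Binary.Bundles using (TotalOrder)
open import Relation.Nullary.Decidable.Core using (Dec; yes; no; does)
open import Relation.Nullary.Negation.Core using (¬_)
open import Defs

import Algebra.Construct.NaturalChoice.Max as Max
import Algebra.Properties.Semiring.Mult as Mult
import Algebra.Properties.Semiring.Mult.TCOptimised as MultTC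
import Algebra.Solver.Ring as RingSolver
import Data.Integer.Properties as ℤ
import Data.Nat.Properties as ℕ
import Relation.Binary.PropositionalEquality.Core as ≡
import Relation.Binary.Reasoning.PartialOrder as ≤-Reasoning

-- The weight 1 - e⁻¹ of the mark is the one that equalises means: `Swap μ` has mean μ ∫ (1 - t) exp
-- (- t) dt over [0 , 1] = e⁻¹ μ, and the Bernoulli part restores the missing (1 - e⁻¹) μ.
--
-- Sums and integrals are never interchanged. Each `I k` is the increment over [0 , 1] of an
-- exhibited antiderivative, so integrability, the value of the integral and the integration by
-- parts all come with explicit error constants. The total ∑ I k is then read off from the
-- decomposition of p by comparing masses on both sides.
--
-- `𝐄` is a limit, and `f` may grow linearly, so convergence has to be carried along. All laws stay
-- in one class of series with finite 2ᵏ-moment, closed under `_⊞_`, whose tails beat any polynomial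
-- that occurs. Hinge functions suffice because of two summations by parts: the first produces the
-- differences f (k + 1) - f k, non-negative and decreasing, and the second pairs them with double
-- partial sums of the mass difference; the boundary term dies with the tails.

-- A ring solver with integer coefficients.

module IntegerRingSolver (A : CommutativeRing 0ℓ 0ℓ) where

  open CommutativeRing A
  open MultTC semiring using (1+×; ×-homo-+; ×1-homo-*) renaming (_×_ to _×′_)
  open import Algebra.Properties.Ring ring
    using (-0#≈0#; -‿involutive; -‿+-comm; -‿distribˡ-*; -‿distribʳ-*)
  open import Algebra.Properties.AbelianGroup +-abelianGroup using (xyx⁻¹≈y)
  open import Relation.Binary.Reasoning.Setoid setoid

  -- The optimised multiple `_×′_` makes 1 and 2 evaluate to `1#` and `1# + 1#` without a trailing
  -- `0#`, so that `:1` and `:2` match the numerals written in goals.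
  fromℤ : ℤ → Carrier
  fromℤ (pos n)  = n ×′ 1#
  fromℤ -[1+ n ] = - (suc n ×′ 1#)

  fromℤ-neg : ∀ i → fromℤ (ℤ.- i) ≈ - fromℤ i
  fromℤ-neg (pos zero)    = sym -0#≈0#
  fromℤ-neg (pos (suc n)) = refl
  fromℤ-neg -[1+ n ]      = sym (-‿involutive _)

  fromℤ-⊖ : ∀ m n → fromℤ (m ⊖ n) ≈ m ×′ 1# - n ×′ 1#
  fromℤ-⊖ m       zero    = sym (trans (+-congˡ -0#≈0#) (+-identityʳ _))
  fromℤ-⊖ zero    (suc n) = sym (+-identityˡ _)
  fromℤ-⊖ (suc m) (suc n) = begin
    fromℤ (suc m ⊖ suc n)                   ≡⟨ ≡.cong fromℤ (ℤ.[1+m]⊖[1+n]≡m⊖n m n) ⟩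
    fromℤ (m ⊖ n)                           ≈⟨ fromℤ-⊖ m n ⟩
    m ×′ 1# - n ×′ 1#                       ≈⟨ +-congʳ (xyx⁻¹≈y 1# (m ×′ 1#)) ⟨
    1# + m ×′ 1# - 1# - n ×′ 1#             ≈⟨ +-assoc _ _ _ ⟩
    1# + m ×′ 1# + (- 1# - n ×′ 1#)         ≈⟨ +-congˡ (-‿+-comm 1# (n ×′ 1#)) ⟩
    1# + m ×′ 1# - (1# + n ×′ 1#)           ≈⟨ +-cong (1+× m 1#) (-‿cong (1+× n 1#)) ⟨
    suc m ×′ 1# - suc n ×′ 1#               ∎

  fromℤ-+ : ∀ i j → fromℤ (i ℤ.+ j) ≈ fromℤ i + fromℤ j
  fromℤ-+ (pos m)  (pos n)  = ×-homo-+ 1# m n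
  fromℤ-+ (pos m)  -[1+ n ] = fromℤ-⊖ m (suc n)
  fromℤ-+ -[1+ m ] (pos n)  = trans (fromℤ-⊖ n (suc m)) (+-comm _ _)
  fromℤ-+ -[1+ m ] -[1+ n ] = begin
    - (suc (suc (m ℕ.+ n)) ×′ 1#)    ≡⟨ ≡.cong (λ k → - (suc k ×′ 1#)) (ℕ.+-suc m n) ⟨
    - ((suc m ℕ.+ suc n) ×′ 1#)      ≈⟨ -‿cong (×-homo-+ 1# (suc m) (suc n)) ⟩
    - (suc m ×′ 1# + suc n ×′ 1#)    ≈⟨ -‿+-comm _ _ ⟨
    - (suc m ×′ 1#) - suc n ×′ 1#    ∎

  fromℤ-pos-* : ∀ m j → fromℤ (pos m ℤ.* j) ≈ fromℤ (pos m) * fromℤ j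
  fromℤ-pos-* m (pos n)  = trans (reflexive (≡.cong fromℤ (≡.sym (ℤ.pos-* m n)))) (×1-homo-* m n)
  fromℤ-pos-* m -[1+ n ] = begin
    fromℤ (pos m ℤ.* ℤ.- pos (suc n))     ≡⟨ ≡.cong fromℤ (ℤ.neg-distribʳ-* (pos m) (pos (suc n))) ⟨
    fromℤ (ℤ.- (pos m ℤ.* pos (suc n)))   ≈⟨ fromℤ-neg (pos m ℤ.* pos (suc n)) ⟩
    - fromℤ (pos m ℤ.* pos (suc n))       ≈⟨ -‿cong (fromℤ-pos-* m (pos (suc n))) ⟩
    - (m ×′ 1# * (suc n ×′ 1#))           ≈⟨ -‿distribʳ-* _ _ ⟩
    m ×′ 1# * - (suc n ×′ 1#)             ∎

  fromℤ-* : ∀ i j → fromℤ (i ℤ.* j) ≈ fromℤ i * fromℤ j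
  fromℤ-* (pos m)  j = fromℤ-pos-* m j
  fromℤ-* -[1+ m ] j = begin
    fromℤ (ℤ.- pos (suc m) ℤ.* j)      ≡⟨ ≡.cong fromℤ (ℤ.neg-distribˡ-* (pos (suc m)) j) ⟨
    fromℤ (ℤ.- (pos (suc m) ℤ.* j))    ≈⟨ fromℤ-neg (pos (suc m) ℤ.* j) ⟩
    - fromℤ (pos (suc m) ℤ.* j)        ≈⟨ -‿cong (fromℤ-pos-* (suc m) j) ⟩
    - (suc m ×′ 1# * fromℤ j)          ≈⟨ -‿distribˡ-* _ _ ⟩
    - (suc m ×′ 1#) * fromℤ j          ∎

  fromℤ-homomorphism : ℤ.+-*-rawRing -Raw-AlmostCommutative⟶ fromCommutativeRing A
  fromℤ-homomorphism = record
    { ⟦_⟧ = fromℤ ; +-homo = fromℤ-+ ; *-homo = fromℤ-* ; -‿homo = fromℤ-neg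
    ; 0-homo = refl ; 1-homo = refl }

  fromℤ-≟ : ∀ i j → Maybe (fromℤ i ≈ fromℤ j)
  fromℤ-≟ i j with i ℤ.≟ j
  ... | yes i≡j = just (reflexive (≡.cong fromℤ i≡j))
  ... | no  _   = nothing

  open RingSolver ℤ.+-*-rawRing (fromCommutativeRing A) fromℤ-homomorphism fromℤ-≟ public
    using (Polynomial; con; solve; _:=_; _:+_; _:*_; _:-_; :-_)

  :0 :1 :2 : ∀ {n} → Polynomial n
  :0 = con (pos 0)
  :1 = con (pos 1)
  :2 = con (pos 2)

-- Order, absolute value and the Archimedean property.

module RealField (em : ExcludedMiddle 0ℓ) (R : CompleteOrderedField) where

  open Probability em R
  open CommutativeRing commutativeRing public
    using ( refl; sym; trans; reflexive; semiring; +-cong; +-congˡ; +-congʳ; *-cong; *-congˡ; *-congʳ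
          ; -‿cong; -‿inverseʳ; +-identityˡ; +-identityʳ; +-comm; +-assoc; *-comm; *-assoc
          ; *-identityˡ; *-identityʳ; zeroˡ; zeroʳ; distribˡ; distribʳ)
  open TotalOrder totalOrder public using ()
    renaming ( refl to ≤-refl; trans to ≤-trans; reflexive to ≤-reflexive; antisym to ≤-antisym
             ; total to ≤-total; poset to ≤-poset)
  open IntegerRingSolver commutativeRing public
  open Max totalOrder using (x≤y⇒x⊔y≈y; x≤y⇒y⊔x≈y; x≤x⊔y; x≤y⊔x; ⊔-lub; ⊔-cong)
  open ≤-Reasoning ≤-poset

  -- Lets an inequality be proved by writing y - x as a visibly non-negative
  -- expression, the identity being left to the ring solver.
  ≤-by : ∀ {x y e} → y - x ≈ e → 0# ≤ e → x ≤ y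
  ≤-by {x} {y} {e} eq 0≤e = begin
    x            ≈⟨ +-identityˡ x ⟨
    0# + x       ≤⟨ +-monoˡ-≤ x 0≤e ⟩
    e + x        ≈⟨ +-congʳ eq ⟨
    y - x + x    ≈⟨ (solve 2 (λ x y → y :- x :+ x := y) refl x y) ⟩
    y            ∎

  gap : ∀ {x y} → x ≤ y → 0# ≤ y - x
  gap {x} {y} x≤y = ≤-trans (≤-reflexive (sym (-‿inverseʳ x))) (+-monoˡ-≤ (- x) x≤y)

  0≤+ : ∀ {x y} → 0# ≤ x → 0# ≤ y → 0# ≤ x + y
  0≤+ {x} {y} 0≤x 0≤y = ≤-trans 0≤y (≤-by (solve 2 (λ x y → x :+ y :- y := x) refl x y) 0≤x)

  +-mono-≤ : ∀ {x y u v} → x ≤ y → u ≤ v → x + u ≤ y + v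
  +-mono-≤ {x} {y} {u} {v} x≤y u≤v =
    ≤-by (solve 4 (λ x y u v → y :+ v :- (x :+ u) := y :- x :+ (v :- u)) refl x y u v) (0≤+ (gap x≤y) (gap u≤v))

  +-monoʳ-≤ : ∀ z {x y} → x ≤ y → z + x ≤ z + y
  +-monoʳ-≤ z = +-mono-≤ ≤-refl

  neg-mono-≤ : ∀ {x y} → x ≤ y → - y ≤ - x
  neg-mono-≤ {x} {y} x≤y = ≤-by (solve 2 (λ x y → :- x :- (:- y) := y :- x) refl x y) (gap x≤y)

  *-monoˡ-≤ : ∀ {z x y} → 0# ≤ z → x ≤ y → z * x ≤ z * y
  *-monoˡ-≤ {z} {x} {y} 0≤z x≤y =
    ≤-by (solve 3 (λ x y z → z :* y :- z :* x := z :* (y :- x)) refl x y z) (*-nonNeg 0≤z (gap x≤y))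

  *-monoʳ-≤ : ∀ {z x y} → 0# ≤ z → x ≤ y → x * z ≤ y * z
  *-monoʳ-≤ {z} {x} {y} 0≤z x≤y =
    ≤-by (solve 3 (λ x y z → y :* z :- x :* z := (y :- x) :* z) refl x y z) (*-nonNeg (gap x≤y) 0≤z)

  *-mono-≤ : ∀ {x y u v} → 0# ≤ x → x ≤ y → 0# ≤ u → u ≤ v → x * u ≤ y * v
  *-mono-≤ 0≤x x≤y 0≤u u≤v = ≤-trans (*-monoˡ-≤ 0≤x u≤v) (*-monoʳ-≤ (≤-trans 0≤u u≤v) x≤y)

  x≤0⇒0≤-x : ∀ {x} → x ≤ 0# → 0# ≤ - x
  x≤0⇒0≤-x {x} x≤0 = ≤-by (solve 1 (λ x → :- x :- :0 := :0 :- x) refl x) (gap x≤0)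

  0≤x² : ∀ x → 0# ≤ x * x
  0≤x² x with ≤-total 0# x
  ... | inj₁ 0≤x = *-nonNeg 0≤x 0≤x
  ... | inj₂ x≤0 = ≤-trans (*-nonNeg (x≤0⇒0≤-x x≤0) (x≤0⇒0≤-x x≤0))
      (≤-reflexive (solve 1 (λ x → :- x :* :- x := x :* x) refl x))

  0≤1 : 0# ≤ 1#
  0≤1 = ≤-trans (0≤x² 1#) (≤-reflexive (*-identityˡ 1#))

  1≰0 : ¬ (1# ≤ 0#)
  1≰0 1≤0 = 0≉1 (≤-antisym 0≤1 1≤0)

  x≤x+y : ∀ {x y} → 0# ≤ y → x ≤ x + y
  x≤x+y {x} {y} 0≤y = ≤-by (solve 2 (λ x y → x :+ y :- x := y) refl x y) 0≤y

  <⇒≤ : ∀ {x y} → x < y → x ≤ y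
  <⇒≤ = proj₁

  <-≤-trans : ∀ {x y z} → x < y → y ≤ z → x < z
  <-≤-trans (x≤y , x≉y) y≤z =
    ≤-trans x≤y y≤z , λ x≈z → x≉y (≤-antisym x≤y (≤-trans y≤z (≤-reflexive (sym x≈z))))

  0<x⇒x≉0 : ∀ {x} → 0# < x → ¬ (x ≈ 0#)
  0<x⇒x≉0 (_ , 0≉x) x≈0 = 0≉x (sym x≈0)

  0<1+x : ∀ {x} → 0# ≤ x → 0# < 1# + x
  0<1+x 0≤x = <-≤-trans (0≤1 , 0≉1) (x≤x+y 0≤x)

  ⁻¹-nonNeg : ∀ {x} → 0# < x → 0# ≤ x ⁻¹
  ⁻¹-nonNeg {x} 0<x with ≤-total 0# (x ⁻¹)
  ... | inj₁ 0≤x⁻¹ = 0≤x⁻¹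
  ... | inj₂ x⁻¹≤0 = ⊥-elim (1≰0 (≤-by eq (*-nonNeg (<⇒≤ 0<x) (x≤0⇒0≤-x x⁻¹≤0))))
    where
    eq : 0# - 1# ≈ x * - (x ⁻¹)
    eq = trans (+-congˡ (-‿cong (sym (⁻¹-inverse x (0<x⇒x≉0 0<x)))))
               (solve 2 (λ x y → :0 :- x :* y := x :* :- y) refl x (x ⁻¹))

  ⁻¹-pos : ∀ {x} → 0# < x → 0# < x ⁻¹
  ⁻¹-pos {x} 0<x = ⁻¹-nonNeg 0<x , λ 0≈x⁻¹ →
    0≉1 (trans (sym (zeroʳ x)) (trans (*-congˡ 0≈x⁻¹) (⁻¹-inverse x (0<x⇒x≉0 0<x))))

  *-pos : ∀ {x y} → 0# < x → 0# < y → 0# < x * y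
  *-pos {x} {y} 0<x 0<y = *-nonNeg (<⇒≤ 0<x) (<⇒≤ 0<y) , λ 0≈xy → proj₂ 0<y (begin-equality
    0#                ≈⟨ zeroʳ _ ⟨
    x ⁻¹ * 0#         ≈⟨ *-congˡ 0≈xy ⟩
    x ⁻¹ * (x * y)    ≈⟨ (solve 3 (λ x y z → z :* (x :* y) := x :* z :* y) refl x y (x ⁻¹)) ⟩
    x * x ⁻¹ * y      ≈⟨ *-congʳ (⁻¹-inverse x (0<x⇒x≉0 0<x)) ⟩
    1# * y            ≈⟨ *-identityˡ y ⟩
    y                 ∎)

  *-cancelˡ-≤ : ∀ {z x y} → 0# < z → z * x ≤ z * y → x ≤ y
  *-cancelˡ-≤ {z} {x} {y} 0<z zx≤zy = begin
    x                  ≈⟨ cancel x ⟨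
    z ⁻¹ * (z * x)     ≤⟨ *-monoˡ-≤ (⁻¹-nonNeg 0<z) zx≤zy ⟩
    z ⁻¹ * (z * y)     ≈⟨ cancel y ⟩
    y                  ∎
    where
    cancel : ∀ u → z ⁻¹ * (z * u) ≈ u
    cancel u = trans (solve 3 (λ u z w → w :* (z :* u) := z :* w :* u) refl u z (z ⁻¹))
                     (trans (*-congʳ (⁻¹-inverse z (0<x⇒x≉0 0<z))) (*-identityˡ u))

  *-cancelˡ-≈ : ∀ {z x y} → 0# < z → z * x ≈ z * y → x ≈ y
  *-cancelˡ-≈ 0<z eq =
    ≤-antisym (*-cancelˡ-≤ 0<z (≤-reflexive eq)) (*-cancelˡ-≤ 0<z (≤-reflexive (sym eq)))

  ½ : ℝ
  ½ = (1# + 1#) ⁻¹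

  0<½ : 0# < ½
  0<½ = ⁻¹-pos (0<1+x 0≤1)

  2½≈1 : (1# + 1#) * ½ ≈ 1#
  2½≈1 = ⁻¹-inverse (1# + 1#) (0<x⇒x≉0 (0<1+x 0≤1))

  <⇒≱ : ∀ {x y} → x < y → ¬ (y ≤ x)
  <⇒≱ (x≤y , x≉y) y≤x = x≉y (≤-antisym x≤y y≤x)

  ≰⇒> : ∀ {x y} → ¬ (x ≤ y) → y < x
  ≰⇒> {x} {y} x≰y with ≤-total x y
  ... | inj₁ x≤y = ⊥-elim (x≰y x≤y)
  ... | inj₂ y≤x = y≤x , λ y≈x → x≰y (≤-reflexive (sym y≈x))

  gap< : ∀ {x y} → x < y → 0# < y - x
  gap< {x} {y} (x≤y , x≉y) = gap x≤y , λ 0≈y-x → x≉y (begin-equality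
    x            ≈⟨ +-identityˡ x ⟨
    0# + x       ≈⟨ +-congʳ 0≈y-x ⟩
    y - x + x    ≈⟨ (solve 2 (λ x y → y :- x :+ x := y) refl x y) ⟩
    y            ∎)

  0<½x : ∀ {x} → 0# < x → 0# < ½ * x
  0<½x = *-pos 0<½

  ½x+½x≈x : ∀ x → ½ * x + ½ * x ≈ x
  ½x+½x≈x x = trans (solve 2 (λ h x → h :* x :+ h :* x := :2 :* h :* x) refl (½) x)
      (trans (*-congʳ 2½≈1) (*-identityˡ x))

  ½x<x : ∀ {x} → 0# < x → ½ * x < x
  ½x<x {x} 0<x = ≤-trans (x≤x+y (<⇒≤ (0<½x 0<x))) (≤-reflexive (½x+½x≈x x)) , λ ½x≈x →
    proj₂ (0<½x 0<x) (begin-equality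
      0#                          ≈⟨ (solve 1 (λ x → :0 := x :- x) refl x) ⟩
      x - x                       ≈⟨ +-cong (½x+½x≈x x) (-‿cong ½x≈x) ⟨
      ½ * x + ½ * x - ½ * x       ≈⟨ (solve 1 (λ y → y :+ y :- y := y) refl (½ * x)) ⟩
      ½ * x                       ∎)

  ≤-<-trans : ∀ {x y z} → x ≤ y → y < z → x < z
  ≤-<-trans x≤y (y≤z , y≉z) =
    ≤-trans x≤y y≤z , λ x≈z → y≉z (≤-antisym y≤z (≤-trans (≤-reflexive (sym x≈z)) x≤y))

  ∣∣-lub : ∀ {x z} → x ≤ z → - x ≤ z → ∣ x ∣ ≤ z
  ∣∣-lub = ⊔-lub

  x≤∣x∣ : ∀ x → x ≤ ∣ x ∣
  x≤∣x∣ x = x≤x⊔y x (- x)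

  -x≤∣x∣ : ∀ x → - x ≤ ∣ x ∣
  -x≤∣x∣ x = x≤y⊔x x (- x)

  ∣∣-cong : ∀ {x y} → x ≈ y → ∣ x ∣ ≈ ∣ y ∣
  ∣∣-cong x≈y = ⊔-cong x≈y (-‿cong x≈y)

  0≤x⇒∣x∣≈x : ∀ {x} → 0# ≤ x → ∣ x ∣ ≈ x
  0≤x⇒∣x∣≈x {x} 0≤x = x≤y⇒y⊔x≈y (≤-trans (≤-by (solve 1 (λ x → :0 :- (:- x) := x) refl x) 0≤x) 0≤x)

  x≤0⇒∣x∣≈-x : ∀ {x} → x ≤ 0# → ∣ x ∣ ≈ - x
  x≤0⇒∣x∣≈-x {x} x≤0 = x≤y⇒x⊔y≈y (≤-trans x≤0 (x≤0⇒0≤-x x≤0))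

  0≤∣x∣ : ∀ x → 0# ≤ ∣ x ∣
  0≤∣x∣ x with ≤-total 0# x
  ... | inj₁ 0≤x = ≤-trans 0≤x (x≤∣x∣ x)
  ... | inj₂ x≤0 = ≤-trans (x≤0⇒0≤-x x≤0) (-x≤∣x∣ x)

  ∣-x∣≈∣x∣ : ∀ x → ∣ - x ∣ ≈ ∣ x ∣
  ∣-x∣≈∣x∣ x = ≤-antisym
    (∣∣-lub (-x≤∣x∣ x) (≤-trans (≤-reflexive (solve 1 (λ x → :- (:- x) := x) refl x)) (x≤∣x∣ x)))
    (∣∣-lub (≤-trans (≤-reflexive (solve 1 (λ x → x := :- (:- x)) refl x)) (-x≤∣x∣ (- x))) (x≤∣x∣ (- x)))

  ∣x+y∣≤∣x∣+∣y∣ : ∀ x y → ∣ x + y ∣ ≤ ∣ x ∣ + ∣ y ∣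
  ∣x+y∣≤∣x∣+∣y∣ x y = ∣∣-lub
    (+-mono-≤ (x≤∣x∣ x) (x≤∣x∣ y))
    (≤-trans (≤-reflexive (solve 2 (λ x y → :- (x :+ y) := :- x :+ :- y) refl x y))
        (+-mono-≤ (-x≤∣x∣ x) (-x≤∣x∣ y)))

  ∣x-z∣≤∣x-y∣+∣y-z∣ : ∀ x y z → ∣ x - z ∣ ≤ ∣ x - y ∣ + ∣ y - z ∣
  ∣x-z∣≤∣x-y∣+∣y-z∣ x y z =
    ≤-trans (≤-reflexive (∣∣-cong (solve 3 (λ x y z → x :- z := x :- y :+ (y :- z)) refl x y z)))
        (∣x+y∣≤∣x∣+∣y∣ (x - y) (y - z))

  ∣x-y∣≈∣y-x∣ : ∀ x y → ∣ x - y ∣ ≈ ∣ y - x ∣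
  ∣x-y∣≈∣y-x∣ x y = trans (∣∣-cong (solve 2 (λ x y → x :- y := :- (y :- x)) refl x y)) (∣-x∣≈∣x∣ (y - x))

  ∣x*y∣≈∣x∣*∣y∣ : ∀ x y → ∣ x * y ∣ ≈ ∣ x ∣ * ∣ y ∣
  ∣x*y∣≈∣x∣*∣y∣ x y with ≤-total 0# x | ≤-total 0# y
  ... | inj₁ 0≤x | inj₁ 0≤y =
    trans (0≤x⇒∣x∣≈x (*-nonNeg 0≤x 0≤y)) (sym (*-cong (0≤x⇒∣x∣≈x 0≤x) (0≤x⇒∣x∣≈x 0≤y)))
  ... | inj₁ 0≤x | inj₂ y≤0 =
    trans (x≤0⇒∣x∣≈-x (≤-by (solve 2 (λ x y → :0 :- x :* y := x :* :- y) refl x y)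
        (*-nonNeg 0≤x (x≤0⇒0≤-x y≤0))))
      (trans (solve 2 (λ x y → :- (x :* y) := x :* :- y) refl x y)
          (sym (*-cong (0≤x⇒∣x∣≈x 0≤x) (x≤0⇒∣x∣≈-x y≤0))))
  ... | inj₂ x≤0 | inj₁ 0≤y =
    trans (x≤0⇒∣x∣≈-x (≤-by (solve 2 (λ x y → :0 :- x :* y := :- x :* y) refl x y)
        (*-nonNeg (x≤0⇒0≤-x x≤0) 0≤y)))
      (trans (solve 2 (λ x y → :- (x :* y) := :- x :* y) refl x y)
          (sym (*-cong (x≤0⇒∣x∣≈-x x≤0) (0≤x⇒∣x∣≈x 0≤y))))
  ... | inj₂ x≤0 | inj₂ y≤0 =
    trans (0≤x⇒∣x∣≈x (≤-trans (*-nonNeg (x≤0⇒0≤-x x≤0) (x≤0⇒0≤-x y≤0))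
        (≤-reflexive (solve 2 (λ x y → :- x :* :- y := x :* y) refl x y))))
      (trans (solve 2 (λ x y → x :* y := :- x :* :- y) refl x y)
          (sym (*-cong (x≤0⇒∣x∣≈-x x≤0) (x≤0⇒∣x∣≈-x y≤0))))

  0≤fromℕ : ∀ n → 0# ≤ fromℕ n
  0≤fromℕ zero    = ≤-refl
  0≤fromℕ (suc n) = 0≤+ 0≤1 (0≤fromℕ n)

  0<fromℕ-suc : ∀ n → 0# < fromℕ (suc n)
  0<fromℕ-suc n = 0<1+x (0≤fromℕ n)

  fromℕ-mono-≤ : ∀ {m n} → m ℕ.≤ n → fromℕ m ≤ fromℕ n
  fromℕ-mono-≤ {n = n} ℕ.z≤n = 0≤fromℕ n
  fromℕ-mono-≤ (ℕ.s≤s m≤n)   = +-monoʳ-≤ 1# (fromℕ-mono-≤ m≤n)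

  -- Were the naturals bounded, they would have a supremum `s`. Since `suc n` is natural whenever
  -- `n` is, `s - 1#` would bound them too, forcing 1 ≤ 0.
  archimedean : ∀ x → ∃ λ n → x ≤ fromℕ n
  archimedean x with em {∃ λ n → x ≤ fromℕ n}
  ... | yes found = found
  ... | no  none  = ⊥-elim (1≰0 1≤0)
    where
    Natural : ℝ → Set
    Natural y = ∃ λ n → y ≈ fromℕ n

    bounded : UpperBound Natural x
    bounded y (n , y≈n) with ≤-total (fromℕ n) x
    ... | inj₁ n≤x = ≤-trans (≤-reflexive y≈n) n≤x
    ... | inj₂ x≤n = ⊥-elim (none (n , x≤n))

    sup = supremum Natural (0# , 0 , refl) (x , bounded)
    s   = proj₁ sup

    1≤0 : 1# ≤ 0#
    1≤0 = ≤-by ((solve 1 (λ s → :0 :- :1 := s :- :1 :- s) refl s)) (gap (proj₂ (proj₂ sup) (s - 1#)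
      λ { y (n , y≈n) → ≤-trans (≤-reflexive y≈n)
            (≤-by (solve 2 (λ s n → s :- :1 :- n := s :- (:1 :+ n)) refl s (fromℕ n))
                (gap (proj₁ (proj₂ sup) (fromℕ (suc n)) (suc n , refl)))) }))

  -- The Archimedean property in the form in which repeated halving delivers it: a positive `x`
  -- would overshoot `C` as soon as `n` passes x⁻¹ (C + 1).
  bounded-multiples⇒≤0 : ∀ {x} C → (∀ n → x * fromℕ (suc n) ≤ C) → x ≤ 0#
  bounded-multiples⇒≤0 {x} C bound with ≤-total x 0#
  ... | inj₁ x≤0 = x≤0
  ... | inj₂ 0≤x with em {0# ≈ x}
  ...   | yes 0≈x = ≤-reflexive (sym 0≈x)
  ...   | no  0≉x = ⊥-elim (1≰0 (≤-by (solve 1 (λ C → :0 :- :1 := C :- (C :+ :1)) refl C) (gap (begin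
    C + 1#                      ≈⟨ *-identityˡ _ ⟨
    1# * (C + 1#)               ≈⟨ *-congʳ (⁻¹-inverse x (0<x⇒x≉0 (0≤x , 0≉x))) ⟨
    x * x ⁻¹ * (C + 1#)         ≈⟨ *-assoc _ _ _ ⟩
    x * (x ⁻¹ * (C + 1#))       ≤⟨ *-monoˡ-≤ 0≤x (proj₂ large) ⟩
    x * fromℕ (proj₁ large)     ≤⟨ *-monoˡ-≤ 0≤x (fromℕ-mono-≤ (ℕ.n≤1+n (proj₁ large))) ⟩
    x * fromℕ (suc (proj₁ large)) ≤⟨ bound (proj₁ large) ⟩
    C                           ∎))))
    where
    large = archimedean (x ⁻¹ * (C + 1#))

-- Partial sums, limits and absolute convergence.

module Limits (em : ExcludedMiddle 0ℓ) (R : CompleteOrderedField) where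

  open Probability em R
  open RealField em R
  open ≤-Reasoning ≤-poset

  -- Definitionally the sequence whose limit `∑∞` takes, so facts about `psum` apply to `exp` and
  -- `𝐄` without conversion. It unfolds at the first term; `psum-last` gives the other end.
  psum : (ℕ → ℝ) → ℕ → ℝ
  psum a n = sum (λ (i : Fin n) → a (toℕ i))

  psum-cong : ∀ {a b} → (∀ k → a k ≈ b k) → ∀ n → psum a n ≈ psum b n
  psum-cong a≈b zero    = refl
  psum-cong a≈b (suc n) = +-cong (a≈b 0) (psum-cong (a≈b ∘ suc) n)

  psum-mono : ∀ {a b} → (∀ k → a k ≤ b k) → ∀ n → psum a n ≤ psum b n
  psum-mono a≤b zero    = ≤-refl
  psum-mono a≤b (suc n) = +-mono-≤ (a≤b 0) (psum-mono (a≤b ∘ suc) n)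

  psum-nonNeg : ∀ {a} → (∀ k → 0# ≤ a k) → ∀ n → 0# ≤ psum a n
  psum-nonNeg 0≤a zero    = ≤-refl
  psum-nonNeg 0≤a (suc n) = 0≤+ (0≤a 0) (psum-nonNeg (0≤a ∘ suc) n)

  psum-last : ∀ a n → psum a (suc n) ≈ psum a n + a n
  psum-last a zero    = +-comm (a 0) 0#
  psum-last a (suc n) = trans (+-congˡ (psum-last (a ∘ suc) n)) (sym (+-assoc _ _ _))

  psum-+ : ∀ a b n → psum (λ k → a k + b k) n ≈ psum a n + psum b n
  psum-+ a b zero    = sym (+-identityˡ 0#)
  psum-+ a b (suc n) = trans (+-congˡ (psum-+ (a ∘ suc) (b ∘ suc) n))
    (solve 4 (λ a b x y → a :+ b :+ (x :+ y) := a :+ x :+ (b :+ y)) refl (a 0) (b 0) (psum (a ∘ suc) n)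
        (psum (b ∘ suc) n))

  psum-* : ∀ c a n → psum (λ k → c * a k) n ≈ c * psum a n
  psum-* c a zero    = sym (zeroʳ c)
  psum-* c a (suc n) = trans (+-congˡ (psum-* c (a ∘ suc) n)) (sym (distribˡ c _ _))

  psum-neg : ∀ a n → psum (λ k → - a k) n ≈ - psum a n
  psum-neg a zero    = (solve 0 (:0 := :- :0) refl)
  psum-neg a (suc n) = trans (+-congˡ (psum-neg (a ∘ suc) n))
    (solve 2 (λ x y → :- x :+ :- y := :- (x :+ y)) refl (a 0) (psum (a ∘ suc) n))

  psum-- : ∀ a b n → psum (λ k → a k - b k) n ≈ psum a n - psum b n
  psum-- a b n = trans (psum-+ a (λ k → - b k) n) (+-congˡ (psum-neg b n))

  ∣psum∣≤psum∣∣ : ∀ a n → ∣ psum a n ∣ ≤ psum (λ k → ∣ a k ∣) n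
  ∣psum∣≤psum∣∣ a zero    = ≤-reflexive (0≤x⇒∣x∣≈x ≤-refl)
  ∣psum∣≤psum∣∣ a (suc n) = ≤-trans (∣x+y∣≤∣x∣+∣y∣ _ _) (+-monoʳ-≤ _ (∣psum∣≤psum∣∣ (a ∘ suc) n))

  psum-split : ∀ a m n → psum a (m ℕ.+ n) ≈ psum a m + psum (a ∘ (m ℕ.+_)) n
  psum-split a zero    n = sym (+-identityˡ _)
  psum-split a (suc m) n = trans (+-congˡ (psum-split (a ∘ suc) m n)) (sym (+-assoc _ _ _))

  increasing : ∀ {s : ℕ → ℝ} → (∀ n → s n ≤ s (suc n)) → ∀ {m n} → m ℕ.≤ n → s m ≤ s n
  increasing {s} step m≤n = go (ℕ.≤⇒≤′ m≤n)
    where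
    go : ∀ {m n} → m ℕ.≤′ n → s m ≤ s n
    go (ℕ.≤′-reflexive ≡.refl) = ≤-refl
    go (ℕ.≤′-step m≤n)         = ≤-trans (go m≤n) (step _)

  psum-step : ∀ {a} → (∀ k → 0# ≤ a k) → ∀ n → psum a n ≤ psum a (suc n)
  psum-step {a} 0≤a n = ≤-trans (x≤x+y (0≤a n)) (≤-reflexive (sym (psum-last a n)))

  psum-increasing : ∀ {a} → (∀ k → 0# ≤ a k) → ∀ {m n} → m ℕ.≤ n → psum a m ≤ psum a n
  psum-increasing {a} 0≤a = increasing {psum a} (psum-step 0≤a)

  ⟶-intro : ∀ {s l} → (∀ ε → 0# < ε → ∃ λ N → ∀ n → N ℕ.≤ n → ∣ s n - l ∣ ≤ ε) → s ⟶ l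
  ⟶-intro close ε 0<ε = let N , h = close (½ * ε) (0<½x 0<ε) in
    N , λ n N≤n → ≤-<-trans (h n N≤n) (½x<x 0<ε)

  ⟶-cong : ∀ {s t l m} → (∀ n → s n ≈ t n) → l ≈ m → s ⟶ l → t ⟶ m
  ⟶-cong s≈t l≈m s⟶l ε 0<ε = let N , h = s⟶l ε 0<ε in
    N , λ n N≤n → ≤-<-trans (≤-reflexive (∣∣-cong (+-cong (sym (s≈t n)) (-‿cong (sym l≈m))))) (h n N≤n)

  ⟶-- : ∀ {s t l m} → s ⟶ l → t ⟶ m → (λ n → s n - t n) ⟶ (l - m)
  ⟶-- {s} {t} {l} {m} s⟶l t⟶m = ⟶-intro λ ε 0<ε →
    let M , f = s⟶l (½ * ε) (0<½x 0<ε)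
        N , g = t⟶m (½ * ε) (0<½x 0<ε)
    in M ℕ.⊔ N , λ n M⊔N≤n → begin
      ∣ s n - t n - (l - m) ∣
        ≈⟨ ∣∣-cong (solve 4 (λ s t l m → s :- t :- (l :- m) := s :- l :+ :- (t :- m)) refl (s n) (t n) l m) ⟩
      ∣ s n - l + - (t n - m) ∣         ≤⟨ ∣x+y∣≤∣x∣+∣y∣ _ _ ⟩
      ∣ s n - l ∣ + ∣ - (t n - m) ∣     ≤⟨ +-mono-≤ (<⇒≤ (f n (ℕ.≤-trans (ℕ.m≤m⊔n M N) M⊔N≤n)))
                                                    (≤-trans (≤-reflexive (∣-x∣≈∣x∣ _))
                                                        (<⇒≤ (g n (ℕ.≤-trans (ℕ.m≤n⊔m M N) M⊔N≤n)))) ⟩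
      ½ * ε + ½ * ε                     ≈⟨ ½x+½x≈x ε ⟩
      ε                                 ∎

  ⟶-≤ : ∀ {s l u} → s ⟶ l → (∀ n → s n ≤ u) → l ≤ u
  ⟶-≤ {s} {l} {u} s⟶l s≤u with em {l ≤ u}
  ... | yes l≤u = l≤u
  -- The supposed excess `l - u` itself serves as ε.
  ... | no  l≰u = let N , h = s⟶l (l - u) (gap< (≰⇒> l≰u)) in
    ⊥-elim (<⇒≱ (h N ℕ.≤-refl) (begin
      l - u
        ≤⟨ ≤-by (solve 3 (λ l u s → :- (s :- l) :- (l :- u) := u :- s) refl l u (s N)) (gap (s≤u N)) ⟩
      - (s N - l)        ≤⟨ -x≤∣x∣ _ ⟩
      ∣ s N - l ∣        ∎))

  ⟶-mono : ∀ {s t l m} → s ⟶ l → t ⟶ m → (∀ n → s n ≤ t n) → l ≤ m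
  ⟶-mono {s} {t} {l} {m} s⟶l t⟶m s≤t = ≤-by (solve 2 (λ l m → m :- l := :0 :- (l :- m)) refl l m) (gap
    (⟶-≤ (⟶-- s⟶l t⟶m) λ n → ≤-by (solve 2 (λ s t → :0 :- (s :- t) := t :- s) refl (s n) (t n)) (gap (s≤t n))))

  ⟶-unique : ∀ {s l m} → s ⟶ l → s ⟶ m → l ≈ m
  ⟶-unique s⟶l s⟶m = ≤-antisym (⟶-mono s⟶l s⟶m λ _ → ≤-refl) (⟶-mono s⟶m s⟶l λ _ → ≤-refl)

  ⟶-suc : ∀ {s l} → (s ∘ suc) ⟶ l → s ⟶ l
  ⟶-suc s⟶l ε 0<ε = let N , h = s⟶l ε 0<ε in suc N , λ { (suc n) (ℕ.s≤s N≤n) → h n N≤n }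

  ⟶-const : ∀ c → (λ _ → c) ⟶ c
  ⟶-const c = ⟶-intro λ ε 0<ε → 0 , λ _ _ →
    ≤-trans (≤-reflexive (trans (∣∣-cong (-‿inverseʳ c)) (0≤x⇒∣x∣≈x ≤-refl))) (<⇒≤ 0<ε)

  ⟶-shift : ∀ {s l} m → s ⟶ l → (s ∘ (m ℕ.+_)) ⟶ l
  ⟶-shift m s⟶l ε 0<ε = let N , h = s⟶l ε 0<ε in
    N , λ n N≤n → h (m ℕ.+ n) (ℕ.≤-trans N≤n (ℕ.m≤n+m n m))

  psum≤limit : ∀ {a A} → (∀ k → 0# ≤ a k) → psum a ⟶ A → ∀ n → psum a n ≤ A
  psum≤limit {a} {A} 0≤a sum⟶A n = ⟶-mono (⟶-const (psum a n)) (⟶-shift n sum⟶A) λ m →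
    psum-increasing 0≤a (ℕ.m≤m+n n m)

  lim-≈ : ∀ {s l} → s ⟶ l → lim s ≈ l
  lim-≈ {s} {l} s⟶l with em {∃ λ l → s ⟶ l}
  ... | yes (m , s⟶m) = ⟶-unique s⟶m s⟶l
  ... | no  diverges  = ⊥-elim (diverges (l , s⟶l))

  -- Any `N` above C / ε works. In this form a limit is proved by one uniform inequality, with no ε
  -- on the caller's side.
  ⟶-rate : ∀ {s l} C → (∀ n → ∣ s n - l ∣ * fromℕ (suc n) ≤ C) → s ⟶ l
  ⟶-rate {s} {l} C bound = ⟶-intro λ ε 0<ε →
    let N , large = archimedean (C * ε ⁻¹)
    in N , λ n N≤n → *-cancelˡ-≤ (0<fromℕ-suc n) (begin
      fromℕ (suc n) * ∣ s n - l ∣     ≈⟨ *-comm _ _ ⟩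
      ∣ s n - l ∣ * fromℕ (suc n)     ≤⟨ bound n ⟩
      C                               ≈⟨ *-identityʳ C ⟨
      C * 1#                          ≈⟨ *-congˡ (⁻¹-inverse ε (0<x⇒x≉0 0<ε)) ⟨
      C * (ε * ε ⁻¹)                  ≈⟨ (solve 3 (λ C ε i → C :* (ε :* i) := C :* i :* ε) refl C ε (ε ⁻¹)) ⟩
      C * ε ⁻¹ * ε                    ≤⟨ *-monoʳ-≤ (<⇒≤ 0<ε) (≤-trans large (fromℕ-mono-≤ (ℕ.m≤n⇒m≤1+n N≤n))) ⟩
      fromℕ (suc n) * ε               ∎)

  monotone-convergence : ∀ {s : ℕ → ℝ} C → (∀ n → s n ≤ s (suc n)) → (∀ n → s n ≤ C) → ∃ λ l → s ⟶ l
  monotone-convergence {s} C step s≤C = l , ⟶-intro close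
    where
    Value : ℝ → Set
    Value y = ∃ λ n → y ≈ s n

    sup = supremum Value (s 0 , 0 , refl) (C , λ { y (n , y≈sn) → ≤-trans (≤-reflexive y≈sn) (s≤C n) })
    l   = proj₁ sup

    s≤l : ∀ n → s n ≤ l
    s≤l n = proj₁ (proj₂ sup) (s n) (n , refl)

    near : ∀ ε → 0# < ε → ∃ λ n → l - ε ≤ s n
    near ε 0<ε with em {∃ λ n → l - ε ≤ s n}
    ... | yes found = found
    ... | no  none  = ⊥-elim (<⇒≱ 0<ε (≤-by (solve 2 (λ l ε → :0 :- ε := l :- ε :- l) refl l ε)
        (gap (proj₂ (proj₂ sup) (l - ε)
      λ { y (n , y≈sn) → ≤-trans (≤-reflexive y≈sn) (<⇒≤ (≰⇒> λ l-ε≤sn → none (n , l-ε≤sn))) }))))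

    close : ∀ ε → 0# < ε → ∃ λ N → ∀ n → N ℕ.≤ n → ∣ s n - l ∣ ≤ ε
    close ε 0<ε = let N , l-ε≤sN = near ε 0<ε in N , λ n N≤n → ∣∣-lub
      (≤-trans (≤-by (solve 2 (λ l s → :0 :- (s :- l) := l :- s) refl l (s n)) (gap (s≤l n))) (<⇒≤ 0<ε))
      (≤-by (solve 3 (λ l ε s → ε :- (:- (s :- l)) := s :- (l :- ε)) refl l ε (s n))
          (gap (≤-trans l-ε≤sN (increasing {s} step N≤n))))

  -- Writes a = (a + ∣a∣) - ∣a∣, a difference of two series with non-negative terms and bounded
  -- partial sums.
  absolute-convergence : ∀ {a} C → (∀ n → psum (λ k → ∣ a k ∣) n ≤ C) → ∃ λ l → psum a ⟶ l
  absolute-convergence {a} C bound = proj₁ F - proj₁ G , ⟶-cong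
    (λ n → trans (+-congʳ (psum-+ a ∣a∣ n)) (solve 2 (λ x y → x :+ y :- y := x) refl (psum a n) (psum ∣a∣ n)))
        refl
    (⟶-- (proj₂ F) (proj₂ G))
    where
    ∣a∣ : ℕ → ℝ
    ∣a∣ k = ∣ a k ∣

    G : ∃ λ l → psum ∣a∣ ⟶ l
    G = monotone-convergence C (psum-step (0≤∣x∣ ∘ a)) bound

    F : ∃ λ l → psum (λ k → a k + ∣a∣ k) ⟶ l
    F = monotone-convergence (C + C)
      (psum-step λ k → ≤-by (solve 2 (λ x y → x :+ y :- :0 := y :- (:- x)) refl (a k) (∣a∣ k))
          (gap (-x≤∣x∣ (a k))))
      (λ n → ≤-trans (≤-reflexive (psum-+ a ∣a∣ n))
        (+-mono-≤ (≤-trans (psum-mono (x≤∣x∣ ∘ a) n) (bound n)) (bound n)))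

-- Algebra of finite convolutions.

module Convolution (em : ExcludedMiddle 0ℓ) (R : CompleteOrderedField) where

  open Probability em R
  open RealField em R
  open Limits em R
  open ≤-Reasoning ≤-poset

  -- The inductions on convolutions rest on the definitional unfolding of `(f ⊞ g) (suc n)` to
  -- `f 0 * g (suc n) + ((f ∘ suc) ⊞ g) n`; hence the left factor varies in them.
  ⊞-cong : ∀ {f f′ g g′} → (∀ k → f k ≈ f′ k) → (∀ k → g k ≈ g′ k) → ∀ n → (f ⊞ g) n ≈ (f′ ⊞ g′) n
  ⊞-cong f≈ g≈ zero    = +-congʳ (*-cong (f≈ 0) (g≈ 0))
  ⊞-cong f≈ g≈ (suc n) = +-cong (*-cong (f≈ 0) (g≈ (suc n))) (⊞-cong (f≈ ∘ suc) g≈ n)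

  ⊞-nonNeg : ∀ {f g} → (∀ k → 0# ≤ f k) → (∀ k → 0# ≤ g k) → ∀ n → 0# ≤ (f ⊞ g) n
  ⊞-nonNeg 0≤f 0≤g zero    = 0≤+ (*-nonNeg (0≤f 0) (0≤g 0)) ≤-refl
  ⊞-nonNeg 0≤f 0≤g (suc n) = 0≤+ (*-nonNeg (0≤f 0) (0≤g (suc n))) (⊞-nonNeg (0≤f ∘ suc) 0≤g n)

  ⊞-monoʳ : ∀ {f g h} → (∀ k → 0# ≤ f k) → (∀ k → g k ≤ h k) → ∀ n → (f ⊞ g) n ≤ (f ⊞ h) n
  ⊞-monoʳ 0≤f g≤h zero    = +-mono-≤ (*-monoˡ-≤ (0≤f 0) (g≤h 0)) ≤-refl
  ⊞-monoʳ 0≤f g≤h (suc n) = +-mono-≤ (*-monoˡ-≤ (0≤f 0) (g≤h (suc n))) (⊞-monoʳ (0≤f ∘ suc) g≤h n)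

  ⊞-last : ∀ f g n → (f ⊞ g) (suc n) ≈ f (suc n) * g 0 + (f ⊞ (g ∘ suc)) n
  ⊞-last f g zero = (solve 4 (λ a b c d → a :* d :+ (b :* c :+ :0) := b :* c :+ (a :* d :+ :0)) refl (f 0) (f 1)
      (g 0) (g 1))
  ⊞-last f g (suc n) = trans (+-congˡ (⊞-last (f ∘ suc) g n))
    (solve 3 (λ x y z → x :+ (y :+ z) := y :+ (x :+ z)) refl (f 0 * g (suc (suc n))) (f (suc (suc n)) * g 0)
        (((f ∘ suc) ⊞ (g ∘ suc)) n))

  ⊞-comm : ∀ f g n → (f ⊞ g) n ≈ (g ⊞ f) n
  ⊞-comm f g zero    = +-congʳ (*-comm (f 0) (g 0))
  ⊞-comm f g (suc n) = trans (+-cong (*-comm (f 0) (g (suc n))) (⊞-comm (f ∘ suc) g n)) (sym (⊞-last g f n))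

  ⊞-+ˡ : ∀ f g h n → ((λ k → f k + g k) ⊞ h) n ≈ (f ⊞ h) n + (g ⊞ h) n
  ⊞-+ˡ f g h zero = (solve 3 (λ x y z → (x :+ y) :* z :+ :0 := x :* z :+ :0 :+ (y :* z :+ :0)) refl (f 0) (g 0)
      (h 0))
  ⊞-+ˡ f g h (suc n) = trans (+-congˡ (⊞-+ˡ (f ∘ suc) (g ∘ suc) h n))
    (solve 5 (λ x y z u v → (x :+ y) :* z :+ (u :+ v) := x :* z :+ u :+ (y :* z :+ v)) refl (f 0) (g 0)
        (h (suc n)) (((f ∘ suc) ⊞ h) n) (((g ∘ suc) ⊞ h) n))

  ⊞-*ˡ : ∀ c f g n → ((λ k → c * f k) ⊞ g) n ≈ c * (f ⊞ g) n
  ⊞-*ˡ c f g zero    = (solve 3 (λ c x y → c :* x :* y :+ :0 := c :* (x :* y :+ :0)) refl c (f 0) (g 0))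
  ⊞-*ˡ c f g (suc n) = trans (+-congˡ (⊞-*ˡ c (f ∘ suc) g n))
    (solve 4 (λ c x y z → c :* x :* y :+ c :* z := c :* (x :* y :+ z)) refl c (f 0) (g (suc n))
        (((f ∘ suc) ⊞ g) n))

  ⊞-+ʳ : ∀ f g h n → (f ⊞ (λ k → g k + h k)) n ≈ (f ⊞ g) n + (f ⊞ h) n
  ⊞-+ʳ f g h n = trans (⊞-comm f (λ k → g k + h k) n)
      (trans (⊞-+ˡ g h f n) (+-cong (⊞-comm g f n) (⊞-comm h f n)))

  ⊞-*ʳ : ∀ c f g n → (f ⊞ (λ k → c * g k)) n ≈ c * (f ⊞ g) n
  ⊞-*ʳ c f g n = trans (⊞-comm f (λ k → c * g k) n) (trans (⊞-*ˡ c g f n) (*-congˡ (⊞-comm g f n)))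

  -- Partial summation is itself a convolution, with generating function x / (1 - x), so by
  -- associativity it can be moved onto one factor.
  psum-⊞ : ∀ f g n → psum (f ⊞ g) n ≈ (f ⊞ psum g) n
  psum-⊞ f g zero    = (solve 1 (λ x → :0 := x :* :0 :+ :0) refl (f 0))
  psum-⊞ f g (suc n) = begin-equality
    f 0 * g 0 + 0# + psum (λ k → f 0 * g (suc k) + ((f ∘ suc) ⊞ g) k) n
      ≈⟨ +-congˡ (trans (psum-+ (λ k → f 0 * g (suc k)) ((f ∘ suc) ⊞ g) n)
                        (+-cong (psum-* (f 0) (g ∘ suc) n) (psum-⊞ (f ∘ suc) g n))) ⟩
    f 0 * g 0 + 0# + (f 0 * psum (g ∘ suc) n + ((f ∘ suc) ⊞ psum g) n)
      ≈⟨ (solve 4 (λ x y z w → x :* y :+ :0 :+ (x :* z :+ w) := x :* (y :+ z) :+ w) refl (f 0) (g 0)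
          (psum (g ∘ suc) n) (((f ∘ suc) ⊞ psum g) n)) ⟩
    f 0 * (g 0 + psum (g ∘ suc) n) + ((f ∘ suc) ⊞ psum g) n ∎

  ⊞-const : ∀ f c n → (f ⊞ (λ _ → c)) n ≈ c * psum f (suc n)
  ⊞-const f c zero    = (solve 2 (λ x c → x :* c :+ :0 := c :* (x :+ :0)) refl (f 0) c)
  ⊞-const f c (suc n) = trans (+-congˡ (⊞-const (f ∘ suc) c n))
    (solve 3 (λ x c y → x :* c :+ c :* y := c :* (x :+ y)) refl (f 0) c (psum (f ∘ suc) (suc n)))

  ∣⊞∣≤∣∣⊞∣∣ : ∀ f g n → ∣ (f ⊞ g) n ∣ ≤ ((λ k → ∣ f k ∣) ⊞ (λ k → ∣ g k ∣)) n
  ∣⊞∣≤∣∣⊞∣∣ f g zero = ≤-trans (∣x+y∣≤∣x∣+∣y∣ _ _)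
    (+-mono-≤ (≤-reflexive (∣x*y∣≈∣x∣*∣y∣ _ _)) (≤-reflexive (0≤x⇒∣x∣≈x ≤-refl)))
  ∣⊞∣≤∣∣⊞∣∣ f g (suc n) = ≤-trans (∣x+y∣≤∣x∣+∣y∣ _ _)
    (+-mono-≤ (≤-reflexive (∣x*y∣≈∣x∣*∣y∣ _ _)) (∣⊞∣≤∣∣⊞∣∣ (f ∘ suc) g n))

  -- Series with geometric weights and their Cauchy products.

  2^ : ℕ → ℝ
  2^ n = (1# + 1#) ^ n

  1≤2^ : ∀ n → 1# ≤ 2^ n
  1≤2^ zero    = ≤-refl
  1≤2^ (suc n) = ≤-trans (1≤2^ n) (≤-by (solve 1 (λ x → :2 :* x :- x := x :- :1 :+ :1) refl (2^ n))
      (0≤+ (gap (1≤2^ n)) 0≤1))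

  0≤2^ : ∀ n → 0# ≤ 2^ n
  0≤2^ n = ≤-trans 0≤1 (1≤2^ n)

  0<2^ : ∀ n → 0# < 2^ n
  0<2^ n = <-≤-trans (0≤1 , 0≉1) (1≤2^ n)

  2^-step : ∀ n → 2^ n ≤ 2^ (suc n)
  2^-step n = ≤-by (solve 1 (λ x → :2 :* x :- x := x) refl (2^ n)) (0≤2^ n)

  1+n≤2^ : ∀ n → fromℕ (suc n) ≤ 2^ n
  1+n≤2^ zero    = ≤-reflexive (+-identityʳ 1#)
  1+n≤2^ (suc n) = ≤-trans (+-mono-≤ (1≤2^ n) (1+n≤2^ n))
      (≤-reflexive (solve 1 (λ x → x :+ x := :2 :* x) refl (2^ n)))

  weigh : (ℕ → ℝ) → ℕ → ℝ
  weigh a k = a k * 2^ k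

  weigh-nonNeg : ∀ {a} → (∀ k → 0# ≤ a k) → ∀ k → 0# ≤ weigh a k
  weigh-nonNeg 0≤a k = *-nonNeg (0≤a k) (0≤2^ k)

  -- Geometric weights are multiplicative along a convolution, because 2ⁱ 2ⁿ⁻ⁱ = 2ⁿ.
  weigh-⊞ : ∀ f g n → (weigh f ⊞ weigh g) n ≈ weigh (f ⊞ g) n
  weigh-⊞ f g zero = (solve 2 (λ x y → x :* :1 :* (y :* :1) :+ :0 := (x :* y :+ :0) :* :1) refl (f 0) (g 0))
  weigh-⊞ f g (suc n) = begin-equality
    weigh f 0 * weigh g (suc n) + ((weigh f ∘ suc) ⊞ weigh g) n
      ≈⟨ +-congˡ (trans (⊞-cong {g = weigh g}
          (λ k → (solve 2 (λ x y → x :* (:2 :* y) := :2 :* (x :* y)) refl (f (suc k)) (2^ k))) (λ _ → refl) n)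
                        (⊞-*ˡ (1# + 1#) (weigh (f ∘ suc)) (weigh g) n)) ⟩
    weigh f 0 * weigh g (suc n) + (1# + 1#) * (weigh (f ∘ suc) ⊞ weigh g) n
      ≈⟨ +-congˡ (*-congˡ (weigh-⊞ (f ∘ suc) g n)) ⟩
    weigh f 0 * weigh g (suc n) + (1# + 1#) * weigh ((f ∘ suc) ⊞ g) n
      ≈⟨ (solve 4 (λ x y z w → x :* :1 :* (y :* (:2 :* z)) :+ :2 :* (w :* z) := (x :* y :+ w) :* (:2 :* z)) refl
          (f 0) (g (suc n)) (2^ n) (((f ∘ suc) ⊞ g) n)) ⟩
    weigh (f ⊞ g) (suc n) ∎

  abs : (ℕ → ℝ) → ℕ → ℝ
  abs a k = ∣ a k ∣

  -- The weights 2ᵏ make this class of series closed under convolution by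
  -- estimates on a single convolution sum, without double series.
  infix 4 _⇝_
  record _⇝_ (a : ℕ → ℝ) (A : ℝ) : Set where
    field
      bound  : ℝ
      moment : ∀ n → psum (weigh (abs a)) n ≤ bound
      tail   : ∀ n → ∣ A - psum a n ∣ * 2^ n ≤ bound

    0≤bound : 0# ≤ bound
    0≤bound = moment 0

  open _⇝_ public

  weigh-tail : ∀ {a} → (∀ k → 0# ≤ a k) → ∀ m n → psum (a ∘ (m ℕ.+_)) n * 2^ m ≤ psum (weigh a ∘ (m ℕ.+_)) n
  weigh-tail {a} 0≤a m zero    = ≤-reflexive (zeroˡ _)
  weigh-tail {a} 0≤a m (suc n) = begin
    psum (a ∘ (m ℕ.+_)) (suc n) * 2^ m
      ≈⟨ trans (*-congʳ (psum-last (a ∘ (m ℕ.+_)) n)) (distribʳ _ _ _) ⟩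
    psum (a ∘ (m ℕ.+_)) n * 2^ m + a (m ℕ.+ n) * 2^ m
      ≤⟨ +-mono-≤ (weigh-tail 0≤a m n) (*-monoˡ-≤ (0≤a _) (increasing {2^} 2^-step (ℕ.m≤m+n m n))) ⟩
    psum (weigh a ∘ (m ℕ.+_)) n + weigh a (m ℕ.+ n)
      ≈⟨ psum-last (weigh a ∘ (m ℕ.+_)) n ⟨
    psum (weigh a ∘ (m ℕ.+_)) (suc n) ∎

  -- The moment bound already yields the tail bound: beyond index `m` every weight is at least 2ᵐ,
  -- so each block of terms starting there is at most C / 2ᵐ in absolute value, and this survives
  -- the passage to the limit in `psum a (m + n)`.
  ⇝-intro : ∀ {a A} C → (∀ n → psum (weigh (abs a)) n ≤ C) → psum a ⟶ A → a ⇝ A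
  ⇝-intro {a} {A} C moment≤C sum⟶A = record { bound = C ; moment = moment≤C ; tail = tail≤C }
    where
    module _ (m : ℕ) where
      u : ℝ
      u = C * 2^ m ⁻¹

      block : ∀ n → ∣ psum (a ∘ (m ℕ.+_)) n ∣ ≤ u
      block n = *-cancelˡ-≤ (0<2^ m) (begin
        2^ m * ∣ psum (a ∘ (m ℕ.+_)) n ∣               ≈⟨ *-comm _ _ ⟩
        ∣ psum (a ∘ (m ℕ.+_)) n ∣ * 2^ m               ≤⟨ *-monoʳ-≤ (0≤2^ m) (∣psum∣≤psum∣∣ (a ∘ (m ℕ.+_)) n) ⟩
        psum (abs a ∘ (m ℕ.+_)) n * 2^ m               ≤⟨ weigh-tail {abs a} (0≤∣x∣ ∘ a) m n ⟩
        psum (weigh (abs a) ∘ (m ℕ.+_)) n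
          ≤⟨ ≤-by (solve 2 (λ x y → x :+ y :- y := x) refl (psum (weigh (abs a)) m)
              (psum (weigh (abs a) ∘ (m ℕ.+_)) n))
                                                            (psum-nonNeg (weigh-nonNeg (0≤∣x∣ ∘ a)) m) ⟩
        psum (weigh (abs a)) m + psum (weigh (abs a) ∘ (m ℕ.+_)) n  ≈⟨ psum-split (weigh (abs a)) m n ⟨
        psum (weigh (abs a)) (m ℕ.+ n)                 ≤⟨ moment≤C (m ℕ.+ n) ⟩
        C                                              ≈⟨ *-identityʳ C ⟨
        C * 1#                                         ≈⟨ *-congˡ (⁻¹-inverse (2^ m) (0<x⇒x≉0 (0<2^ m))) ⟨
        C * (2^ m * 2^ m ⁻¹)
          ≈⟨ (solve 3 (λ C x y → C :* (x :* y) := x :* (C :* y)) refl C (2^ m) (2^ m ⁻¹)) ⟩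
        2^ m * u                                       ∎)

      near : ∣ A - psum a m ∣ ≤ u
      near = ∣∣-lub
        (≤-by (solve 3 (λ u A x → u :- (A :- x) := x :+ u :- A) refl u A (psum a m))
            (gap (⟶-≤ shifted λ n → ≤-trans (≤-reflexive (psum-split a m n))
          (+-monoʳ-≤ _ (≤-trans (x≤∣x∣ _) (block n))))))
        (≤-by (solve 3 (λ u A x → u :- (:- (A :- x)) := A :- (x :- u)) refl u A (psum a m))
            (gap (⟶-mono (⟶-const (psum a m - u)) shifted λ n →
          ≤-trans (+-monoʳ-≤ _ (≤-trans (neg-mono-≤ (≤-trans (-x≤∣x∣ _) (block n)))
              (≤-reflexive (solve 1 (λ x → :- (:- x) := x) refl (psum (a ∘ (m ℕ.+_)) n)))))
                  (≤-reflexive (sym (psum-split a m n))))))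
        where
        shifted : (λ n → psum a (m ℕ.+ n)) ⟶ A
        shifted = ⟶-shift m sum⟶A

      tail≤C : ∣ A - psum a m ∣ * 2^ m ≤ C
      tail≤C = begin
        ∣ A - psum a m ∣ * 2^ m   ≤⟨ *-monoʳ-≤ (0≤2^ m) near ⟩
        C * 2^ m ⁻¹ * 2^ m
          ≈⟨ (solve 3 (λ C x y → C :* y :* x := C :* (x :* y)) refl C (2^ m) (2^ m ⁻¹)) ⟩
        C * (2^ m * 2^ m ⁻¹)      ≈⟨ *-congˡ (⁻¹-inverse (2^ m) (0<x⇒x≉0 (0<2^ m))) ⟩
        C * 1#                    ≈⟨ *-identityʳ C ⟩
        C                         ∎

  moment⇒convergent : ∀ {a} C → (∀ n → psum (weigh (abs a)) n ≤ C) → ∃ λ A → psum a ⟶ A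
  moment⇒convergent {a} C moment≤C = absolute-convergence {a} C λ n →
    ≤-trans (psum-mono {abs a} {weigh (abs a)} (λ k → ≤-trans (≤-reflexive (sym (*-identityʳ _)))
        (*-monoˡ-≤ (0≤∣x∣ (a k)) (1≤2^ k))) n) (moment≤C n)

  -- As n + 1 ≤ 2ⁿ, the geometric tail bound is in particular a rate C / (n + 1).
  ⇝⇒⟶ : ∀ {a A} → a ⇝ A → psum a ⟶ A
  ⇝⇒⟶ {a} {A} a⇝A = ⟶-rate (bound a⇝A) λ n → ≤-trans
    (*-mono-≤ (0≤∣x∣ _) (≤-reflexive (∣x-y∣≈∣y-x∣ _ _)) (0≤fromℕ (suc n)) (1+n≤2^ n)) (tail a⇝A n)

  ⇝-unique : ∀ {a A B} → a ⇝ A → a ⇝ B → A ≈ B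
  ⇝-unique a⇝A a⇝B = ⟶-unique (⇝⇒⟶ a⇝A) (⇝⇒⟶ a⇝B)

  ⇝-cong : ∀ {a b A B} → (∀ k → a k ≈ b k) → A ≈ B → a ⇝ A → b ⇝ B
  ⇝-cong {a} {b} a≈b A≈B a⇝A = record
    { bound  = bound a⇝A
    ; moment = λ n → ≤-trans (≤-reflexive (psum-cong {weigh (abs b)} {weigh (abs a)}
        (λ k → *-congʳ (∣∣-cong (sym (a≈b k)))) n)) (moment a⇝A n)
    ; tail   = λ n → ≤-trans (≤-reflexive
        (*-congʳ (∣∣-cong (+-cong (sym A≈B) (-‿cong (psum-cong {b} {a} (sym ∘ a≈b) n)))))) (tail a⇝A n)
    }

  ⇝-* : ∀ {a A} c → a ⇝ A → (λ k → c * a k) ⇝ c * A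
  ⇝-* {a} {A} c a⇝A = record
    { bound  = ∣ c ∣ * bound a⇝A
    ; moment = λ n → begin
        psum (weigh (abs (λ k → c * a k))) n
          ≈⟨ psum-cong (λ k → trans (*-congʳ (∣x*y∣≈∣x∣*∣y∣ c (a k))) (*-assoc ∣ c ∣ ∣ a k ∣ (2^ k))) n ⟩
        psum (λ k → ∣ c ∣ * weigh (abs a) k) n      ≈⟨ psum-* ∣ c ∣ (weigh (abs a)) n ⟩
        ∣ c ∣ * psum (weigh (abs a)) n              ≤⟨ *-monoˡ-≤ (0≤∣x∣ c) (moment a⇝A n) ⟩
        ∣ c ∣ * bound a⇝A                           ∎
    ; tail   = λ n → begin
        ∣ c * A - psum (λ k → c * a k) n ∣ * 2^ n
          ≈⟨ *-congʳ (∣∣-cong (trans (+-congˡ (-‿cong (psum-* c a n)))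
              (solve 3 (λ c A x → c :* A :- c :* x := c :* (A :- x)) refl c A (psum a n)))) ⟩
        ∣ c * (A - psum a n) ∣ * 2^ n               ≈⟨ trans (*-congʳ (∣x*y∣≈∣x∣*∣y∣ c _)) (*-assoc _ _ _) ⟩
        ∣ c ∣ * (∣ A - psum a n ∣ * 2^ n)           ≤⟨ *-monoˡ-≤ (0≤∣x∣ c) (tail a⇝A n) ⟩
        ∣ c ∣ * bound a⇝A                           ∎
    }

  ⇝-+ : ∀ {a b A B} → a ⇝ A → b ⇝ B → (λ k → a k + b k) ⇝ A + B
  ⇝-+ {a} {b} {A} {B} a⇝A b⇝B = record
    { bound  = bound a⇝A + bound b⇝B
    ; moment = λ n → begin
        psum (weigh (abs (λ k → a k + b k))) n
          ≤⟨ psum-mono (λ k → ≤-trans (*-monoʳ-≤ (0≤2^ k) (∣x+y∣≤∣x∣+∣y∣ (a k) (b k)))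
              (≤-reflexive (distribʳ _ _ _))) n ⟩
        psum (λ k → weigh (abs a) k + weigh (abs b) k) n
          ≈⟨ psum-+ (weigh (abs a)) (weigh (abs b)) n ⟩
        psum (weigh (abs a)) n + psum (weigh (abs b)) n
          ≤⟨ +-mono-≤ (moment a⇝A n) (moment b⇝B n) ⟩
        bound a⇝A + bound b⇝B ∎
    ; tail   = λ n → begin
        ∣ A + B - psum (λ k → a k + b k) n ∣ * 2^ n
          ≈⟨ *-congʳ (∣∣-cong (trans (+-congˡ (-‿cong (psum-+ a b n)))
              (solve 4 (λ A B x y → A :+ B :- (x :+ y) := A :- x :+ (B :- y)) refl A B (psum a n)
              (psum b n)))) ⟩
        ∣ A - psum a n + (B - psum b n) ∣ * 2^ n
          ≤⟨ *-monoʳ-≤ (0≤2^ n) (∣x+y∣≤∣x∣+∣y∣ _ _) ⟩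
        (∣ A - psum a n ∣ + ∣ B - psum b n ∣) * 2^ n
          ≈⟨ distribʳ _ _ _ ⟩
        ∣ A - psum a n ∣ * 2^ n + ∣ B - psum b n ∣ * 2^ n
          ≤⟨ +-mono-≤ (tail a⇝A n) (tail b⇝B n) ⟩
        bound a⇝A + bound b⇝B ∎
    }

  -- By `psum-⊞` the error of the product splits into the tail of `f` times `G`, plus the
  -- convolution of `f` with the tails of `g`. The moment estimate has the same shape as the second
  -- piece, so `weighted-average` serves both.
  ⇝-⊞ : ∀ {f g F G} → f ⇝ F → g ⇝ G → f ⊞ g ⇝ F * G
  ⇝-⊞ {f} {g} {F} {G} f⇝F g⇝G = record
    { bound  = bound f⇝F * ∣ G ∣ + bound g⇝G * bound f⇝F
    ; moment = λ n → begin
        psum (weigh (abs (f ⊞ g))) n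
          ≤⟨ psum-mono (λ k → *-monoʳ-≤ (0≤2^ k) (∣⊞∣≤∣∣⊞∣∣ f g k)) n ⟩
        psum (weigh (abs f ⊞ abs g)) n                     ≈⟨ psum-cong (weigh-⊞ (abs f) (abs g)) n ⟨
        psum (weigh (abs f) ⊞ weigh (abs g)) n             ≈⟨ psum-⊞ (weigh (abs f)) (weigh (abs g)) n ⟩
        (weigh (abs f) ⊞ psum (weigh (abs g))) n           ≤⟨ weighted-average n (moment g⇝G) ⟩
        bound g⇝G * bound f⇝F                              ≤⟨ x≤x+y (*-nonNeg (0≤bound f⇝F) (0≤∣x∣ G)) ⟩
        bound g⇝G * bound f⇝F + bound f⇝F * ∣ G ∣          ≈⟨ +-comm _ _ ⟩
        bound f⇝F * ∣ G ∣ + bound g⇝G * bound f⇝F          ∎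
    ; tail   = λ n → begin
        ∣ F * G - psum (f ⊞ g) n ∣ * 2^ n
          ≈⟨ *-congʳ (∣∣-cong (remainder n)) ⟩
        ∣ (F - psum f (suc n)) * G + (f ⊞ (λ k → G - psum g k)) n ∣ * 2^ n
          ≤⟨ *-monoʳ-≤ (0≤2^ n) (∣x+y∣≤∣x∣+∣y∣ _ _) ⟩
        (∣ (F - psum f (suc n)) * G ∣ + ∣ (f ⊞ (λ k → G - psum g k)) n ∣) * 2^ n
          ≤⟨ *-monoʳ-≤ (0≤2^ n) (+-mono-≤ (≤-reflexive (∣x*y∣≈∣x∣*∣y∣ _ _))
              (∣⊞∣≤∣∣⊞∣∣ f (λ k → G - psum g k) n)) ⟩
        (∣ F - psum f (suc n) ∣ * ∣ G ∣ + (abs f ⊞ (λ k → ∣ G - psum g k ∣)) n) * 2^ n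
          ≈⟨ (solve 4 (λ x y z w → (x :* y :+ z) :* w := x :* w :* y :+ z :* w) refl (∣ F - psum f (suc n) ∣)
              (∣ G ∣) ((abs f ⊞ (λ k → ∣ G - psum g k ∣)) n) (2^ n)) ⟩
        ∣ F - psum f (suc n) ∣ * 2^ n * ∣ G ∣ + weigh (abs f ⊞ (λ k → ∣ G - psum g k ∣)) n
          ≤⟨ +-mono-≤
               -- The tail of `f` enters at index n + 1 but carries only the weight 2ⁿ.
               (*-monoʳ-≤ (0≤∣x∣ G) (≤-trans (*-monoˡ-≤ (0≤∣x∣ _) (2^-step n)) (tail f⇝F (suc n))))
               (≤-trans (≤-reflexive (sym (weigh-⊞ (abs f) (λ k → ∣ G - psum g k ∣) n)))
                   (weighted-average n (tail g⇝G))) ⟩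
        bound f⇝F * ∣ G ∣ + bound g⇝G * bound f⇝F ∎
    }
    where
    -- Applied with `h` the weighted partial sums of ∣g∣ and with `h` the weighted tails of `g`;
    -- both are bounded by `bound g⇝G`.
    weighted-average : ∀ {h} n → (∀ k → h k ≤ bound g⇝G) → (weigh (abs f) ⊞ h) n ≤ bound g⇝G * bound f⇝F
    weighted-average {h} n h≤ = begin
      (weigh (abs f) ⊞ h) n                          ≤⟨ ⊞-monoʳ (weigh-nonNeg (0≤∣x∣ ∘ f)) h≤ n ⟩
      (weigh (abs f) ⊞ (λ _ → bound g⇝G)) n          ≈⟨ ⊞-const (weigh (abs f)) (bound g⇝G) n ⟩
      bound g⇝G * psum (weigh (abs f)) (suc n)       ≤⟨ *-monoˡ-≤ (0≤bound g⇝G) (moment f⇝F (suc n)) ⟩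
      bound g⇝G * bound f⇝F                          ∎

    remainder : ∀ n → F * G - psum (f ⊞ g) n ≈ (F - psum f (suc n)) * G + (f ⊞ (λ k → G - psum g k)) n
    remainder n = begin-equality
      F * G - psum (f ⊞ g) n
        ≈⟨ +-congˡ (-‿cong (psum-⊞ f g n)) ⟩
      F * G - (f ⊞ psum g) n
        ≈⟨ (solve 4 (λ F G x y → F :* G :- y := (F :- x) :* G :+ (G :* x :+ :- :1 :* y)) refl F G
            (psum f (suc n)) ((f ⊞ psum g) n)) ⟩
      (F - psum f (suc n)) * G + (G * psum f (suc n) + - 1# * (f ⊞ psum g) n)
        ≈⟨ +-congˡ (+-cong (⊞-const f G n) (⊞-*ʳ (- 1#) f (psum g) n)) ⟨
      (F - psum f (suc n)) * G + ((f ⊞ (λ _ → G)) n + (f ⊞ (λ k → - 1# * psum g k)) n)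
        ≈⟨ +-congˡ (⊞-+ʳ f (λ _ → G) (λ k → - 1# * psum g k) n) ⟨
      (F - psum f (suc n)) * G + (f ⊞ (λ k → G + - 1# * psum g k)) n
        ≈⟨ +-congˡ (⊞-cong {f} (λ _ → refl)
            (λ k → (solve 2 (λ G x → G :+ :- :1 :* x := G :- x) refl G (psum g k))) n) ⟩
      (F - psum f (suc n)) * G + (f ⊞ (λ k → G - psum g k)) n ∎

  finite-⇝ : ∀ a → (∀ k → a (suc (suc k)) ≈ 0#) → a ⇝ a 0 + a 1
  finite-⇝ a a≈0 = ⇝-intro (t 0 + t 1) t-bound
    (⟶-suc (⟶-suc (⟶-cong (λ n → sym (begin-equality
      a 0 + (a 1 + psum (a ∘ suc ∘ suc) n)   ≈⟨ +-congˡ (+-congˡ (vanishes a≈0 n)) ⟩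
      a 0 + (a 1 + 0#)                       ≈⟨ +-congˡ (+-identityʳ _) ⟩
      a 0 + a 1                              ∎)) refl (⟶-const (a 0 + a 1)))))
    where
    t : ℕ → ℝ
    t = weigh (abs a)

    0≤t : ∀ k → 0# ≤ t k
    0≤t = weigh-nonNeg (0≤∣x∣ ∘ a)

    vanishes : ∀ {b} → (∀ k → b k ≈ 0#) → ∀ n → psum b n ≈ 0#
    vanishes b≈0 zero    = refl
    vanishes b≈0 (suc n) = trans (+-cong (b≈0 0) (vanishes (b≈0 ∘ suc) n)) (+-identityˡ 0#)

    t-bound : ∀ n → psum t n ≤ t 0 + t 1
    t-bound n = ≤-trans (psum-increasing {t} 0≤t (ℕ.m≤n+m n 2)) (≤-reflexive (+-congˡ (trans
      (+-congˡ (vanishes (λ k → trans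
          (*-congʳ {2^ (suc (suc k))} (trans (∣∣-cong {y = 0#} (a≈0 k)) (0≤x⇒∣x∣≈x ≤-refl))) (zeroˡ _)) n))
      (+-identityʳ _))))

-- The exponential series and elementary bounds on it.

module Exponential (em : ExcludedMiddle 0ℓ) (R : CompleteOrderedField) where

  open Probability em R
  open RealField em R
  open Limits em R
  open Convolution em R
  open ≤-Reasoning ≤-poset
  open Mult semiring using (×1-homo-*)

  expTerm : ℝ → ℕ → ℝ
  expTerm x k = x ^ k * fromℕ (k !) ⁻¹

  0<fromℕ-! : ∀ k → 0# < fromℕ (k !)
  0<fromℕ-! k = <-≤-trans (0<fromℕ-suc 0) (fromℕ-mono-≤ (ℕ.1≤n! k))

  expTerm-zero : ∀ x → expTerm x 0 ≈ 1#
  expTerm-zero x = trans (*-congʳ (sym (+-identityʳ 1#))) (⁻¹-inverse _ (0<x⇒x≉0 (0<fromℕ-suc 0)))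

  expTerm-suc : ∀ x k → fromℕ (suc k) * expTerm x (suc k) ≈ x * expTerm x k
  expTerm-suc x k = *-cancelˡ-≈ (0<fromℕ-! k) (begin-equality
    b * (a * (x * x ^ k * fromℕ (suc k !) ⁻¹))
      ≈⟨ (solve 5 (λ a b x p c → b :* (a :* (x :* p :* c)) := a :* b :* c :* (x :* p)) refl a b x (x ^ k)
          (fromℕ (suc k !) ⁻¹)) ⟩
    a * b * fromℕ (suc k !) ⁻¹ * (x * x ^ k)
      ≈⟨ *-congʳ (trans (*-congʳ (sym (×1-homo-* (suc k) (k !))))
          (⁻¹-inverse _ (0<x⇒x≉0 (0<fromℕ-! (suc k))))) ⟩
    1# * (x * x ^ k)
      ≈⟨ *-congʳ (⁻¹-inverse b (0<x⇒x≉0 (0<fromℕ-! k))) ⟨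
    b * b ⁻¹ * (x * x ^ k)
      ≈⟨ (solve 4 (λ b x p d → b :* d :* (x :* p) := b :* (x :* (p :* d))) refl b x (x ^ k) (b ⁻¹)) ⟩
    b * (x * expTerm x k) ∎)
    where
    a b : ℝ
    a = fromℕ (suc k)
    b = fromℕ (k !)

  -- The recursion is the coefficient form of A′ = x A, A(0) = 1. Identities between exponential
  -- terms are checked through it, avoiding powers and factorials.
  expTerm-unique : ∀ {a : ℕ → ℝ} {x} → a 0 ≈ 1# → (∀ k → fromℕ (suc k) * a (suc k) ≈ x * a k) →
                   ∀ k → a k ≈ expTerm x k
  expTerm-unique {a} {x} a0≈1 step zero    = trans a0≈1 (sym (expTerm-zero x))
  expTerm-unique {a} {x} a0≈1 step (suc k) = *-cancelˡ-≈ (0<fromℕ-suc k)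
    (trans (step k) (trans (*-congˡ (expTerm-unique {a} a0≈1 step k)) (sym (expTerm-suc x k))))

  expTerm-cong : ∀ {x y} → x ≈ y → ∀ k → expTerm x k ≈ expTerm y k
  expTerm-cong {x} {y} x≈y = expTerm-unique (expTerm-zero x) (λ k → trans (expTerm-suc x k) (*-congʳ x≈y))

  expTerm-nonNeg : ∀ {x} → 0# ≤ x → ∀ k → 0# ≤ expTerm x k
  expTerm-nonNeg {x} 0≤x zero    = ≤-trans 0≤1 (≤-reflexive (sym (expTerm-zero x)))
  expTerm-nonNeg {x} 0≤x (suc k) = *-cancelˡ-≤ (0<fromℕ-suc k) (begin
    fromℕ (suc k) * 0#                  ≈⟨ zeroʳ _ ⟩
    0#                                  ≤⟨ *-nonNeg 0≤x (expTerm-nonNeg 0≤x k) ⟩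
    x * expTerm x k                     ≈⟨ expTerm-suc x k ⟨
    fromℕ (suc k) * expTerm x (suc k)   ∎)

  -- The weight 2ᵏ is absorbed into the argument, so the moments of the series at `x` are partial
  -- sums of the series at 2 ∣x∣.
  weigh-∣expTerm∣ : ∀ x k → weigh (abs (expTerm x)) k ≈ expTerm ((1# + 1#) * ∣ x ∣) k
  weigh-∣expTerm∣ x = expTerm-unique
    (trans (*-identityʳ _) (trans (∣∣-cong (expTerm-zero x)) (0≤x⇒∣x∣≈x 0≤1)))
    λ k → begin-equality
      fromℕ (suc k) * weigh (abs (expTerm x)) (suc k)
        ≈⟨ (solve 3 (λ n a w → n :* (a :* (:2 :* w)) := n :* a :* (:2 :* w)) refl (fromℕ (suc k))
            (∣ expTerm x (suc k) ∣) (2^ k)) ⟩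
      fromℕ (suc k) * ∣ expTerm x (suc k) ∣ * 2^ (suc k)
        ≈⟨ *-congʳ (*-congʳ (0≤x⇒∣x∣≈x (0≤fromℕ (suc k)))) ⟨
      ∣ fromℕ (suc k) ∣ * ∣ expTerm x (suc k) ∣ * 2^ (suc k)
        ≈⟨ *-congʳ (trans (sym (∣x*y∣≈∣x∣*∣y∣ _ _)) (trans (∣∣-cong (expTerm-suc x k)) (∣x*y∣≈∣x∣*∣y∣ _ _))) ⟩
      ∣ x ∣ * ∣ expTerm x k ∣ * 2^ (suc k)
        ≈⟨ (solve 3 (λ y a w → y :* a :* (:2 :* w) := :2 :* y :* (a :* w)) refl (∣ x ∣) (∣ expTerm x k ∣)
            (2^ k)) ⟩
      (1# + 1#) * ∣ x ∣ * weigh (abs (expTerm x)) k ∎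

  -- Comparison with a geometric series: once the terms halve, `psum a n + 2 a n` cannot increase.
  -- The terms before index `N` are peeled off one by one.
  halving⇒bounded : ∀ N {a : ℕ → ℝ} → (∀ k → 0# ≤ a k) → (∀ k → N ℕ.≤ k → (1# + 1#) * a (suc k) ≤ a k) →
                    ∃ λ C → ∀ n → psum a n ≤ C
  halving⇒bounded zero {a} 0≤a halves = (1# + 1#) * a 0 , λ n →
    ≤-trans (x≤x+y (*-nonNeg (0≤+ 0≤1 0≤1) (0≤a n))) (go n)
    where
    go : ∀ n → psum a n + (1# + 1#) * a n ≤ (1# + 1#) * a 0
    go zero    = ≤-reflexive (+-identityˡ _)
    go (suc n) = begin
      psum a (suc n) + (1# + 1#) * a (suc n)   ≤⟨ +-mono-≤ (≤-reflexive (psum-last a n)) (halves n ℕ.z≤n) ⟩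
      psum a n + a n + a n
        ≈⟨ (solve 2 (λ x y → x :+ y :+ y := x :+ :2 :* y) refl (psum a n) (a n)) ⟩
      psum a n + (1# + 1#) * a n               ≤⟨ go n ⟩
      (1# + 1#) * a 0                          ∎
  halving⇒bounded (suc N) {a} 0≤a halves =
    let C , bnd = halving⇒bounded N {a ∘ suc} (0≤a ∘ suc) (λ k N≤k → halves (suc k) (ℕ.s≤s N≤k))
    in a 0 + C , λ n → ≤-trans (psum-step 0≤a n) (+-monoʳ-≤ (a 0) (bnd n))

  psum-expTerm-bounded : ∀ {x} → 0# ≤ x → ∃ λ C → ∀ n → psum (expTerm x) n ≤ C
  psum-expTerm-bounded {x} 0≤x = halving⇒bounded N (expTerm-nonNeg 0≤x) λ k N≤k →
    *-cancelˡ-≤ (0<fromℕ-suc k) (begin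
      fromℕ (suc k) * ((1# + 1#) * expTerm x (suc k))
        ≈⟨ (solve 2 (λ n a → n :* (:2 :* a) := :2 :* (n :* a)) refl (fromℕ (suc k)) (expTerm x (suc k))) ⟩
      (1# + 1#) * (fromℕ (suc k) * expTerm x (suc k))
        ≈⟨ trans (*-congˡ (expTerm-suc x k)) (sym (*-assoc _ _ _)) ⟩
      (1# + 1#) * x * expTerm x k
        ≤⟨ *-monoʳ-≤ (expTerm-nonNeg 0≤x k) (≤-trans 2x≤N (fromℕ-mono-≤ (ℕ.m≤n⇒m≤1+n N≤k))) ⟩
      fromℕ (suc k) * expTerm x k ∎)
    where
    -- From index `N` ≥ 2 x on, the ratio x / (k + 1) of consecutive terms is at most one half.
    N = proj₁ (archimedean ((1# + 1#) * x))
    2x≤N = proj₂ (archimedean ((1# + 1#) * x))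

  exp-⇝ : ∀ x → expTerm x ⇝ exp x
  exp-⇝ x = ⇝-intro C bnd (⟶-cong (λ _ → refl) (sym (lim-≈ sum⟶)) sum⟶)
    where
    C-bnd = psum-expTerm-bounded (*-nonNeg (0≤+ 0≤1 0≤1) (0≤∣x∣ x))
    C = proj₁ C-bnd

    bnd : ∀ n → psum (weigh (abs (expTerm x))) n ≤ C
    bnd n = ≤-trans (≤-reflexive (psum-cong (weigh-∣expTerm∣ x) n)) (proj₂ C-bnd n)

    sum⟶ = proj₂ (moment⇒convergent {expTerm x} C bnd)

  -- Multiplication by the index is the derivation x d/dx on generating functions, and this is its
  -- product rule.
  index-⊞ : ∀ f g n → fromℕ n * (f ⊞ g) n ≈ ((λ k → fromℕ k * f k) ⊞ g) n + (f ⊞ (λ k → fromℕ k * g k)) n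
  index-⊞ f g zero    = (solve 2 (λ x y → :0 :* (x :* y :+ :0) := :0 :* x :* y :+ :0 :+ (x :* (:0 :* y) :+ :0))
      refl (f 0) (g 0))
  index-⊞ f g (suc n) = begin-equality
    fromℕ (suc n) * (f 0 * g (suc n) + (f′ ⊞ g) n)
      ≈⟨ (solve 4 (λ n x y z → (:1 :+ n) :* (x :* y :+ z) := x :* ((:1 :+ n) :* y) :+ (n :* z :+ z)) refl
          (fromℕ n) (f 0) (g (suc n)) ((f′ ⊞ g) n)) ⟩
    f 0 * (fromℕ (suc n) * g (suc n)) + (fromℕ n * (f′ ⊞ g) n + (f′ ⊞ g) n)
      ≈⟨ +-congˡ (+-congʳ (index-⊞ f′ g n)) ⟩
    f 0 * (fromℕ (suc n) * g (suc n)) + (((λ k → fromℕ k * f′ k) ⊞ g) n + (f′ ⊞ ng) n + (f′ ⊞ g) n)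
      ≈⟨ (solve 6 (λ x a b c d y → a :+ (b :+ c :+ d) := :0 :* x :* y :+ (d :+ b) :+ (a :+ c)) refl (f 0)
          (f 0 * (fromℕ (suc n) * g (suc n))) (((λ k → fromℕ k * f′ k) ⊞ g) n) ((f′ ⊞ ng) n) ((f′ ⊞ g) n)
          (g (suc n))) ⟩
    0# * f 0 * g (suc n) + ((f′ ⊞ g) n + ((λ k → fromℕ k * f′ k) ⊞ g) n) + (f ⊞ ng) (suc n)
      ≈⟨ +-congʳ (+-congˡ (trans
          (⊞-cong {g = g} (λ k → (solve 2 (λ n x → (:1 :+ n) :* x := x :+ n :* x) refl (fromℕ k) (f′ k)))
          (λ _ → refl) n)
                                 (⊞-+ˡ f′ (λ k → fromℕ k * f′ k) g n))) ⟨
    ((λ k → fromℕ k * f k) ⊞ g) (suc n) + (f ⊞ ng) (suc n) ∎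
    where
    f′ ng : ℕ → ℝ
    f′ = f ∘ suc
    ng k = fromℕ k * g k

  -- The binomial theorem without binomial coefficients: by the product rule for the index, the
  -- convolution satisfies the recursion that characterises the terms at x + y. The zeroth entries
  -- of `nx` and `ny` vanish, which lines up the shifted sums.
  expTerm-⊞ : ∀ x y k → (expTerm x ⊞ expTerm y) k ≈ expTerm (x + y) k
  expTerm-⊞ x y = expTerm-unique {expTerm x ⊞ expTerm y}
    (trans (+-identityʳ _) (trans (*-cong (expTerm-zero x) (expTerm-zero y)) (*-identityˡ 1#)))
    λ k → begin-equality
      fromℕ (suc k) * (expTerm x ⊞ expTerm y) (suc k)
        ≈⟨ index-⊞ (expTerm x) (expTerm y) (suc k) ⟩
      0# * expTerm x 0 * expTerm y (suc k) + ((nx ∘ suc) ⊞ expTerm y) k + (expTerm x ⊞ ny) (suc k)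
        ≈⟨ +-congˡ (⊞-last (expTerm x) ny k) ⟩
      0# * expTerm x 0 * expTerm y (suc k) + ((nx ∘ suc) ⊞ expTerm y) k
        + (expTerm x (suc k) * (0# * expTerm y 0) + (expTerm x ⊞ (ny ∘ suc)) k)
        ≈⟨ (solve 6 (λ a b c d e f → :0 :* a :* b :+ c :+ (d :* (:0 :* e) :+ f) := c :+ f) refl (expTerm x 0)
            (expTerm y (suc k)) (((nx ∘ suc) ⊞ expTerm y) k) (expTerm x (suc k)) (expTerm y 0)
            ((expTerm x ⊞ (ny ∘ suc)) k)) ⟩
      ((nx ∘ suc) ⊞ expTerm y) k + (expTerm x ⊞ (ny ∘ suc)) k
        ≈⟨ +-cong (trans (⊞-cong {g = expTerm y} (expTerm-suc x) (λ _ → refl) k)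
            (⊞-*ˡ x (expTerm x) (expTerm y) k))
                  (trans (⊞-cong {expTerm x} (λ _ → refl) (expTerm-suc y) k)
                      (⊞-*ʳ y (expTerm x) (expTerm y) k)) ⟩
      x * (expTerm x ⊞ expTerm y) k + y * (expTerm x ⊞ expTerm y) k
        ≈⟨ distribʳ _ x y ⟨
      (x + y) * (expTerm x ⊞ expTerm y) k ∎
    where
    nx ny : ℕ → ℝ
    nx k = fromℕ k * expTerm x k
    ny k = fromℕ k * expTerm y k

  exp-cong : ∀ {x y} → x ≈ y → exp x ≈ exp y
  exp-cong {x} {y} x≈y = ⇝-unique (exp-⇝ x) (⇝-cong (sym ∘ expTerm-cong x≈y) refl (exp-⇝ y))

  exp-+ : ∀ x y → exp (x + y) ≈ exp x * exp y
  exp-+ x y = ⇝-unique (exp-⇝ (x + y)) (⇝-cong (expTerm-⊞ x y) refl (⇝-⊞ (exp-⇝ x) (exp-⇝ y)))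

  exp-0 : exp 0# ≈ 1#
  exp-0 = ⇝-unique (exp-⇝ 0#) (⇝-cong (λ _ → refl)
    (trans (+-cong (expTerm-zero 0#) (vanishes 0)) (+-identityʳ 1#)) (finite-⇝ (expTerm 0#) (vanishes ∘ suc)))
    where
    vanishes : ∀ k → expTerm 0# (suc k) ≈ 0#
    vanishes k = trans (*-congʳ (zeroˡ _)) (zeroˡ _)

  exp-inverse : ∀ x → exp x * exp (- x) ≈ 1#
  exp-inverse x = trans (sym (exp-+ x (- x))) (trans (exp-cong (-‿inverseʳ x)) exp-0)

  -- `exp x` is the square of `exp (½ * x)`, and it cannot be 0 because it has an inverse.
  0<exp : ∀ x → 0# < exp x
  0<exp x = ≤-trans (0≤x² (exp (½ * x))) (≤-reflexive (trans (sym (exp-+ _ _)) (exp-cong (½x+½x≈x x)))) ,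
    λ 0≈exp → 0≉1 (trans (sym (zeroˡ _)) (trans (*-congʳ 0≈exp) (exp-inverse x)))

  exp-⁻¹ : ∀ x → exp x ⁻¹ ≈ exp (- x)
  exp-⁻¹ x = *-cancelˡ-≈ (0<exp x) (trans (⁻¹-inverse _ (0<x⇒x≉0 (0<exp x))) (sym (exp-inverse x)))

  1+x≤exp : ∀ {x} → 0# ≤ x → 1# + x ≤ exp x
  1+x≤exp {x} 0≤x = begin
    1# + x
      ≈⟨ +-congˡ (trans (sym (*-identityʳ x)) (*-congˡ (sym (expTerm-zero x)))) ⟩
    1# + x * expTerm x 0
      ≈⟨ +-congˡ (trans (sym (expTerm-suc x 0)) (solve 1 (λ y → (:1 :+ :0) :* y := y :+ :0) refl
          (expTerm x 1))) ⟩
    1# + (expTerm x 1 + 0#)                   ≈⟨ +-congʳ (expTerm-zero x) ⟨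
    psum (expTerm x) 2                        ≤⟨ psum≤limit (expTerm-nonNeg 0≤x) (⇝⇒⟶ (exp-⇝ x)) 2 ⟩
    exp x                                     ∎

  exp≤1+x*exp : ∀ {x} → 0# ≤ x → exp x ≤ 1# + x * exp x
  exp≤1+x*exp {x} 0≤x = ⟶-≤ (⟶-shift 1 (⇝⇒⟶ (exp-⇝ x))) λ n → +-mono-≤ (≤-reflexive (expTerm-zero x)) (begin
    psum (expTerm x ∘ suc) n              ≤⟨ psum-mono {expTerm x ∘ suc} {λ k → x * expTerm x k} term n ⟩
    psum (λ k → x * expTerm x k) n        ≈⟨ psum-* x (expTerm x) n ⟩
    x * psum (expTerm x) n                ≤⟨ *-monoˡ-≤ 0≤x (psum≤limit (expTerm-nonNeg 0≤x) (⇝⇒⟶ (exp-⇝ x)) n) ⟩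
    x * exp x                             ∎)
    where
    term : ∀ k → expTerm x (suc k) ≤ x * expTerm x k
    term k = ≤-trans
      (≤-by (solve 2 (λ n y → (:1 :+ n) :* y :- y := n :* y) refl (fromℕ k) (expTerm x (suc k)))
          (*-nonNeg (0≤fromℕ k) (expTerm-nonNeg 0≤x (suc k))))
      (≤-reflexive (expTerm-suc x k))

  -- The bounds on exp (- z) come from 1 + z ≤ exp z ≤ 1 + z exp z on dividing by exp z.

  exp-neg*[1+z]≤1 : ∀ {z} → 0# ≤ z → exp (- z) * (1# + z) ≤ 1#
  exp-neg*[1+z]≤1 {z} 0≤z = ≤-trans (*-monoˡ-≤ (<⇒≤ (0<exp (- z))) (1+x≤exp 0≤z))
    (≤-reflexive (trans (*-comm _ _) (exp-inverse z)))

  exp-neg≤1 : ∀ {z} → 0# ≤ z → exp (- z) ≤ 1#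
  exp-neg≤1 {z} 0≤z = ≤-trans (≤-by (solve 2 (λ z E → E :* (:1 :+ z) :- E := E :* z) refl z (exp (- z)))
      (*-nonNeg (<⇒≤ (0<exp (- z))) 0≤z))
    (exp-neg*[1+z]≤1 0≤z)

  1-z≤exp-neg : ∀ {z} → 0# ≤ z → 1# - z ≤ exp (- z)
  1-z≤exp-neg {z} 0≤z = begin
    1# - z
      ≈⟨ +-cong (exp-inverse z) (-‿cong (trans (*-congˡ (exp-inverse z)) (*-identityʳ z))) ⟨
    exp z * exp (- z) - z * (exp z * exp (- z))
      ≤⟨ ≤-by (solve 3 (λ z F E → E :- (F :* E :- z :* (F :* E)) := E :* (:1 :+ z :* F :- F)) refl z (exp z)
          (exp (- z)))
                                                        (*-nonNeg (<⇒≤ (0<exp (- z))) (gap (exp≤1+x*exp 0≤z))) ⟩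
    exp (- z)                                       ∎

  exp-neg≤1-z+z² : ∀ {z} → 0# ≤ z → exp (- z) ≤ 1# - z + z * z
  -- The certificate comes from (1 + z)(1 - z + z²) = 1 + z³, which puts 1 - z + z² above 1 / (1 +
  -- z).
  exp-neg≤1-z+z² {z} 0≤z = ≤-by
    (solve 2 (λ z E → :1 :- z :+ z :* z :- E := (:1 :- E :* (:1 :+ z)) :* (:1 :- z :+ z :* z) :+ E :*
        (z :* z :* z)) refl z (exp (- z)))
    (0≤+ (*-nonNeg (gap (exp-neg*[1+z]≤1 0≤z)) 0≤1-z+z²) (*-nonNeg (<⇒≤ (0<exp (- z))) (*-nonNeg (0≤x² z) 0≤z)))
    where
    0≤1-z+z² : 0# ≤ 1# - z + z * z
    0≤1-z+z² with ≤-total z 1#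
    ... | inj₁ z≤1 = 0≤+ (gap z≤1) (0≤x² z)
    ... | inj₂ 1≤z = ≤-by (solve 1 (λ z → :1 :- z :+ z :* z :- :0 := :1 :+ z :* (z :- :1)) refl z)
        (0≤+ 0≤1 (*-nonNeg 0≤z (gap 1≤z)))

-- Differential calculus with explicit constants.

module Integration (em : ExcludedMiddle 0ℓ) (R : CompleteOrderedField) where

  open Probability em R
  open RealField em R
  open Limits em R
  open Convolution em R using (2^; 1+n≤2^)
  open ≤-Reasoning ≤-poset

  ∣∣≤-+ : ∀ {u v p q} → ∣ u ∣ ≤ p → ∣ v ∣ ≤ q → ∣ u + v ∣ ≤ p + q
  ∣∣≤-+ {u} {v} ∣u∣≤p ∣v∣≤q = ≤-trans (∣x+y∣≤∣x∣+∣y∣ u v) (+-mono-≤ ∣u∣≤p ∣v∣≤q)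

  ∣∣≤-* : ∀ {u v p q} → ∣ u ∣ ≤ p → ∣ v ∣ ≤ q → ∣ u * v ∣ ≤ p * q
  ∣∣≤-* {u} {v} ∣u∣≤p ∣v∣≤q =
    ≤-trans (≤-reflexive (∣x*y∣≈∣x∣*∣y∣ u v)) (*-mono-≤ (0≤∣x∣ u) ∣u∣≤p (0≤∣x∣ v) ∣v∣≤q)

  ∣∣≤-resp : ∀ {u v p q} → v ≈ u → p ≈ q → ∣ u ∣ ≤ p → ∣ v ∣ ≤ q
  ∣∣≤-resp v≈u p≈q ∣u∣≤p = ≤-trans (≤-reflexive (∣∣-cong v≈u)) (≤-trans ∣u∣≤p (≤-reflexive p≈q))

  ∣gap∣≤ : ∀ {x y z} → x ≤ y → y - x ≤ z → ∣ y - x ∣ ≤ z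
  ∣gap∣≤ x≤y y-x≤z = ≤-trans (≤-reflexive (0≤x⇒∣x∣≈x (gap x≤y))) y-x≤z

  OnInterval : ℝ → ℝ → (ℝ → ℝ → Set) → Set
  OnInterval a b P = ∀ {x y} → a ≤ x → x ≤ y → y ≤ b → P x y

  -- An explicit Lipschitz constant takes the place of uniform continuity: it controls the variation
  -- of `f` inside a cell of a partition and bounds `f` on the whole interval.
  Lipschitz : ℝ → ℝ → (ℝ → ℝ) → Set
  Lipschitz a b f = ∃ λ K → 0# ≤ K × OnInterval a b (λ x y → ∣ f y - f x ∣ ≤ K * (y - x))

  -- The uniform quadratic error replaces the mean value theorem below.
  Derivative : ℝ → ℝ → (f F : ℝ → ℝ) → Set
  Derivative a b f F = ∃ λ K → 0# ≤ K ×
    OnInterval a b (λ x y → ∣ F y - F x - f x * (y - x) ∣ ≤ K * ((y - x) * (y - x)))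

  Bounded : ℝ → ℝ → (ℝ → ℝ) → Set
  Bounded a b f = ∃ λ M → 0# ≤ M × (∀ {x} → a ≤ x → x ≤ b → ∣ f x ∣ ≤ M)

  Lipschitz⇒Bounded : ∀ {a b f} → a ≤ b → Lipschitz a b f → Bounded a b f
  Lipschitz⇒Bounded {a} {b} {f} a≤b (K , 0≤K , lip) =
    ∣ f a ∣ + K * (b - a) , 0≤+ (0≤∣x∣ _) (*-nonNeg 0≤K (gap a≤b)) , λ {x} a≤x x≤b →
      ∣∣≤-resp (solve 2 (λ u v → v := u :+ (v :- u)) refl (f a) (f x)) refl
        (∣∣≤-+ ≤-refl (≤-trans (lip ≤-refl a≤x x≤b) (*-monoˡ-≤ 0≤K (+-mono-≤ x≤b ≤-refl))))

  Lipschitz-cong : ∀ {a b f g} → (∀ {x} → a ≤ x → x ≤ b → f x ≈ g x) → Lipschitz a b f → Lipschitz a b g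
  Lipschitz-cong f≈g (K , 0≤K , lip) = K , 0≤K , λ a≤x x≤y y≤b →
    ∣∣≤-resp (sym (+-cong (f≈g (≤-trans a≤x x≤y) y≤b) (-‿cong (f≈g a≤x (≤-trans x≤y y≤b))))) refl
        (lip a≤x x≤y y≤b)

  Lipschitz-const : ∀ {a b} c → Lipschitz a b (λ _ → c)
  Lipschitz-const c = 0# , ≤-refl , λ {x} {y} _ _ _ →
    ≤-reflexive (trans (∣∣-cong (-‿inverseʳ c)) (trans (0≤x⇒∣x∣≈x ≤-refl) (sym (zeroˡ _))))

  Lipschitz-* : ∀ {a b f g} → a ≤ b → Lipschitz a b f → Lipschitz a b g → Lipschitz a b (λ x → f x * g x)
  Lipschitz-* {f = f} {g} a≤b F@(K , 0≤K , lipf) G@(L , 0≤L , lipg) =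
    let M , 0≤M , f≤M = Lipschitz⇒Bounded a≤b F
        N , 0≤N , g≤N = Lipschitz⇒Bounded a≤b G
    in M * L + K * N , 0≤+ (*-nonNeg 0≤M 0≤L) (*-nonNeg 0≤K 0≤N) , λ {x} {y} a≤x x≤y y≤b →
      ∣∣≤-resp (solve 4 (λ p q r s → p :* q :- r :* s := p :* (q :- s) :+ (p :- r) :* s) refl (f y) (g y) (f x)
          (g x))
               (solve 5 (λ M L K N d → M :* (L :* d) :+ K :* d :* N := (M :* L :+ K :* N) :* d) refl M L K N
                   (y - x))
        (∣∣≤-+ (∣∣≤-* (f≤M (≤-trans a≤x x≤y) y≤b) (lipg a≤x x≤y y≤b))
               (∣∣≤-* (lipf a≤x x≤y y≤b) (g≤N a≤x (≤-trans x≤y y≤b))))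

  Derivative-cong : ∀ {a b f g F G} → (∀ {x} → a ≤ x → x ≤ b → f x ≈ g x) →
      (∀ {x} → a ≤ x → x ≤ b → F x ≈ G x) →
                    Derivative a b f F → Derivative a b g G
  Derivative-cong f≈g F≈G (K , 0≤K , rem) = K , 0≤K , λ a≤x x≤y y≤b →
    ∣∣≤-resp (sym (+-cong (+-cong (F≈G (≤-trans a≤x x≤y) y≤b) (-‿cong (F≈G a≤x (≤-trans x≤y y≤b))))
                          (-‿cong (*-congʳ (f≈g a≤x (≤-trans x≤y y≤b)))))) refl (rem a≤x x≤y y≤b)

  Derivative-const : ∀ {a b} c → Derivative a b (λ _ → 0#) (λ _ → c)
  Derivative-const c = 0# , ≤-refl , λ {x} {y} _ _ _ →
    ≤-reflexive (trans (∣∣-cong (solve 3 (λ c x y → c :- c :- :0 :* (y :- x) := :0) refl c x y))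
        (trans (0≤x⇒∣x∣≈x ≤-refl) (sym (zeroˡ _))))

  Derivative-+ : ∀ {a b f g F G} → Derivative a b f F → Derivative a b g G →
                 Derivative a b (λ x → f x + g x) (λ x → F x + G x)
  Derivative-+ {f = f} {g} {F} {G} (K , 0≤K , remF) (L , 0≤L , remG) = K + L , 0≤+ 0≤K 0≤L , λ {x} {y} a≤x x≤y
      y≤b →
    ∣∣≤-resp (solve 7 (λ p q r s u v d → p :+ q :- (r :+ s) :- (u :+ v) :* d := p :- r :- u :* d :+
        (q :- s :- v :* d)) refl (F y) (G y) (F x) (G x) (f x) (g x) (y - x)) (sym (distribʳ _ K L))
      (∣∣≤-+ (remF a≤x x≤y y≤b) (remG a≤x x≤y y≤b))

  -- The remainder of a product is the two individual remainders, each times a bounded factor, plus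
  -- the product of the two increments; the Lipschitz bounds make the last term quadratic.
  Derivative-* : ∀ {a b f g F G} → a ≤ b → Lipschitz a b F → Lipschitz a b G → Derivative a b f F → Derivative a
      b g G →
                 Derivative a b (λ x → f x * G x + F x * g x) (λ x → F x * G x)
  Derivative-* {f = f} {g} {F} {G} a≤b LF@(K′ , 0≤K′ , lipF) LG@(L′ , 0≤L′ , lipG) (K , 0≤K , remF)
      (L , 0≤L , remG) =
    let M , 0≤M , F≤M = Lipschitz⇒Bounded a≤b LF
        N , 0≤N , G≤N = Lipschitz⇒Bounded a≤b LG
    in K * N + M * L + K′ * L′ , 0≤+ (0≤+ (*-nonNeg 0≤K 0≤N) (*-nonNeg 0≤M 0≤L)) (*-nonNeg 0≤K′ 0≤L′) , λ {x}
        {y} a≤x x≤y y≤b →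
      let x≤b = ≤-trans x≤y y≤b in
      ∣∣≤-resp (solve 7 (λ p q r s u v d → p :* q :- r :* s :- (u :* s :+ r :* v) :* d := (p :- r :- u :* d) :*
          s :+ r :* (q :- s :- v :* d) :+ (p :- r) :* (q :- s)) refl (F y) (G y) (F x) (G x) (f x) (g x)
          (y - x))
               (solve 7 (λ K N M L K′ L′ d → K :* (d :* d) :* N :+ M :* (L :* (d :* d)) :+ K′ :* d :* (L′ :* d)
                   := (K :* N :+ M :* L :+ K′ :* L′) :* (d :* d)) refl K N M L K′ L′ (y - x))
        (∣∣≤-+ (∣∣≤-+ (∣∣≤-* (remF a≤x x≤y y≤b) (G≤N a≤x x≤b)) (∣∣≤-* (F≤M a≤x x≤b) (remG a≤x x≤y y≤b)))
               (∣∣≤-* (lipF a≤x x≤y y≤b) (lipG a≤x x≤y y≤b)))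

  Lipschitz-scale : ∀ {a b f} → a ≤ b → ∀ c → Lipschitz a b f → Lipschitz a b (λ x → c * f x)
  Lipschitz-scale a≤b c F = Lipschitz-* a≤b (Lipschitz-const c) F

  Derivative-scale : ∀ {a b f F} → ∀ c → Derivative a b f F → Derivative a b (λ x → c * f x) (λ x → c * F x)
  Derivative-scale {f = f} {F} c (K , 0≤K , rem) = ∣ c ∣ * K , *-nonNeg (0≤∣x∣ c) 0≤K , λ {x} {y} a≤x x≤y y≤b →
    ∣∣≤-resp (solve 5 (λ c p q u d → c :* p :- c :* q :- c :* u :* d := c :* (p :- q :- u :* d)) refl c (F y)
        (F x) (f x) (y - x))
             (sym (*-assoc _ _ _)) (∣∣≤-* ≤-refl (rem a≤x x≤y y≤b))

  -- Functions on the setoid of reals need not respect `_≈_`; the remainder bound at distance 0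
  -- forces it for `F`. This matters at the end of a partition and at the seam of a glued
  -- antiderivative.
  Derivative-cong-arg : ∀ {a b f F x y} → Derivative a b f F → a ≤ x → y ≤ b → x ≈ y → F y - F x ≈ 0#
  Derivative-cong-arg {f = f} {F} {x} {y} (K , 0≤K , rem) a≤x y≤b x≈y = ≤-antisym
    (≤-trans (x≤∣x∣ _) zero-bound) (≤-by (solve 1 (λ u → u :- :0 := :0 :- (:- u)) refl (F y - F x))
        (gap (≤-trans (-x≤∣x∣ _) zero-bound)))
    where
    y-x≈0 : y - x ≈ 0#
    y-x≈0 = trans (+-congˡ (-‿cong x≈y)) (-‿inverseʳ y)

    zero-bound : ∣ F y - F x ∣ ≤ 0#
    zero-bound = ∣∣≤-resp
      (trans (solve 2 (λ u v → u := u :- v :* :0) refl (F y - F x) (f x))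
          (+-congˡ (-‿cong (*-congˡ (sym y-x≈0)))))
      (trans (*-congˡ (trans (*-congʳ y-x≈0) (zeroˡ _))) (zeroʳ K))
      (rem a≤x (≤-reflexive x≈y) y≤b)

  glue : ∀ {a c b} {P : ℝ → ℝ → Set} → OnInterval a c P → OnInterval c b P →
         (∀ {x y} → a ≤ x → x ≤ c → c ≤ y → y ≤ b → P x c → P c y → P x y) →
         OnInterval a b P
  glue {c = c} left right across {x} {y} a≤x x≤y y≤b with ≤-total y c | ≤-total c x
  ... | inj₁ y≤c | _        = left a≤x x≤y y≤c
  ... | inj₂ c≤y | inj₁ c≤x = right c≤x x≤y y≤b
  ... | inj₂ c≤y | inj₂ x≤c = across a≤x x≤c c≤y y≤b (left a≤x x≤c ≤-refl) (right ≤-refl c≤y y≤b)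

  Lipschitz-glue : ∀ {a c b f} → Lipschitz a c f → Lipschitz c b f → Lipschitz a b f
  Lipschitz-glue {c = c} {f = f} (K , 0≤K , left) (L , 0≤L , right) = K + L , 0≤+ 0≤K 0≤L , glue
    (λ a≤x x≤y y≤c → ≤-trans (left a≤x x≤y y≤c) (*-monoʳ-≤ (gap x≤y) (x≤x+y 0≤L)))
    (λ c≤x x≤y y≤b → ≤-trans (right c≤x x≤y y≤b) (*-monoʳ-≤ (gap x≤y) (L≤K+L)))
    (λ {x} {y} _ _ _ _ x-c c-y →
      ∣∣≤-resp (solve 3 (λ p q r → r :- p := q :- p :+ (r :- q)) refl (f x) (f c) (f y))
          (solve 4 (λ M x y c → M :* (c :- x) :+ M :* (y :- c) := M :* (y :- x)) refl (K + L) x y c)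
        (∣∣≤-+ x-c c-y))
    where
    L≤K+L : L ≤ K + L
    L≤K+L = ≤-trans (x≤x+y 0≤K) (≤-reflexive (+-comm L K))

  -- Across the seam the slope at `x` is replaced by the slope at `c` on [c , y]. That costs at most
  -- M (c - x)(y - c), which the cross term of (y - x)² absorbs.
  Derivative-glue : ∀ {a c b f F} → Lipschitz a b f → Derivative a c f F → Derivative c b f F → Derivative a
      b f F
  Derivative-glue {c = c} {f = f} {F} (M , 0≤M , lip) (K , 0≤K , left) (L , 0≤L , right) =
    K + L + M , 0≤+ (0≤+ 0≤K 0≤L) 0≤M , glue
    (λ a≤x x≤y y≤c → ≤-trans (left a≤x x≤y y≤c)
        (*-monoʳ-≤ (0≤x² _) (≤-by (solve 3 (λ K L M → K :+ L :+ M :- K := L :+ M) refl K L M) (0≤+ 0≤L 0≤M))))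
    (λ c≤x x≤y y≤b → ≤-trans (right c≤x x≤y y≤b)
        (*-monoʳ-≤ (0≤x² _) (≤-by (solve 3 (λ K L M → K :+ L :+ M :- L := K :+ M) refl K L M) (0≤+ 0≤K 0≤M))))
    (λ {x} {y} a≤x x≤c c≤y y≤b x-c c-y →
      ≤-trans (∣∣≤-resp (solve 8 (λ p q r u v x y c → r :- p :- u :* (y :- x) := q :- p :- u :* (c :- x) :+
          (r :- q :- v :* (y :- c)) :+ (v :- u) :* (y :- c)) refl (F x) (F c) (F y) (f x) (f c) x y c) refl
                 (∣∣≤-+ (∣∣≤-+ x-c c-y)
                        (∣∣≤-* (lip a≤x x≤c (≤-trans c≤y y≤b)) (∣gap∣≤ c≤y ≤-refl))))
        (≤-by (solve 6 (λ K L M x y c → (K :+ L :+ M) :* ((y :- x) :* (y :- x)) :-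
            ((K :+ L :+ M) :* ((c :- x) :* (c :- x)) :+ (K :+ L :+ M) :* ((y :- c) :* (y :- c)) :+ M :* (c :- x)
            :* (y :- c)) := (K :+ L :+ K :+ L :+ M) :* ((c :- x) :* (y :- c))) refl K L M x y c)
          (*-nonNeg (0≤+ (0≤+ (0≤+ (0≤+ 0≤K 0≤L) 0≤K) 0≤L) 0≤M) (*-nonNeg (gap x≤c) (gap c≤y)))))

  -- F y - F x ≥ - K (y - x)² for all x ≤ y; adding this up over the two halves of
  -- [x , y] gives it with K / 2 in place of K, and so on.
  0≤f⇒F-increasing : ∀ {a b f F} → Derivative a b f F → (∀ {x} → a ≤ x → x ≤ b → 0# ≤ f x) →
                     OnInterval a b (λ x y → F x ≤ F y)
  0≤f⇒F-increasing {a} {b} {f} {F} (K , 0≤K , rem) 0≤f {u} {v} a≤u u≤v v≤b with ≤-total (F u) (F v)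
  ... | inj₁ Fu≤Fv = Fu≤Fv
  ... | inj₂ Fv≤Fu = ≤-by (solve 2 (λ u v → v :- u := :0 :- (u :- v)) refl (F u) (F v)) (gap
    (bounded-multiples⇒≤0 (K * ((v - u) * (v - u))) λ n →
      ≤-trans (*-monoˡ-≤ (gap Fv≤Fu) (1+n≤2^ n)) (bound n a≤u u≤v v≤b)))
    where
    bound : ∀ n → OnInterval a b (λ x y → (F x - F y) * 2^ n ≤ K * ((y - x) * (y - x)))
    bound zero {x} {y} a≤x x≤y y≤b = ≤-trans
      (≤-by (solve 4 (λ p q w d → :- (q :- p :- w :* d) :- (p :- q) :* :1 := w :* d) refl (F x) (F y) (f x)
          (y - x))
            (*-nonNeg (0≤f a≤x (≤-trans x≤y y≤b)) (gap x≤y)))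
      (≤-trans (-x≤∣x∣ _) (rem a≤x x≤y y≤b))
    bound (suc n) {x} {y} a≤x x≤y y≤b = begin
      (F x - F y) * ((1# + 1#) * 2^ n)
        ≈⟨ (solve 4 (λ p q r w → (p :- q) :* (:2 :* w) := :2 :* ((p :- r) :* w :+ (r :- q) :* w)) refl (F x)
            (F y) (F m) (2^ n)) ⟩
      (1# + 1#) * ((F x - F m) * 2^ n + (F m - F y) * 2^ n)
        ≤⟨ *-monoˡ-≤ (0≤+ 0≤1 0≤1) (+-mono-≤ (bound n a≤x x≤m (≤-trans m≤y y≤b))
            (bound n (≤-trans a≤x x≤m) m≤y y≤b)) ⟩
      (1# + 1#) * (K * ((m - x) * (m - x)) + K * ((y - m) * (y - m)))
        ≈⟨ *-congˡ (+-cong (*-congˡ (*-cong m-x≈ m-x≈)) (*-congˡ (*-cong y-m≈ y-m≈))) ⟩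
      (1# + 1#) * (K * (½ * (y - x) * (½ * (y - x))) + K * (½ * (y - x) * (½ * (y - x))))
        ≈⟨ (solve 3 (λ K h d → :2 :* (K :* (h :* d :* (h :* d)) :+ K :* (h :* d :* (h :* d))) := K :*
            (:2 :* h :* d :* (:2 :* h :* d))) refl K (½) (y - x)) ⟩
      K * ((1# + 1#) * ½ * (y - x) * ((1# + 1#) * ½ * (y - x)))
        ≈⟨ *-congˡ (*-cong (unit (y - x)) (unit (y - x))) ⟩
      K * ((y - x) * (y - x)) ∎
      where
      m : ℝ
      m = ½ * (x + y)

      unit : ∀ z → (1# + 1#) * ½ * z ≈ z
      unit z = trans (*-congʳ 2½≈1) (*-identityˡ z)

      m-x≈ : m - x ≈ ½ * (y - x)
      m-x≈ = trans (+-congˡ (-‿cong (sym (unit x))))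
          (solve 3 (λ h x y → h :* (x :+ y) :- :2 :* h :* x := h :* (y :- x)) refl (½) x y)

      y-m≈ : y - m ≈ ½ * (y - x)
      y-m≈ = trans (+-congʳ (sym (unit y))) (solve 3 (λ h x y → :2 :* h :* y :- h :* (x :+ y) := h :* (y :- x))
          refl (½) x y)

      x≤m : x ≤ m
      x≤m = ≤-by m-x≈ (*-nonNeg (<⇒≤ 0<½) (gap x≤y))

      m≤y : m ≤ y
      m≤y = ≤-by y-m≈ (*-nonNeg (<⇒≤ 0<½) (gap x≤y))

  -- Riemann sums and the fundamental theorem.

  partition-≤ : ∀ {a b} → TaggedPartition b a → a ≤ b
  partition-≤ (end a≈b)          = ≤-reflexive a≈b
  partition-≤ (cell t x a≤t t≤x p) = ≤-trans (≤-trans a≤t t≤x) (partition-≤ p)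

  -- On one cell, moving the tag to the left end costs at most L δ times the width, and replacing
  -- the slope by the increment of `F` at most K δ times the width. The increments telescope and the
  -- widths add up.
  riemannSum-error : ∀ {a b δ f F} → (lip : Lipschitz a b f) → (der : Derivative a b f F) →
    ∀ {c} → a ≤ c → (p : TaggedPartition b c) → MeshBelow δ p →
    ∣ riemannSum f p - (F b - F c) ∣ ≤ (proj₁ lip + proj₁ der) * δ * (b - c)
  riemannSum-error {b = b} {δ} {f} {F} (L , _) der@(K , _ , _) {c} a≤c (end c≈b) _ = ≤-reflexive (begin-equality
    ∣ 0# - (F b - F c) ∣        ≈⟨ ∣∣-cong (+-congˡ (-‿cong (Derivative-cong-arg der a≤c ≤-refl c≈b))) ⟩
    ∣ 0# - 0# ∣                 ≈⟨ trans (∣∣-cong (-‿inverseʳ 0#)) (0≤x⇒∣x∣≈x ≤-refl) ⟩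
    0#                          ≈⟨ (solve 2 (λ M b → :0 := M :* (b :- b)) refl ((L + K) * δ) b) ⟩
    (L + K) * δ * (b - b)       ≈⟨ *-congˡ (+-congˡ (-‿cong c≈b)) ⟨
    (L + K) * δ * (b - c)       ∎)
  riemannSum-error {b = b} {δ} {f} {F} lip@(L , 0≤L , lipf) der@(K , 0≤K , rem) {c} a≤c (cell t x c≤t t≤x p)
      (cell x-c<δ p-fine) =
    ∣∣≤-resp (solve 7 (λ u v d s p q r → u :* d :+ s :- (p :- q) := (u :- v) :* d :+ :- (r :- q :- v :* d) :+
        (s :- (p :- r))) refl (f t) (f c) (x - c) (riemannSum f p) (F b) (F c) (F x))
             (solve 6 (λ L K δ x c b → L :* δ :* (x :- c) :+ K :* (δ :* (x :- c)) :+ (L :+ K) :* δ :* (b :- x)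
                 := (L :+ K) :* δ :* (b :- c)) refl L K δ x c b)
      (∣∣≤-+ (∣∣≤-+
        (∣∣≤-* (≤-trans (lipf a≤c c≤t (≤-trans t≤x x≤b))
            (*-monoˡ-≤ 0≤L (≤-trans (+-mono-≤ t≤x ≤-refl) (<⇒≤ x-c<δ))))
               (∣gap∣≤ c≤x ≤-refl))
        (≤-trans (≤-reflexive (∣-x∣≈∣x∣ _))
            (≤-trans (rem a≤c c≤x x≤b) (*-monoˡ-≤ 0≤K (*-monoʳ-≤ (gap c≤x) (<⇒≤ x-c<δ))))))
        (riemannSum-error {F = F} lip der (≤-trans a≤c c≤x) p p-fine))
    where
    c≤x = ≤-trans c≤t t≤x
    x≤b = partition-≤ p

  uniform-partition : ∀ {h b} → 0# ≤ h → ∀ n {a} → a + fromℕ n * h ≈ b → TaggedPartition b a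
  uniform-partition {h} 0≤h zero    {a} eq = end
      (trans (trans (sym (+-identityʳ a)) (+-congˡ (sym (zeroˡ h)))) eq)
  uniform-partition {h} 0≤h (suc n) {a} eq = cell a (a + h) ≤-refl (x≤x+y 0≤h)
    (uniform-partition 0≤h n (trans (solve 3 (λ a h n → a :+ h :+ n :* h := a :+ (:1 :+ n) :* h) refl a h
        (fromℕ n)) eq))

  uniform-mesh : ∀ {h b δ} (0≤h : 0# ≤ h) → h < δ → ∀ n {a} (eq : a + fromℕ n * h ≈ b) →
                 MeshBelow δ (uniform-partition 0≤h n eq)
  uniform-mesh 0≤h h<δ zero    eq = end
  uniform-mesh {h} 0≤h h<δ (suc n) {a} eq =
    cell (≤-<-trans (≤-reflexive (solve 2 (λ a h → a :+ h :- a := h) refl a h)) h<δ) (uniform-mesh 0≤h h<δ n _)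

  fine-partition : ∀ {a b δ} → a ≤ b → 0# < δ → ∃ λ (p : TaggedPartition b a) → MeshBelow δ p
  fine-partition {a} {b} {δ} a≤b 0<δ = uniform-partition 0≤h (suc N) eq , uniform-mesh 0≤h h<δ (suc N) eq
    where
    0<½δ = 0<½x 0<δ
    -- Dividing by `½ * δ` gives steps of at most `½ * δ`, hence strictly below `δ`, as the mesh
    -- condition asks.
    N = proj₁ (archimedean ((b - a) * (½ * δ) ⁻¹))
    s h : ℝ
    s = fromℕ (suc N)
    h = (b - a) * s ⁻¹

    0≤h : 0# ≤ h
    0≤h = *-nonNeg (gap a≤b) (⁻¹-nonNeg (0<fromℕ-suc N))

    s*h≈ : s * h ≈ b - a
    s*h≈ = trans (solve 3 (λ s d i → s :* (d :* i) := s :* i :* d) refl s (b - a) (s ⁻¹))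
      (trans (*-congʳ (⁻¹-inverse s (0<x⇒x≉0 (0<fromℕ-suc N)))) (*-identityˡ _))

    eq : a + s * h ≈ b
    eq = trans (+-congˡ s*h≈) (solve 2 (λ a b → a :+ (b :- a) := b) refl a b)

    h<δ : h < δ
    h<δ = ≤-<-trans (*-cancelˡ-≤ (0<fromℕ-suc N) (begin
      s * h                                   ≈⟨ trans s*h≈ (sym (*-identityʳ _)) ⟩
      (b - a) * 1#                            ≈⟨ *-congˡ (⁻¹-inverse (½ * δ) (0<x⇒x≉0 0<½δ)) ⟨
      (b - a) * (½ * δ * (½ * δ) ⁻¹)
        ≈⟨ (solve 3 (λ d e i → d :* (e :* i) := d :* i :* e) refl (b - a) (½ * δ) ((½ * δ) ⁻¹)) ⟩
      (b - a) * (½ * δ) ⁻¹ * (½ * δ)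
        ≤⟨ *-monoʳ-≤ (<⇒≤ 0<½δ) (≤-trans (proj₂ (archimedean ((b - a) * (½ * δ) ⁻¹)))
            (fromℕ-mono-≤ (ℕ.n≤1+n N))) ⟩
      s * (½ * δ)                             ∎)) (½x<x 0<δ)

  MeshBelow-mono : ∀ {δ δ′ b a} {p : TaggedPartition b a} → δ ≤ δ′ → MeshBelow δ p → MeshBelow δ′ p
  MeshBelow-mono δ≤δ′ end              = end
  MeshBelow-mono δ≤δ′ (cell x-a<δ fine) = cell (<-≤-trans x-a<δ δ≤δ′) (MeshBelow-mono δ≤δ′ fine)

  common-fine-partition : ∀ {a b δ δ′} → a ≤ b → 0# < δ → 0# < δ′ →
                          ∃ λ (p : TaggedPartition b a) → MeshBelow δ p × MeshBelow δ′ p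
  common-fine-partition {δ = δ} {δ′} a≤b 0<δ 0<δ′ with ≤-total δ δ′
  ... | inj₁ δ≤δ′ = let p , fine = fine-partition a≤b 0<δ  in p , fine , MeshBelow-mono δ≤δ′ fine
  ... | inj₂ δ′≤δ = let p , fine = fine-partition a≤b 0<δ′ in p , MeshBelow-mono δ′≤δ fine , fine

  integral-unique : ∀ {a b f I J} → a ≤ b → IsRiemannIntegral a b f I → IsRiemannIntegral a b f J → I ≈ J
  -- That `I` lies within every ε of `J` is read as the constant sequence `I` converging to `J`.
  integral-unique {f = f} {I} {J} a≤b int-I int-J = ⟶-unique (⟶-const I) (⟶-intro λ ε 0<ε → 0 , λ _ _ →
    let δ , 0<δ , near-I = int-I (½ * ε) (0<½x 0<ε)
        δ′ , 0<δ′ , near-J = int-J (½ * ε) (0<½x 0<ε)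
        p , fine , fine′ = common-fine-partition a≤b 0<δ 0<δ′
    in begin
      ∣ I - J ∣                                           ≤⟨ ∣x-z∣≤∣x-y∣+∣y-z∣ I (riemannSum f p) J ⟩
      ∣ I - riemannSum f p ∣ + ∣ riemannSum f p - J ∣
        ≤⟨ +-mono-≤ (≤-trans (≤-reflexive (∣x-y∣≈∣y-x∣ _ _)) (<⇒≤ (near-I p fine))) (<⇒≤ (near-J p fine′)) ⟩
      ½ * ε + ½ * ε                                       ≈⟨ ½x+½x≈x ε ⟩
      ε                                                   ∎)

  ∫-≈ : ∀ {a b f I} → a ≤ b → IsRiemannIntegral a b f I → ∫ a b f ≈ I
  ∫-≈ {a} {b} {f} {I} a≤b int-I with em {∃ (IsRiemannIntegral a b f)}
  ... | yes (J , int-J) = integral-unique {f = f} a≤b int-J int-I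
  ... | no  none        = ⊥-elim (none (I , int-I))

  -- Integrability is a by-product: the error estimate shows directly that Riemann sums approach
  -- `F b - F a`.
  fundamental-theorem : ∀ {a b f F} → a ≤ b → Lipschitz a b f → Derivative a b f F → ∫ a b f ≈ F b - F a
  fundamental-theorem {a} {b} {f} {F} a≤b lip der = ∫-≈ a≤b λ ε 0<ε →
    ½ * ε * D ⁻¹ , *-pos (0<½x 0<ε) (⁻¹-pos 0<D) , λ p fine → ≤-<-trans (begin
      ∣ riemannSum f p - (F b - F a) ∣          ≤⟨ riemannSum-error {F = F} lip der ≤-refl p fine ⟩
      M * (½ * ε * D ⁻¹) * (b - a)
        ≈⟨ (solve 4 (λ M e i d → M :* (e :* i) :* d := M :* d :* (e :* i)) refl M (½ * ε) (D ⁻¹) (b - a)) ⟩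
      M * (b - a) * (½ * ε * D ⁻¹)
        ≤⟨ *-monoʳ-≤ (<⇒≤ (*-pos (0<½x 0<ε) (⁻¹-pos 0<D)))
            (≤-by (solve 1 (λ d → :1 :+ d :- d := :1) refl (M * (b - a))) 0≤1) ⟩
      D * (½ * ε * D ⁻¹)
        ≈⟨ (solve 3 (λ D e i → D :* (e :* i) := D :* i :* e) refl D (½ * ε) (D ⁻¹)) ⟩
      D * D ⁻¹ * (½ * ε)
        ≈⟨ trans (*-congʳ (⁻¹-inverse D (0<x⇒x≉0 0<D))) (*-identityˡ _) ⟩
      ½ * ε                                     ∎) (½x<x 0<ε)
    where
    M D : ℝ
    M = proj₁ lip + proj₁ der
    -- The summand `1#` keeps the divisor positive when M (b - a) is 0.
    D = 1# + M * (b - a)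

    0<D : 0# < D
    0<D = 0<1+x (*-nonNeg (0≤+ (proj₁ (proj₂ lip)) (proj₁ (proj₂ der))) (gap a≤b))

-- The mass function of `Swap`.

module SwapDistribution (em : ExcludedMiddle 0ℓ) (R : CompleteOrderedField) where

  open Probability em R
  open RealField em R
  open Limits em R
  open Convolution em R
  open Exponential em R
  open Integration em R
  open Max totalOrder using (x≤y⇒x⊔y≈y; x≤y⇒y⊔x≈y)
  open ≤-Reasoning ≤-poset

  -- Gives meaning to a (k - 1) at k = 0, so that derivative formulas and recursions in `k` hold
  -- uniformly.
  shift : (ℕ → ℝ) → ℕ → ℝ
  shift a zero    = 0#
  shift a (suc k) = a k

  shift-cong : ∀ {a b} → (∀ k → a k ≈ b k) → ∀ k → shift a k ≈ shift b k
  shift-cong a≈b zero    = refl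
  shift-cong a≈b (suc k) = a≈b k

  shift-* : ∀ c a k → shift (λ j → c * a j) k ≈ c * shift a k
  shift-* c a zero    = sym (zeroʳ c)
  shift-* c a (suc k) = refl

  shift-nonNeg : ∀ {a} → (∀ k → 0# ≤ a k) → ∀ k → 0# ≤ shift a k
  shift-nonNeg 0≤a zero    = ≤-refl
  shift-nonNeg 0≤a (suc k) = 0≤a k

  -- The solved form of the recursion: it presents the next term as a scaled product, so regularity
  -- in `t` follows by induction on `k` from the product rule.
  expTerm-recursion : ∀ x k → expTerm x (suc k) ≈ fromℕ (suc k) ⁻¹ * (x * expTerm x k)
  expTerm-recursion x k = *-cancelˡ-≈ (0<fromℕ-suc k) (begin-equality
    n * expTerm x (suc k)            ≈⟨ expTerm-suc x k ⟩
    x * expTerm x k                  ≈⟨ *-identityˡ _ ⟨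
    1# * (x * expTerm x k)           ≈⟨ *-congʳ (⁻¹-inverse n (0<x⇒x≉0 (0<fromℕ-suc k))) ⟨
    n * n ⁻¹ * (x * expTerm x k)     ≈⟨ *-assoc _ _ _ ⟩
    n * (n ⁻¹ * (x * expTerm x k))   ∎)
    where
    n : ℝ
    n = fromℕ (suc k)

  *-shift-expTerm : ∀ x k → x * shift (expTerm x) k ≈ fromℕ k * expTerm x k
  *-shift-expTerm x zero    = trans (zeroʳ x) (sym (zeroˡ _))
  *-shift-expTerm x (suc k) = sym (expTerm-suc x k)

  expTerm-0≈pointMass₀ : ∀ k → expTerm 0# k ≈ pointMass₀ k
  expTerm-0≈pointMass₀ zero    = expTerm-zero 0#
  expTerm-0≈pointMass₀ (suc k) = trans (*-congʳ (zeroˡ _)) (zeroˡ _)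

  module _ {c : ℝ} (0≤c : 0# ≤ c) where

    decay : ℝ → ℝ
    decay t = exp (- (c * t))

    -- Reduces increments of `decay` to exp (- z) with z = c (y - x) ≥ 0. There 1 - z ≤ exp (- z) ≤
    -- 1 yields the Lipschitz constant, and exp (- z) ≤ 1 - z + z² the quadratic remainder.
    decay-step : ∀ x y → decay y ≈ decay x * exp (- (c * (y - x)))
    decay-step x y = trans (exp-cong (solve 3 (λ c x y → :- (c :* y) := :- (c :* x) :+ :- (c :* (y :- x))) refl
        c x y)) (exp-+ _ _)

    module _ {x y : ℝ} (0≤x : 0# ≤ x) (x≤y : x ≤ y) where

      0≤z : 0# ≤ c * (y - x)
      0≤z = *-nonNeg 0≤c (gap x≤y)

      decay-x≤1 : decay x ≤ 1#
      decay-x≤1 = exp-neg≤1 (*-nonNeg 0≤c 0≤x)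

      decay-lipschitz : ∣ decay y - decay x ∣ ≤ c * (y - x)
      decay-lipschitz = ∣∣≤-resp
        (trans (+-congʳ (decay-step x y)) (solve 2 (λ D E → D :* E :- D := :- (D :* (:1 :- E))) refl (decay x)
            (exp (- (c * (y - x))))))
        (*-identityˡ _)
        (≤-trans (≤-reflexive (∣-x∣≈∣x∣ _)) (∣∣≤-*
          (≤-trans (≤-reflexive (0≤x⇒∣x∣≈x (<⇒≤ (0<exp _)))) decay-x≤1)
          (∣gap∣≤ (exp-neg≤1 0≤z)
            (≤-by (solve 2 (λ z E → z :- (:1 :- E) := E :- (:1 :- z)) refl (c * (y - x))
                (exp (- (c * (y - x))))) (gap (1-z≤exp-neg 0≤z))))))

      decay-remainder : ∣ decay y - decay x - - (c * decay x) * (y - x) ∣ ≤ c * c * ((y - x) * (y - x))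
      decay-remainder = ∣∣≤-resp
        (trans (+-congʳ (+-congʳ (decay-step x y)))
          (solve 4 (λ D E c d → D :* E :- D :- :- (c :* D) :* d := D :* (E :- (:1 :- c :* d))) refl (decay x)
              (exp (- (c * (y - x)))) c (y - x)))
        (solve 2 (λ c d → :1 :* (c :* d :* (c :* d)) := c :* c :* (d :* d)) refl c (y - x))
        (∣∣≤-*
          (≤-trans (≤-reflexive (0≤x⇒∣x∣≈x (<⇒≤ (0<exp _)))) decay-x≤1)
          (∣gap∣≤ (1-z≤exp-neg 0≤z)
            (≤-by (solve 2 (λ z E → z :* z :- (E :- (:1 :- z)) := :1 :- z :+ z :* z :- E) refl (c * (y - x))
                (exp (- (c * (y - x))))) (gap (exp-neg≤1-z+z² 0≤z)))))

    Lipschitz-decay : ∀ {a b} → 0# ≤ a → Lipschitz a b decay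
    Lipschitz-decay 0≤a = c , 0≤c , λ a≤x x≤y _ → decay-lipschitz (≤-trans 0≤a a≤x) x≤y

    Derivative-decay : ∀ {a b} → 0# ≤ a → Derivative a b (λ t → - (c * decay t)) decay
    Derivative-decay 0≤a = c * c , 0≤x² c , λ a≤x x≤y _ → decay-remainder (≤-trans 0≤a a≤x) x≤y

  module _ (μ : ℝ) (0≤μ : 0# ≤ μ) (μ≤1 : μ ≤ 1#) where

    c : ℝ
    c = 1# - μ

    0≤c : 0# ≤ c
    0≤c = gap μ≤1

    rate : ℝ → ℝ
    rate t = μ * (1# - t)

    Lipschitz-rate : Lipschitz 0# 1# rate
    Lipschitz-rate = μ , 0≤μ , λ {x} {y} _ x≤y _ →
      ∣∣≤-resp (solve 3 (λ μ x y → μ :* (:1 :- y) :- μ :* (:1 :- x) := :- (μ :* (y :- x))) refl μ x y) refl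
        (≤-reflexive (trans (∣-x∣≈∣x∣ _) (0≤x⇒∣x∣≈x (*-nonNeg 0≤μ (gap x≤y)))))

    Derivative-rate : Derivative 0# 1# (λ _ → - μ) rate
    Derivative-rate = 0# , ≤-refl , λ {x} {y} _ _ _ →
      ≤-reflexive (trans (∣∣-cong
          (solve 3 (λ μ x y → μ :* (:1 :- y) :- μ :* (:1 :- x) :- :- μ :* (y :- x) := :0) refl μ x y))
                         (trans (0≤x⇒∣x∣≈x ≤-refl) (sym (zeroˡ _))))

    Lipschitz-term : ∀ k → Lipschitz 0# 1# (λ t → expTerm (rate t) k)
    Lipschitz-term zero    = Lipschitz-cong (λ {t} _ _ → sym (expTerm-zero (rate t))) (Lipschitz-const 1#)
    Lipschitz-term (suc k) = Lipschitz-cong (λ _ _ → sym (expTerm-recursion _ k))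
      (Lipschitz-scale 0≤1 _ (Lipschitz-* 0≤1 Lipschitz-rate (Lipschitz-term k)))

    Derivative-term : ∀ k → Derivative 0# 1# (λ t → - (μ * shift (expTerm (rate t)) k))
        (λ t → expTerm (rate t) k)
    Derivative-term zero    = Derivative-cong (λ _ _ → (solve 1 (λ μ → :0 := :- (μ :* :0)) refl μ))
        (λ {t} _ _ → sym (expTerm-zero (rate t))) (Derivative-const 1#)
    Derivative-term (suc k) = Derivative-cong (λ {t} _ _ → slope t)
        (λ {t} _ _ → sym (expTerm-recursion (rate t) k))
      (Derivative-scale (n ⁻¹) (Derivative-* 0≤1 Lipschitz-rate (Lipschitz-term k) Derivative-rate
          (Derivative-term k)))
      where
      n : ℝ
      n = fromℕ (suc k)

      slope : ∀ t → n ⁻¹ * (- μ * expTerm (rate t) k + rate t * - (μ * shift (expTerm (rate t)) k)) ≈ -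
          (μ * expTerm (rate t) k)
      slope t = begin-equality
        n ⁻¹ * (- μ * T + rate t * - (μ * shift (expTerm (rate t)) k))
          ≈⟨ (solve 5 (λ i μ T r s → i :* (:- μ :* T :+ r :* :- (μ :* s)) := :- (i :* μ :* (T :+ r :* s))) refl
              (n ⁻¹) μ T (rate t) (shift (expTerm (rate t)) k)) ⟩
        - (n ⁻¹ * μ * (T + rate t * shift (expTerm (rate t)) k))
          -- The rate times the previous term is `k` copies of `T`, so the product rule yields k + 1
          -- copies, which cancel the factor `n ⁻¹`.
          ≈⟨ -‿cong (*-congˡ (+-congˡ (*-shift-expTerm (rate t) k))) ⟩
        - (n ⁻¹ * μ * (T + fromℕ k * T))
          ≈⟨ (solve 4 (λ i μ T m → :- (i :* μ :* (T :+ m :* T)) := :- ((:1 :+ m) :* i :* (μ :* T))) refl (n ⁻¹)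
              μ T (fromℕ k)) ⟩
        - (n * n ⁻¹ * (μ * T))
          ≈⟨ -‿cong (trans (*-congʳ (⁻¹-inverse n (0<x⇒x≉0 (0<fromℕ-suc k)))) (*-identityˡ _)) ⟩
        - (μ * T) ∎
        where
        T : ℝ
        T = expTerm (rate t) k

    -- exp (- t) * Poisson (μ * (1# - t)) k, with the two exponentials merged.
    kernel : ℕ → ℝ → ℝ
    kernel k t = exp (- μ) * (decay 0≤c t * expTerm (rate t) k)

    Lipschitz-kernel : ∀ k → Lipschitz 0# 1# (kernel k)
    Lipschitz-kernel k = Lipschitz-scale 0≤1 _ (Lipschitz-* 0≤1 (Lipschitz-decay 0≤c ≤-refl) (Lipschitz-term k))

    Derivative-kernel : ∀ k → Derivative 0# 1# (λ t → - (c * kernel k t + μ * shift (λ j → kernel j t) k))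
        (kernel k)
    Derivative-kernel k = Derivative-cong (λ {t} _ _ → slope t) (λ _ _ → refl)
      (Derivative-scale (exp (- μ)) (Derivative-* 0≤1 (Lipschitz-decay 0≤c ≤-refl) (Lipschitz-term k)
                                                     (Derivative-decay 0≤c ≤-refl) (Derivative-term k)))
      where
      slope : ∀ t → exp (- μ) * (- (c * decay 0≤c t) * expTerm (rate t) k + decay 0≤c t * -
          (μ * shift (expTerm (rate t)) k))
                  ≈ - (c * kernel k t + μ * shift (λ j → kernel j t) k)
      slope t = trans
        (solve 6 (λ e c D T μ s → e :* (:- (c :* D) :* T :+ D :* :- (μ :* s)) := :-
            (c :* (e :* (D :* T)) :+ μ :* (e :* (D :* s)))) refl (exp (- μ)) c (decay 0≤c t)
            (expTerm (rate t) k) μ (shift (expTerm (rate t)) k))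
        (-‿cong (+-congˡ (*-congˡ (sym (trans (shift-* _ _ k) (*-congˡ (shift-* _ _ k)))))))

    kernel-nonNeg : ∀ k {t} → 0# ≤ t → t ≤ 1# → 0# ≤ kernel k t
    kernel-nonNeg k _ t≤1 = *-nonNeg (<⇒≤ (0<exp _))
        (*-nonNeg (<⇒≤ (0<exp _)) (expTerm-nonNeg (*-nonNeg 0≤μ (gap t≤1)) k))

    kernel-0 : ∀ k → kernel k 0# ≈ Poisson μ k
    kernel-0 k = *-congˡ (trans (*-cong
      (trans (exp-cong (solve 1 (λ c → :- (c :* :0) := :0) refl c)) exp-0)
      (expTerm-cong (solve 1 (λ μ → μ :* (:1 :- :0) := μ) refl μ) k)) (*-identityˡ _))

    -- At t = 1 the Poisson parameter vanishes and the exponents sum to -1. This endpoint is the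
    -- source of the atom in the decomposition of the Poisson law.
    kernel-1 : ∀ k → kernel k 1# ≈ exp (- 1#) * pointMass₀ k
    kernel-1 k = begin-equality
      exp (- μ) * (decay 0≤c 1# * expTerm (rate 1#) k)     ≈⟨ *-assoc _ _ _ ⟨
      exp (- μ) * decay 0≤c 1# * expTerm (rate 1#) k
        ≈⟨ *-cong (trans (sym (exp-+ _ _))
            (exp-cong (solve 1 (λ μ → :- μ :+ :- ((:1 :- μ) :* :1) := :- :1) refl μ)))
                                                                (trans (expTerm-cong (solve 1
                                                                    (λ μ → μ :* (:1 :- :1) := :0) refl μ) k)
                                                                    (expTerm-0≈pointMass₀ k)) ⟩
      exp (- 1#) * pointMass₀ k                            ∎

    -- Hides which of the two constructions supplies the antiderivatives, so that `I` and its
    -- recursion are used without a case split on `c`.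
    record Antiderivatives : Set where
      field
        A      : ℕ → ℝ → ℝ
        A′≈    : ∀ k → Derivative 0# 1# (kernel k) (A k)

      I : ℕ → ℝ
      I k = A k 1# - A k 0#

      field
        recursion : ∀ k → c * I k + μ * shift I k ≈ kernel k 0# - kernel k 1#

    -- Integrating kernel k′ = - (c kernel k + μ kernel (k - 1)) determines the
    -- antiderivatives recursively; for c = 0 it gives them directly.
    antiderivatives : Antiderivatives
    antiderivatives with em {c ≈ 0#}
    ... | yes c≈0 = record { A = A ; A′≈ = A′≈ ; recursion = recursion }
      where
      A : ℕ → ℝ → ℝ
      A k t = - 1# * kernel (suc k) t

      μ≈1 : μ ≈ 1#
      μ≈1 = trans (solve 1 (λ μ → μ := :1 :- (:1 :- μ)) refl μ)
          (trans (+-congˡ (-‿cong c≈0)) (solve 0 (:1 :- :0 := :1) refl))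

      A′≈ : ∀ k → Derivative 0# 1# (kernel k) (A k)
      A′≈ k = Derivative-cong
        (λ {t} _ _ → trans (*-congˡ (-‿cong (+-cong (*-congʳ c≈0) (*-congʳ μ≈1))))
                           (solve 2 (λ p q → :- :1 :* :- (:0 :* p :+ :1 :* q) := q) refl (kernel (suc k) t)
                               (kernel k t)))
        (λ _ _ → refl) (Derivative-scale (- 1#) (Derivative-kernel (suc k)))

      kernel-zero : ∀ t → kernel 0 t ≈ exp (- μ)
      kernel-zero t = trans (*-congˡ (trans (*-cong
        (trans (exp-cong (trans (-‿cong (*-congʳ c≈0)) (solve 1 (λ t → :- (:0 :* t) := :0) refl t))) exp-0)
            (expTerm-zero (rate t)))
        (*-identityˡ 1#))) (*-identityʳ _)

      I : ℕ → ℝ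
      I k = A k 1# - A k 0#

      recursion : ∀ k → c * I k + μ * shift I k ≈ kernel k 0# - kernel k 1#
      recursion zero    = trans (+-congʳ (*-congʳ c≈0))
          (trans (solve 2 (λ i μ → :0 :* i :+ μ :* :0 := :0) refl (I 0) μ)
        (sym (trans (+-cong (kernel-zero 0#) (-‿cong (kernel-zero 1#))) (-‿inverseʳ _))))
      recursion (suc k) = trans (+-cong (*-congʳ c≈0) (*-congʳ μ≈1))
        (solve 3 (λ i p q → :0 :* i :+ :1 :* (:- :1 :* p :- :- :1 :* q) := q :- p) refl (I (suc k))
            (kernel (suc k) 1#) (kernel (suc k) 0#))
    ... | no c≉0 = record { A = A ; A′≈ = A′≈ ; recursion = recursion }
      where
      cancel : ∀ x → c * c ⁻¹ * x ≈ x
      cancel x = trans (*-congʳ (⁻¹-inverse c c≉0)) (*-identityˡ x)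

      A : ℕ → ℝ → ℝ
      A zero    t = - (c ⁻¹) * kernel 0 t
      A (suc k) t = - (c ⁻¹) * (kernel (suc k) t + μ * A k t)

      A′≈ : ∀ k → Derivative 0# 1# (kernel k) (A k)
      A′≈ zero    = Derivative-cong
        (λ {t} _ _ → trans (solve 4 (λ c i p μ → :- i :* :- (c :* p :+ μ :* :0) := c :* i :* p) refl c (c ⁻¹)
            (kernel 0 t) μ) (cancel _))
        (λ _ _ → refl) (Derivative-scale (- (c ⁻¹)) (Derivative-kernel 0))
      A′≈ (suc k) = Derivative-cong
        (λ {t} _ _ → trans (solve 5 (λ c i p q μ → :- i :* (:- (c :* p :+ μ :* q) :+ μ :* q) := c :* i :* p)
            refl c (c ⁻¹) (kernel (suc k) t) (kernel k t) μ) (cancel _))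
        (λ _ _ → refl) (Derivative-scale (- (c ⁻¹)) (Derivative-+ (Derivative-kernel (suc k))
            (Derivative-scale μ (A′≈ k))))

      I : ℕ → ℝ
      I k = A k 1# - A k 0#

      recursion : ∀ k → c * I k + μ * shift I k ≈ kernel k 0# - kernel k 1#
      recursion zero    = trans
        (solve 5 (λ c i p q μ → c :* (:- i :* p :- :- i :* q) :+ μ :* :0 := c :* i :* (q :- p)) refl c (c ⁻¹)
            (kernel 0 1#) (kernel 0 0#) μ) (cancel _)
      recursion (suc k) = trans
        (solve 7 (λ c i p q μ a b → c :* (:- i :* (p :+ μ :* a) :- :- i :* (q :+ μ :* b)) :+ μ :* (a :- b) := c
            :* i :* (q :- p :+ μ :* (b :- a)) :+ μ :* (a :- b)) refl c (c ⁻¹) (kernel (suc k) 1#)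
            (kernel (suc k) 0#) μ (A k 1#) (A k 0#))
        (trans (+-congʳ (cancel _)) (solve 5 (λ p q μ a b → q :- p :+ μ :* (b :- a) :+ μ :* (a :- b) := q :- p)
            refl (kernel (suc k) 1#) (kernel (suc k) 0#) μ (A k 1#) (A k 0#)))

    open Antiderivatives antiderivatives public

    I-nonNeg : ∀ k → 0# ≤ I k
    I-nonNeg k = gap (0≤f⇒F-increasing (A′≈ k) (kernel-nonNeg k) ≤-refl 0≤1 ≤-refl)

    -- The Poisson mass is the kernel at t = 0; the recursion recovers it from `I` and the kernel at
    -- t = 1.
    Poisson-decomposition : ∀ k → Poisson μ k ≈ c * I k + μ * shift I k + exp (- 1#) * pointMass₀ k
    Poisson-decomposition k = begin-equality
      Poisson μ k                                                         ≈⟨ kernel-0 k ⟨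
      kernel k 0#
        ≈⟨ (solve 2 (λ p q → p := p :- q :+ q) refl (kernel k 0#) (kernel k 1#)) ⟩
      kernel k 0# - kernel k 1# + kernel k 1#
        ≈⟨ +-cong (sym (recursion k)) (kernel-1 k) ⟩
      c * I k + μ * shift I k + exp (- 1#) * pointMass₀ k                 ∎

    -- Evaluation of the improper integral across the kink at t = 1.

    integrand : ℕ → ℝ → ℝ
    integrand k t = exp (- t) * Poisson (μ * (1# - t) ⁺) k

    integrand-left : ∀ k {t} → t ≤ 1# → integrand k t ≈ kernel k t
    integrand-left k {t} t≤1 = begin-equality
      exp (- t) * (exp (- (μ * (1# - t) ⁺)) * expTerm (μ * (1# - t) ⁺) k)
        ≈⟨ *-congˡ (*-cong (exp-cong (-‿cong (*-congˡ 1-t⁺≈))) (expTerm-cong (*-congˡ 1-t⁺≈) k)) ⟩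
      exp (- t) * (exp (- rate t) * expTerm (rate t) k)
        ≈⟨ *-assoc _ _ _ ⟨
      exp (- t) * exp (- rate t) * expTerm (rate t) k
        ≈⟨ *-congʳ (trans (sym (exp-+ _ _))
            (trans (exp-cong (solve 2 (λ μ t → :- t :+ :- (μ :* (:1 :- t)) := :- μ :+ :- ((:1 :- μ) :* t)) refl
            μ t)) (exp-+ _ _))) ⟩
      exp (- μ) * decay 0≤c t * expTerm (rate t) k
        ≈⟨ *-assoc _ _ _ ⟩
      kernel k t ∎
      where
      1-t⁺≈ : (1# - t) ⁺ ≈ 1# - t
      1-t⁺≈ = x≤y⇒y⊔x≈y (gap t≤1)

    -- Beyond t = 1 the Poisson parameter is 0. The doubly negated side is literally the slope that
    -- scaling `Derivative-decay` assigns to `B`.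
    integrand-right : ∀ k {t} → 1# ≤ t → - pointMass₀ k * - (1# * decay 0≤1 t) ≈ integrand k t
    integrand-right k {t} 1≤t = sym (begin-equality
      exp (- t) * (exp (- (μ * (1# - t) ⁺)) * expTerm (μ * (1# - t) ⁺) k)
        ≈⟨ *-cong (exp-cong (solve 1 (λ t → :- t := :- (:1 :* t)) refl t))
                  (*-cong (trans (exp-cong (trans (-‿cong rate≈0) (solve 0 (:- :0 := :0) refl))) exp-0)
                          (trans (expTerm-cong rate≈0 k) (expTerm-0≈pointMass₀ k))) ⟩
      decay 0≤1 t * (1# * pointMass₀ k)
        ≈⟨ (solve 2 (λ D m → D :* (:1 :* m) := :- m :* :- (:1 :* D)) refl (decay 0≤1 t) (pointMass₀ k)) ⟩
      - pointMass₀ k * - (1# * decay 0≤1 t) ∎)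
      where
      rate≈0 : μ * (1# - t) ⁺ ≈ 0#
      rate≈0 = trans (*-congˡ (x≤y⇒x⊔y≈y (≤-by (solve 1 (λ t → :0 :- (:1 :- t) := t :- :1) refl t) (gap 1≤t))))
          (zeroʳ μ)

    module _ (k n : ℕ) where

      b : ℝ
      b = fromℕ (suc n)

      1≤b : 1# ≤ b
      1≤b = x≤x+y (0≤fromℕ n)

      B : ℝ → ℝ
      B t = - pointMass₀ k * decay 0≤1 t

      B′≈ : Derivative 1# b (integrand k) B
      B′≈ = Derivative-cong (λ 1≤t _ → integrand-right k 1≤t) (λ _ _ → refl)
        (Derivative-scale (- pointMass₀ k) (Derivative-decay 0≤1 0≤1))

      -- The added constants make the two branches agree at the kink, where both equal
      -- `A k 1# + B 1#`.
      pasted : ℝ → ℝ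
      pasted t with em {t ≤ 1#}
      ... | yes _ = A k t + B 1#
      ... | no  _ = A k 1# + B t

      pasted-left : ∀ {t} → t ≤ 1# → A k t + B 1# ≈ pasted t
      pasted-left {t} t≤1 with em {t ≤ 1#}
      ... | yes _   = refl
      ... | no  t≰1 = ⊥-elim (t≰1 t≤1)

      pasted-right : ∀ {t} → 1# ≤ t → t ≤ b → A k 1# + B t ≈ pasted t
      pasted-right {t} 1≤t t≤b with em {t ≤ 1#}
      ... | no  _   = refl
      ... | yes t≤1 = trans
        (solve 4 (λ p q r s → p :+ s := q :+ r :+ (p :- q) :+ (s :- r)) refl (A k 1#) (A k t) (B 1#) (B t))
        -- Here `t` is only equivalent to `1#`, so `A k` and `B` must be known to respect `_≈_`
        -- there.
        (trans (+-cong (+-congˡ (Derivative-cong-arg (A′≈ k) (≤-trans 0≤1 1≤t) ≤-refl (sym 1≈t)))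
                       (Derivative-cong-arg B′≈ ≤-refl t≤b 1≈t))
               (solve 1 (λ x → x :+ :0 :+ :0 := x) refl (A k t + B 1#)))
        where
        1≈t = ≤-antisym 1≤t t≤1

      Lipschitz-integrand : Lipschitz 0# b (integrand k)
      Lipschitz-integrand = Lipschitz-glue
        (Lipschitz-cong (λ _ t≤1 → sym (integrand-left k t≤1)) (Lipschitz-kernel k))
        (Lipschitz-cong (λ 1≤t _ → trans (solve 2 (λ m D → m :* D := :- m :* :- (:1 :* D)) refl (pointMass₀ k)
            (decay 0≤1 _)) (integrand-right k 1≤t))
          (Lipschitz-scale 1≤b (pointMass₀ k) (Lipschitz-decay 0≤1 0≤1)))

      Derivative-pasted : Derivative 0# b (integrand k) pasted
      Derivative-pasted = Derivative-glue Lipschitz-integrand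
        (Derivative-cong (λ {t} _ t≤1 → trans (+-identityʳ _) (sym (integrand-left k t≤1))) (λ _ → pasted-left)
          (Derivative-+ (A′≈ k) (Derivative-const (B 1#))))
        (Derivative-cong (λ _ _ → +-identityˡ _) pasted-right (Derivative-+ (Derivative-const (A k 1#)) B′≈))

      ∫-integrand : ∫ 0# b (integrand k) ≈ I k + exp (- 1#) * pointMass₀ k - pointMass₀ k * exp (- b)
      ∫-integrand = begin-equality
        ∫ 0# b (integrand k)
          ≈⟨ fundamental-theorem (≤-trans 0≤1 1≤b) Lipschitz-integrand Derivative-pasted ⟩
        pasted b - pasted 0#
          ≈⟨ +-cong (sym (pasted-right 1≤b ≤-refl)) (-‿cong (sym (pasted-left 0≤1))) ⟩
        A k 1# + - m * decay 0≤1 b - (A k 0# + - m * decay 0≤1 1#)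
          ≈⟨ +-cong (+-congˡ (*-congˡ (exp-cong (solve 1 (λ b → :- (:1 :* b) := :- b) refl b))))
                    (-‿cong (+-congˡ (*-congˡ (exp-cong (solve 0 (:- (:1 :* :1) := :- :1) refl))))) ⟩
        A k 1# + - m * exp (- b) - (A k 0# + - m * exp (- 1#))
          ≈⟨ (solve 5 (λ p q m E e → p :+ :- m :* E :- (q :+ :- m :* e) := p :- q :+ e :* m :- m :* E) refl
              (A k 1#) (A k 0#) m (exp (- b)) (exp (- 1#))) ⟩
        I k + exp (- 1#) * m - m * exp (- b) ∎
        where
        m : ℝ
        m = pointMass₀ k

    0≤pointMass₀ : ∀ k → 0# ≤ pointMass₀ k
    0≤pointMass₀ zero    = 0≤1
    0≤pointMass₀ (suc k) = ≤-refl

    pointMass₀≤1 : ∀ k → pointMass₀ k ≤ 1#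
    pointMass₀≤1 zero    = ≤-refl
    pointMass₀≤1 (suc k) = 0≤1

    Swap-≈ : ∀ k → Swap μ k ≈ I k + exp (- 1#) * pointMass₀ k
    -- `⟶-suc` skips the upper limit 0, since the integral is evaluated only for limits n + 1 ≥ 1.
    -- The error times n + 1 is at most (n + 1) exp (- (n + 1)) ≤ 1, so the rate constant is `1#`.
    Swap-≈ k = lim-≈ (⟶-suc (⟶-rate 1# λ n → begin
      ∣ ∫ 0# (b k n) (integrand k) - l ∣ * b k n
        ≈⟨ *-congʳ (∣∣-cong (trans (+-congʳ (∫-integrand k n)) (solve 2 (λ l x → l :- x :- l := :- x) refl l
            (pointMass₀ k * exp (- b k n))))) ⟩
      ∣ - (pointMass₀ k * exp (- b k n)) ∣ * b k n
        ≈⟨ *-congʳ (trans (∣-x∣≈∣x∣ _) (0≤x⇒∣x∣≈x (*-nonNeg (0≤pointMass₀ k) (<⇒≤ (0<exp _))))) ⟩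
      pointMass₀ k * exp (- b k n) * b k n
        ≈⟨ *-assoc _ _ _ ⟩
      pointMass₀ k * (exp (- b k n) * b k n)
        ≤⟨ *-mono-≤ (0≤pointMass₀ k) (pointMass₀≤1 k) (*-nonNeg (<⇒≤ (0<exp _)) (0≤fromℕ (suc n)))
             (≤-trans (*-monoˡ-≤ (<⇒≤ (0<exp _)) (≤-trans (x≤x+y 0≤1) (≤-reflexive (+-comm _ _))))
                 (exp-neg*[1+z]≤1 (0≤fromℕ (suc n)))) ⟩
      1# * 1#
        ≈⟨ *-identityˡ 1# ⟩
      1# ∎))
      where
      l : ℝ
      l = I k + exp (- 1#) * pointMass₀ k

-- Dominance through double partial sums.

module Dominance (em : ExcludedMiddle 0ℓ) (R : CompleteOrderedField) where

  open Probability em R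
  open RealField em R
  open Limits em R
  open Convolution em R
  open ≤-Reasoning ≤-poset

  NonNeg : Dist → Set
  NonNeg D = ∀ k → 0# ≤ D k

  psum² : (ℕ → ℝ) → ℕ → ℝ
  psum² a = psum (psum a)

  -- For X with law D, psum² D (suc n) is the expectation of (n - X)⁺, so this is
  -- second-order dominance tested on the functions x ↦ - (n - x)⁺ only.
  infix 4 _≽_
  _≽_ : Dist → Dist → Set
  D ≽ D′ = ∀ n → psum² D n ≤ psum² D′ n

  psum²-cong : ∀ {a b} → (∀ k → a k ≈ b k) → ∀ n → psum² a n ≈ psum² b n
  psum²-cong {a} {b} a≈b = psum-cong {psum a} {psum b} (psum-cong {a} {b} a≈b)

  psum²-⊞ : ∀ f g n → psum² (f ⊞ g) n ≈ (f ⊞ psum² g) n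
  psum²-⊞ f g n = trans (psum-cong {psum (f ⊞ g)} {f ⊞ psum g} (psum-⊞ f g) n) (psum-⊞ f (psum g) n)

  ≽-trans : ∀ {D D′ D″} → D ≽ D′ → D′ ≽ D″ → D ≽ D″
  ≽-trans D≽D′ D′≽D″ n = ≤-trans (D≽D′ n) (D′≽D″ n)

  ≽-reflexive : ∀ {D D′} → (∀ k → D k ≈ D′ k) → D ≽ D′
  ≽-reflexive {D} {D′} D≈D′ n = ≤-reflexive (psum²-cong {D} {D′} D≈D′ n)

  -- Both partial summations move onto the second factor, where the hypothesis is a termwise
  -- inequality that the non-negative weights of `D` preserve.
  ⊞-monoʳ-≽ : ∀ {D E E′} → NonNeg D → E ≽ E′ → D ⊞ E ≽ D ⊞ E′
  ⊞-monoʳ-≽ {D} {E} {E′} 0≤D E≽E′ n = begin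
    psum² (D ⊞ E) n      ≈⟨ psum²-⊞ D E n ⟩
    (D ⊞ psum² E) n      ≤⟨ ⊞-monoʳ {D} {psum² E} {psum² E′} 0≤D E≽E′ n ⟩
    (D ⊞ psum² E′) n     ≈⟨ psum²-⊞ D E′ n ⟨
    psum² (D ⊞ E′) n     ∎

  -- One factor is exchanged at a time, by way of `D ⊞ E′`; the factor held fixed is `D` in the
  -- first exchange and `E′` in the second.
  ⊞-mono-≽ : ∀ {D D′ E E′} → NonNeg D → NonNeg E′ → D ≽ D′ → E ≽ E′ → D ⊞ E ≽ D′ ⊞ E′
  ⊞-mono-≽ {D} {D′} {E} {E′} 0≤D 0≤E′ D≽D′ E≽E′ =
    ≽-trans {D ⊞ E} {D ⊞ E′} {D′ ⊞ E′} (⊞-monoʳ-≽ {D} {E} {E′} 0≤D E≽E′)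
    (≽-trans {D ⊞ E′} {E′ ⊞ D} {D′ ⊞ E′} (≽-reflexive {D ⊞ E′} {E′ ⊞ D} (⊞-comm D E′))
    (≽-trans {E′ ⊞ D} {E′ ⊞ D′} {D′ ⊞ E′} (⊞-monoʳ-≽ {E′} {D} {D′} 0≤E′ D≽D′)
      (≽-reflexive {E′ ⊞ D′} {D′ ⊞ E′} (⊞-comm E′ D′))))

  0≤n*[n-1] : ∀ n → 0# ≤ fromℕ n * (fromℕ n - 1#)
  0≤n*[n-1] zero    = ≤-reflexive (sym (zeroˡ _))
  0≤n*[n-1] (suc n) = ≤-trans (*-nonNeg (0≤fromℕ (suc n)) (0≤fromℕ n))
    (≤-reflexive (solve 1 (λ x → (:1 :+ x) :* x := (:1 :+ x) :* (:1 :+ x :- :1)) refl (fromℕ n)))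

  -- The polynomial is chosen for the induction: twice its value at n exceeds its value at n + 1 by
  -- n (n - 1), which is non-negative at every natural.
  n²+n+2≤2^1+n : ∀ n → fromℕ n * fromℕ n + fromℕ n + (1# + 1#) ≤ 2^ (suc n)
  n²+n+2≤2^1+n zero    = ≤-reflexive (solve 0 (:0 :* :0 :+ :0 :+ :2 := :2 :* :1) refl)
  n²+n+2≤2^1+n (suc n) = ≤-trans
    (≤-by (solve 1 (λ x → :2 :* (x :* x :+ x :+ :2) :- ((:1 :+ x) :* (:1 :+ x) :+ (:1 :+ x) :+ :2) := x :*
        (x :- :1)) refl (fromℕ n)) (0≤n*[n-1] n))
    (*-monoˡ-≤ (0≤+ 0≤1 0≤1) (n²+n+2≤2^1+n n))

  [1+n]²≤4*2^n : ∀ n → fromℕ (suc n) * fromℕ (suc n) ≤ (1# + 1#) * ((1# + 1#) * 2^ n)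
  [1+n]²≤4*2^n n = ≤-trans
    (≤-by (solve 1 (λ x → x :* x :+ x :+ :2 :- x :* x := x :+ :2) refl (fromℕ (suc n)))
        (0≤+ (0≤fromℕ (suc n)) (0≤+ 0≤1 0≤1)))
    (n²+n+2≤2^1+n (suc n))

  -- From double partial sums to concave non-decreasing functions.

  module _ {f : ℝ → ℝ} (f-mono : NonDecreasing f) (f-concave : Concave f) where

    v d : ℕ → ℝ
    v k = f (fromℕ k)
    d k = v (suc k) - v k

    0≤d : ∀ k → 0# ≤ d k
    0≤d k = gap (f-mono (fromℕ-mono-≤ (ℕ.n≤1+n k)))

    d-decreasing : ∀ k → d (suc k) ≤ d k
    d-decreasing k = ≤-by
      -- The solver cannot use `2½≈1`, so the coefficients of value 1 are isolated, rewritten to 2 ·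
      -- ½, and the midpoint inequality is then factored out.
      (trans (solve 3 (λ p q r → q :- p :- (r :- q) := :2 :* q :- :1 :* p :- (:2 :- :1) :* r) refl (v k)
          (v (suc k)) (v (suc (suc k))))
        (trans (+-cong (+-congˡ (-‿cong (*-congʳ (sym 2½≈1)))) (-‿cong (*-congʳ (+-congˡ (-‿cong (sym 2½≈1))))))
          (solve 4 (λ h p q r → :2 :* q :- :2 :* h :* p :- (:2 :- :2 :* h) :* r := :2 :*
              (q :- (h :* p :+ (:1 :- h) :* r))) refl (½) (v k) (v (suc k)) (v (suc (suc k))))))
      (*-nonNeg (0≤+ 0≤1 0≤1) (gap (≤-trans
        (f-concave (fromℕ k) (fromℕ (suc (suc k))) ½ (<⇒≤ 0<½) ½≤1)
        -- Monotonicity is what makes `f` respect `_≈_`.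
        (f-mono (≤-reflexive midpoint)))))
      where
      ½≤1 : ½ ≤ 1#
      ½≤1 = ≤-trans (≤-by (solve 1 (λ h → :2 :* h :- h := h) refl (½)) (<⇒≤ 0<½)) (≤-reflexive 2½≈1)

      midpoint : ½ * fromℕ k + (1# - ½) * fromℕ (suc (suc k)) ≈ fromℕ (suc k)
      midpoint = trans (solve 2 (λ h x → h :* x :+ (:1 :- h) :* (:1 :+ (:1 :+ x)) := x :+ :2 :- :2 :* h) refl
          (½) (fromℕ k))
        (trans (+-congˡ (-‿cong 2½≈1)) (solve 1 (λ x → x :+ :2 :- :1 := :1 :+ x) refl (fromℕ k)))

    d≤d0 : ∀ k → d k ≤ d 0
    d≤d0 zero    = ≤-refl
    d≤d0 (suc k) = ≤-trans (d-decreasing k) (d≤d0 k)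

    M : ℝ
    M = ∣ v 0 ∣ + d 0

    0≤M : 0# ≤ M
    0≤M = 0≤+ (0≤∣x∣ _) (0≤d 0)

    linear-growth : ∀ k → ∣ v k ∣ ≤ M * fromℕ (suc k)
    linear-growth zero    = ≤-trans (x≤x+y (0≤d 0)) (≤-reflexive (solve 1 (λ M → M := M :* (:1 :+ :0)) refl M))
    linear-growth (suc k) = begin
      ∣ v (suc k) ∣
        ≈⟨ ∣∣-cong (solve 2 (λ p q → q := p :+ (q :- p)) refl (v k) (v (suc k))) ⟩
      ∣ v k + d k ∣                     ≤⟨ ∣x+y∣≤∣x∣+∣y∣ _ _ ⟩
      ∣ v k ∣ + ∣ d k ∣                 ≤⟨ +-mono-≤ (linear-growth k) (≤-trans (≤-reflexive (0≤x⇒∣x∣≈x (0≤d k)))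
                                            (≤-trans (d≤d0 k) (≤-by (solve 2 (λ x y → x :+ y :- y := x) refl
                                                (∣ v 0 ∣) (d 0)) (0≤∣x∣ _)))) ⟩
      M * fromℕ (suc k) + M
        ≈⟨ (solve 2 (λ M x → M :* x :+ M := M :* (:1 :+ x)) refl M (fromℕ (suc k))) ⟩
      M * fromℕ (suc (suc k))           ∎

    -- By linear growth ∣v k∣ ≤ M (k + 1) ≤ M 2ᵏ, so the 2ᵏ-moment of `D` dominates the series.
    𝐄-converges : ∀ {D A} → D ⇝ A → psum (λ k → D k * v k) ⟶ 𝐄 D f
    𝐄-converges {D} D⇝A = ⟶-cong (λ _ → refl) (sym (lim-≈ (proj₂ E))) (proj₂ E)
      where
      E : ∃ λ l → psum (λ k → D k * v k) ⟶ l
      E = absolute-convergence {λ k → D k * v k} (M * bound D⇝A) λ n → begin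
        psum (λ k → ∣ D k * v k ∣) n
          ≤⟨ psum-mono {λ k → ∣ D k * v k ∣} {λ k → M * weigh (abs D) k} (λ k → begin
               ∣ D k * v k ∣            ≈⟨ ∣x*y∣≈∣x∣*∣y∣ (D k) (v k) ⟩
               ∣ D k ∣ * ∣ v k ∣
                 ≤⟨ *-monoˡ-≤ (0≤∣x∣ _) (≤-trans (linear-growth k) (*-monoˡ-≤ 0≤M (1+n≤2^ k))) ⟩
               ∣ D k ∣ * (M * 2^ k)
                 ≈⟨ (solve 3 (λ x M w → x :* (M :* w) := M :* (x :* w)) refl (∣ D k ∣) M (2^ k)) ⟩
               M * weigh (abs D) k      ∎) n ⟩
        psum (λ k → M * weigh (abs D) k) n
          ≈⟨ psum-* M (weigh (abs D)) n ⟩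
        M * psum (weigh (abs D)) n
          ≤⟨ *-monoˡ-≤ 0≤M (moment D⇝A n) ⟩
        M * bound D⇝A ∎

    module _ (a : ℕ → ℝ) (psum²≤0 : ∀ n → psum² a n ≤ 0#) where

      W : ℕ → ℝ
      W = psum (λ k → d k * psum a (suc k))

      summation-by-parts : ∀ n → psum (λ k → a k * v k) n + W n ≈ v n * psum a n
      summation-by-parts zero    = (solve 1 (λ x → :0 :+ :0 := x :* :0) refl (v 0))
      summation-by-parts (suc n) = begin-equality
        psum (λ k → a k * v k) (suc n) + W (suc n)
          ≈⟨ +-cong (psum-last (λ k → a k * v k) n) (psum-last (λ k → d k * psum a (suc k)) n) ⟩
        psum (λ k → a k * v k) n + a n * v n + (W n + d n * psum a (suc n))
          ≈⟨ (solve 4 (λ s x w y → s :+ x :+ (w :+ y) := s :+ w :+ x :+ y) refl (psum (λ k → a k * v k) n)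
              (a n * v n) (W n) (d n * psum a (suc n))) ⟩
        psum (λ k → a k * v k) n + W n + a n * v n + d n * psum a (suc n)
          ≈⟨ +-cong (+-congʳ (summation-by-parts n)) (*-congˡ (psum-last a n)) ⟩
        v n * psum a n + a n * v n + d n * (psum a n + a n)
          ≈⟨ (solve 4 (λ p q t x → p :* t :+ x :* p :+ (q :- p) :* (t :+ x) := q :* (t :+ x)) refl (v n)
              (v (suc n)) (psum a n) (a n)) ⟩
        v (suc n) * (psum a n + a n)
          ≈⟨ *-congˡ (psum-last a n) ⟨
        v (suc n) * psum a (suc n) ∎

      -- The second summation by parts, as an inequality: the discarded terms are differences d n -
      -- d (n + 1) ≥ 0 times double sums ≤ 0. Since `psum a 0` is 0, `psum² a (suc n)` sums exactly
      -- the `n` values of `psum a` that occur in `W n`.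
      W≤ : ∀ n → W n ≤ d n * psum² a (suc n)
      W≤ zero    = ≤-reflexive (solve 1 (λ x → :0 := x :* (:0 :+ :0)) refl (d 0))
      W≤ (suc n) = begin
        W (suc n)                                            ≈⟨ psum-last (λ k → d k * psum a (suc k)) n ⟩
        W n + d n * psum a (suc n)                           ≤⟨ +-mono-≤ (W≤ n) ≤-refl ⟩
        d n * psum² a (suc n) + d n * psum a (suc n)
          ≈⟨ trans (sym (distribˡ _ _ _)) (*-congˡ (sym (psum-last (psum a) (suc n)))) ⟩
        d n * psum² a (suc (suc n))
          ≤⟨ ≤-by (solve 3 (λ x y u → y :* u :- x :* u := (x :- y) :* (:0 :- u)) refl (d n) (d (suc n))
              (psum² a (suc (suc n))))
                                                                 (*-nonNeg (gap (d-decreasing n))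
                                                                     (gap (psum²≤0 (suc (suc n))))) ⟩
        d (suc n) * psum² a (suc (suc n))                    ∎

      lower-bound : ∀ n → - (∣ v n ∣ * ∣ psum a n ∣) ≤ psum (λ k → a k * v k) n
      lower-bound n = begin
        - (∣ v n ∣ * ∣ psum a n ∣)     ≈⟨ -‿cong (∣x*y∣≈∣x∣*∣y∣ _ _) ⟨
        - ∣ v n * psum a n ∣
          ≤⟨ ≤-by (solve 2 (λ x y → x :- :- y := y :- :- x) refl (v n * psum a n) (∣ v n * psum a n ∣))
              (gap (-x≤∣x∣ _)) ⟩
        v n * psum a n                 ≈⟨ summation-by-parts n ⟨
        psum (λ k → a k * v k) n + W n
          ≤⟨ ≤-by (solve 2 (λ s w → s :- (s :+ w) := :0 :- w) refl (psum (λ k → a k * v k) n) (W n)) (gap W≤0) ⟩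
        psum (λ k → a k * v k) n       ∎
        where
        W≤0 : W n ≤ 0#
        W≤0 = ≤-trans (W≤ n) (≤-by (solve 2 (λ x u → :0 :- x :* u := x :* (:0 :- u)) refl (d n)
            (psum² a (suc n)))
          (*-nonNeg (0≤d n) (gap (psum²≤0 (suc n)))))

    𝐄-mono : ∀ {D D′} → D ⇝ 1# → D′ ⇝ 1# → D ≽ D′ → 𝐄 D′ f ≤ 𝐄 D f
    𝐄-mono {D} {D′} D⇝1 D′⇝1 D≽D′ = ≤-by
      (solve 2 (λ x y → x :- y := :0 :- (y :- x :- :0)) refl (𝐄 D f) (𝐄 D′ f))
      (gap (⟶-≤ (⟶-- (⟶-- (𝐄-converges D′⇝1) (𝐄-converges D⇝1)) r⟶0) λ n → ≤-by
        (solve 3 (λ s s′ r → :0 :- (s′ :- s :- r) := s :- s′ :- (:- r)) refl (psum (λ k → D k * v k) n)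
            (psum (λ k → D′ k * v k) n) (r n))
        (gap (≤-trans (lower-bound a psum²a≤0 n) (≤-reflexive (trans
          (psum-cong {λ k → a k * v k} {λ k → D k * v k - D′ k * v k}
              (λ k → (solve 3 (λ x y z → (x :- y) :* z := x :* z :- y :* z) refl (D k) (D′ k) (v k))) n)
          (psum-- (λ k → D k * v k) (λ k → D′ k * v k) n)))))))
      where
      a r : ℕ → ℝ
      a k = D k - D′ k
      r n = ∣ v n ∣ * ∣ psum a n ∣

      psum²a≤0 : ∀ n → psum² a n ≤ 0#
      psum²a≤0 n = ≤-trans (≤-reflexive (trans (psum-cong {psum a} {λ k → psum D k - psum D′ k} (psum-- D D′) n)
          (psum-- (psum D) (psum D′) n)))
        (≤-by (solve 2 (λ x y → :0 :- (x :- y) := y :- x) refl (psum² D n) (psum² D′ n)) (gap (D≽D′ n)))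

      N : ℝ
      N = bound D′⇝1 + bound D⇝1

      -- Both laws have total mass 1, so `psum a n` is a difference of their tails.
      tail-bound : ∀ n → ∣ psum a n ∣ * 2^ n ≤ N
      tail-bound n = begin
        ∣ psum a n ∣ * 2^ n
          ≈⟨ *-congʳ (∣∣-cong (trans (psum-- D D′ n) (solve 2 (λ x y → x :- y := :1 :- y :- (:1 :- x)) refl
              (psum D n) (psum D′ n)))) ⟩
        ∣ 1# - psum D′ n - (1# - psum D n) ∣ * 2^ n
          ≤⟨ *-monoʳ-≤ (0≤2^ n) (≤-trans (∣x+y∣≤∣x∣+∣y∣ _ _) (+-monoʳ-≤ _ (≤-reflexive (∣-x∣≈∣x∣ _)))) ⟩
        (∣ 1# - psum D′ n ∣ + ∣ 1# - psum D n ∣) * 2^ n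
          ≈⟨ distribʳ _ _ _ ⟩
        ∣ 1# - psum D′ n ∣ * 2^ n + ∣ 1# - psum D n ∣ * 2^ n
          ≤⟨ +-mono-≤ (tail D′⇝1 n) (tail D⇝1 n) ⟩
        N ∎

      r⟶0 : r ⟶ 0#
      -- One factor n + 1 is the growth of `v`, the other is demanded by `⟶-rate`. Their product is
      -- at most 4 · 2ⁿ, which the tail bound absorbs; hence the constant 4 M N.
      r⟶0 = ⟶-rate ((1# + 1#) * ((1# + 1#) * (M * N))) λ n → begin
        ∣ r n - 0# ∣ * fromℕ (suc n)
          ≈⟨ *-congʳ (trans (∣∣-cong (solve 1 (λ x → x :- :0 := x) refl (r n)))
              (0≤x⇒∣x∣≈x (*-nonNeg (0≤∣x∣ _) (0≤∣x∣ _)))) ⟩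
        ∣ v n ∣ * ∣ psum a n ∣ * fromℕ (suc n)
          ≤⟨ *-monoʳ-≤ (0≤fromℕ (suc n)) (*-monoʳ-≤ (0≤∣x∣ _) (linear-growth n)) ⟩
        M * fromℕ (suc n) * ∣ psum a n ∣ * fromℕ (suc n)
          ≈⟨ (solve 3 (λ M x t → M :* x :* t :* x := M :* t :* (x :* x)) refl M (fromℕ (suc n))
              (∣ psum a n ∣)) ⟩
        M * ∣ psum a n ∣ * (fromℕ (suc n) * fromℕ (suc n))
          ≤⟨ *-monoˡ-≤ (*-nonNeg 0≤M (0≤∣x∣ _)) ([1+n]²≤4*2^n n) ⟩
        M * ∣ psum a n ∣ * ((1# + 1#) * ((1# + 1#) * 2^ n))
          ≈⟨ (solve 3 (λ M t w → M :* t :* (:2 :* (:2 :* w)) := :2 :* (:2 :* (M :* (t :* w)))) refl M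
              (∣ psum a n ∣) (2^ n)) ⟩
        (1# + 1#) * ((1# + 1#) * (M * (∣ psum a n ∣ * 2^ n)))
          ≤⟨ *-monoˡ-≤ (0≤+ 0≤1 0≤1) (*-monoˡ-≤ (0≤+ 0≤1 0≤1) (*-monoˡ-≤ 0≤M (tail-bound n))) ⟩
        (1# + 1#) * ((1# + 1#) * (M * N)) ∎

  ≽⇒⪰ : ∀ {D D′} → D ⇝ 1# → D′ ⇝ 1# → D ≽ D′ → D ⪰ D′
  ≽⇒⪰ D⇝1 D′⇝1 D≽D′ f f-mono f-concave = 𝐄-mono {f} f-mono f-concave D⇝1 D′⇝1 D≽D′

-- Comparison of `MarkSwap` with the Poisson law.

module MarkSwapDominance (em : ExcludedMiddle 0ℓ) (R : CompleteOrderedField) where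

  open Probability em R
  open RealField em R
  open Limits em R
  open Convolution em R
  open Exponential em R
  open SwapDistribution em R
  open Dominance em R
  open ≤-Reasoning ≤-poset

  -- Light-tailed probability laws: the 2ᵏ-moment is part of `_⇝_`. This suffices for `𝐄` to
  -- converge and is stable under `_⊞_`.
  record Light (D : Dist) : Set where
    constructor light
    field
      nonNeg : NonNeg D
      total  : D ⇝ 1#

  open Light

  Light-⊞ : ∀ {D E} → Light D → Light E → Light (D ⊞ E)
  Light-⊞ {D} {E} D-light E-light = light (⊞-nonNeg {D} {E} (nonNeg D-light) (nonNeg E-light))
    (⇝-cong (λ _ → refl) (*-identityˡ 1#) (⇝-⊞ (total D-light) (total E-light)))

  Light-pointMass₀ : Light pointMass₀
  Light-pointMass₀ = light (λ { zero → 0≤1 ; (suc k) → ≤-refl })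
    (⇝-cong (λ _ → refl) (+-identityʳ 1#) (finite-⇝ pointMass₀ (λ _ → refl)))

  Bern-⇝ : ∀ q → Bern q ⇝ 1#
  Bern-⇝ q = ⇝-cong (λ _ → refl) (solve 1 (λ q → :1 :- q :+ q := :1) refl q) (finite-⇝ (Bern q) (λ _ → refl))

  Bern-nonNeg : ∀ {q} → 0# ≤ q → q ≤ 1# → NonNeg (Bern q)
  Bern-nonNeg 0≤q q≤1 zero          = gap q≤1
  Bern-nonNeg 0≤q q≤1 (suc zero)    = 0≤q
  Bern-nonNeg 0≤q q≤1 (suc (suc k)) = ≤-refl

  zero-⊞ : ∀ {f} → (∀ k → f k ≈ 0#) → ∀ g n → (f ⊞ g) n ≈ 0#
  zero-⊞ f≈0 g zero    = trans (+-identityʳ _) (trans (*-congʳ (f≈0 0)) (zeroˡ _))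
  zero-⊞ f≈0 g (suc n) = trans (+-cong (trans (*-congʳ (f≈0 0)) (zeroˡ _)) (zero-⊞ (f≈0 ∘ suc) g n))
      (+-identityˡ 0#)

  Bern-⊞ : ∀ q a k → (Bern q ⊞ a) k ≈ (1# - q) * a k + q * shift a k
  Bern-⊞ q a zero          = (solve 2 (λ q x → (:1 :- q) :* x :+ :0 := (:1 :- q) :* x :+ q :* :0) refl q (a 0))
  Bern-⊞ q a (suc zero)    = +-congˡ (+-identityʳ _)
  Bern-⊞ q a (suc (suc k)) = +-congˡ (trans (+-congˡ (zero-⊞ {λ j → Bern q (suc (suc j))} (λ _ → refl) a k))
      (+-identityʳ _))

  Poisson-cong : ∀ {x y} → x ≈ y → ∀ k → Poisson x k ≈ Poisson y k
  Poisson-cong x≈y k = *-cong (exp-cong (-‿cong x≈y)) (expTerm-cong x≈y k)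

  Poisson-0 : ∀ k → Poisson 0# k ≈ pointMass₀ k
  Poisson-0 k = trans (*-cong (trans (exp-cong (solve 0 (:- :0 := :0) refl)) exp-0) (expTerm-0≈pointMass₀ k))
      (*-identityˡ _)

  Poisson-⊞ : ∀ x y k → (Poisson x ⊞ Poisson y) k ≈ Poisson (x + y) k
  Poisson-⊞ x y k = begin-equality
    (Poisson x ⊞ Poisson y) k
      ≈⟨ trans (⊞-*ˡ (exp (- x)) (expTerm x) (Poisson y) k)
          (*-congˡ (⊞-*ʳ (exp (- y)) (expTerm x) (expTerm y) k)) ⟩
    exp (- x) * (exp (- y) * (expTerm x ⊞ expTerm y) k)
      ≈⟨ *-assoc _ _ _ ⟨
    exp (- x) * exp (- y) * (expTerm x ⊞ expTerm y) k
      ≈⟨ *-cong (trans (sym (exp-+ _ _)) (exp-cong (solve 2 (λ x y → :- x :+ :- y := :- (x :+ y)) refl x y)))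
          (expTerm-⊞ x y k) ⟩
    Poisson (x + y) k ∎

  Light-Poisson : ∀ {x} → 0# ≤ x → Light (Poisson x)
  Light-Poisson {x} 0≤x = light (λ k → *-nonNeg (<⇒≤ (0<exp _)) (expTerm-nonNeg 0≤x k))
    (⇝-cong (λ _ → refl) (trans (*-comm _ _) (exp-inverse x)) (⇝-* (exp (- x)) (exp-⇝ x)))

  module _ (μ : ℝ) (0≤μ : 0# ≤ μ) (μ≤1 : μ ≤ 1#) where

    private
      I₀ : ℕ → ℝ
      I₀ = I μ 0≤μ μ≤1

      0≤I : NonNeg I₀
      0≤I = I-nonNeg μ 0≤μ μ≤1

      e⁻¹ q : ℝ
      e⁻¹ = exp (- 1#)
      q   = (1# - exp 1# ⁻¹) * μ

      0≤e⁻¹ : 0# ≤ e⁻¹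
      0≤e⁻¹ = <⇒≤ (0<exp _)

      e⁻¹≤1 : e⁻¹ ≤ 1#
      e⁻¹≤1 = exp-neg≤1 0≤1

      q≈ : q ≈ (1# - e⁻¹) * μ
      q≈ = *-congʳ (+-congˡ (-‿cong (exp-⁻¹ 1#)))

      0≤q : 0# ≤ q
      0≤q = ≤-trans (*-nonNeg (gap e⁻¹≤1) 0≤μ) (≤-reflexive (sym q≈))

      q≤1 : q ≤ 1#
      q≤1 = ≤-trans (≤-reflexive q≈)
          (≤-by (solve 2 (λ e μ → :1 :- (:1 :- e) :* μ := :1 :- μ :+ e :* μ) refl (e⁻¹) μ)
          (0≤+ (gap μ≤1) (*-nonNeg 0≤e⁻¹ 0≤μ)))

      atom : ℕ → ℝ
      atom k = e⁻¹ * pointMass₀ k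

      0≤atom : NonNeg atom
      0≤atom k = *-nonNeg 0≤e⁻¹ (nonNeg Light-pointMass₀ k)

      atom-⇝ : atom ⇝ e⁻¹
      atom-⇝ = ⇝-cong (λ _ → refl) (*-identityʳ _) (⇝-* e⁻¹ (total Light-pointMass₀))

      Poisson-≈ : ∀ k → Poisson μ k ≈ (Bern μ ⊞ I₀) k + atom k
      Poisson-≈ k = trans (Poisson-decomposition μ 0≤μ μ≤1 k) (+-congʳ (sym (Bern-⊞ μ I₀ k)))

      P : ℕ → ℝ
      P = Poisson μ

      P-⇝ : P ⇝ 1#
      P-⇝ = total (Light-Poisson 0≤μ)

      ∣P∣≈P : ∀ k → ∣ P k ∣ ≈ P k
      ∣P∣≈P k = 0≤x⇒∣x∣≈x (nonNeg (Light-Poisson 0≤μ) k)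

      -- I k ≤ P k + P (k + 1), since P k ≥ (1 - μ) I k and P (k + 1) ≥ μ I k.
      I-weighted : ∀ k → weigh (abs I₀) k ≤ weigh (abs P) k + weigh (abs P) (suc k)
      I-weighted k = begin
        ∣ I₀ k ∣ * 2^ k
          ≈⟨ *-congʳ (0≤x⇒∣x∣≈x (0≤I k)) ⟩
        I₀ k * 2^ k
          ≈⟨ (solve 3 (λ i w μ → i :* w := ((:1 :- μ) :* i :+ μ :* i) :* w) refl (I₀ k) (2^ k) μ) ⟩
        ((1# - μ) * I₀ k + μ * I₀ k) * 2^ k
          ≤⟨ *-monoʳ-≤ (0≤2^ k) (+-mono-≤
               (≤-trans (≤-by (solve 3 (λ x y z → x :+ y :+ z :- x := y :+ z) refl ((1# - μ) * I₀ k)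
                   (μ * shift I₀ k) (atom k))
                          (0≤+ (*-nonNeg 0≤μ (shift-nonNeg {I₀} 0≤I k)) (0≤atom k)))
                        (≤-reflexive (sym (Poisson-decomposition μ 0≤μ μ≤1 k))))
               (≤-trans (≤-by (solve 3 (λ x y z → x :+ y :+ z :- y := x :+ z) refl ((1# - μ) * I₀ (suc k))
                   (μ * I₀ k) (atom (suc k)))
                          (0≤+ (*-nonNeg (gap μ≤1) (0≤I (suc k))) (0≤atom (suc k))))
                        (≤-reflexive (sym (Poisson-decomposition μ 0≤μ μ≤1 (suc k)))))) ⟩
        (P k + P (suc k)) * 2^ k
          ≤⟨ ≤-by (solve 3 (λ p q w → p :* w :+ q :* (:2 :* w) :- (p :+ q) :* w := q :* w) refl (P k)
              (P (suc k)) (2^ k))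
               (*-nonNeg (nonNeg (Light-Poisson 0≤μ) (suc k)) (0≤2^ k)) ⟩
        P k * 2^ k + P (suc k) * 2^ (suc k)
          ≈⟨ +-cong (*-congʳ (∣P∣≈P k)) (*-congʳ (∣P∣≈P (suc k))) ⟨
        weigh (abs P) k + weigh (abs P) (suc k) ∎

      I-moment : ∀ n → psum (weigh (abs I₀)) n ≤ bound P-⇝ + bound P-⇝
      I-moment n = begin
        psum (weigh (abs I₀)) n
          ≤⟨ psum-mono {weigh (abs I₀)} {λ k → weigh (abs P) k + weigh (abs P) (suc k)} I-weighted n ⟩
        psum (λ k → weigh (abs P) k + weigh (abs P) (suc k)) n
          ≈⟨ psum-+ (weigh (abs P)) (weigh (abs P) ∘ suc) n ⟩
        psum (weigh (abs P)) n + psum (weigh (abs P) ∘ suc) n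
          ≤⟨ +-mono-≤ (moment P-⇝ n) (≤-trans
               (≤-by (solve 2 (λ x y → x :+ y :- y := x) refl (weigh (abs P) 0) (psum (weigh (abs P) ∘ suc) n))
                   (weigh-nonNeg {abs P} (0≤∣x∣ ∘ P) 0))
               (moment P-⇝ (suc n))) ⟩
        bound P-⇝ + bound P-⇝ ∎

      I-⇝ : I₀ ⇝ 1# - e⁻¹
      I-⇝ = ⇝-cong (λ _ → refl) mass≈ I-⇝J
        where
        J : ∃ λ J → psum I₀ ⟶ J
        J = moment⇒convergent {I₀} (bound P-⇝ + bound P-⇝) I-moment

        I-⇝J : I₀ ⇝ proj₁ J
        I-⇝J = ⇝-intro (bound P-⇝ + bound P-⇝) I-moment (proj₂ J)

        mass≈ : proj₁ J ≈ 1# - e⁻¹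
        mass≈ = trans (solve 2 (λ j e → j := :1 :* j :+ e :- e) refl (proj₁ J) (e⁻¹)) (+-congʳ
          -- Summing both sides of `Poisson-≈` exhibits `1# * J + e⁻¹` and `1#` as limits of the
          -- same series.
          (⇝-unique (⇝-cong (sym ∘ Poisson-≈) refl (⇝-+ (⇝-⊞ (Bern-⇝ μ) I-⇝J) atom-⇝)) P-⇝))

      Swap-light : Light (Swap μ)
      Swap-light = light
        (λ k → ≤-trans (0≤+ (0≤I k) (0≤atom k)) (≤-reflexive (sym (Swap-≈ μ 0≤μ μ≤1 k))))
        (⇝-cong (sym ∘ Swap-≈ μ 0≤μ μ≤1) (solve 1 (λ e → :1 :- e :+ e := :1) refl (e⁻¹)) (⇝-+ I-⇝ atom-⇝))

    MarkSwap≤1-light : Light (MarkSwap≤1 μ)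
    MarkSwap≤1-light = Light-⊞ (light (Bern-nonNeg 0≤q q≤1) (Bern-⇝ q)) Swap-light

    private
      psum²-+ : ∀ a b n → psum² (λ k → a k + b k) n ≈ psum² a n + psum² b n
      psum²-+ a b n = trans (psum-cong {psum (λ k → a k + b k)} {λ k → psum a k + psum b k} (psum-+ a b) n)
          (psum-+ (psum a) (psum b) n)

      psum²-Bern-⊞ : ∀ r a n → psum² (Bern r ⊞ a) n ≈ (1# - r) * psum² a n + r * shift (psum² a) n
      psum²-Bern-⊞ r a n = trans (psum²-⊞ (Bern r) a n) (Bern-⊞ r (psum² a) n)

      U V : ℕ → ℝ
      U = psum² I₀
      V = psum² atom

      MarkSwap≤1-psum² : ∀ n → psum² (MarkSwap≤1 μ) n ≈ (1# - q) * (U n + V n) + q * shift (λ k → U k + V k) n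
      MarkSwap≤1-psum² n = trans
        (psum²-cong {MarkSwap≤1 μ} {Bern q ⊞ (λ k → I₀ k + atom k)}
            (⊞-cong {Bern q} (λ _ → refl) (Swap-≈ μ 0≤μ μ≤1)) n)
        (trans (psum²-Bern-⊞ q (λ k → I₀ k + atom k) n)
          (+-cong (*-congˡ (psum²-+ I₀ atom n)) (*-congˡ (shift-cong (psum²-+ I₀ atom) n))))

      Poisson-psum² : ∀ n → psum² P n ≈ (1# - μ) * U n + μ * shift U n + V n
      Poisson-psum² n = trans (psum²-cong {P} {λ k → (Bern μ ⊞ I₀) k + atom k} Poisson-≈ n)
        (trans (psum²-+ (Bern μ ⊞ I₀) atom n) (+-congʳ (psum²-Bern-⊞ μ I₀ n)))

      -- From the first term on, `psum atom` is at least e⁻¹, while `psum I₀` never exceeds its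
      -- total 1 - e⁻¹. This is where all mass of the atom sitting at 0 is used.
      psum-I≤ : ∀ n → e⁻¹ * psum I₀ n ≤ (1# - e⁻¹) * psum atom n
      psum-I≤ zero    = ≤-reflexive (solve 1 (λ e → e :* :0 := (:1 :- e) :* :0) refl (e⁻¹))
      psum-I≤ (suc n) = begin
        e⁻¹ * psum I₀ (suc n)               ≤⟨ *-monoˡ-≤ 0≤e⁻¹ (psum≤limit {I₀} 0≤I (⇝⇒⟶ I-⇝) (suc n)) ⟩
        e⁻¹ * (1# - e⁻¹)
          ≈⟨ (solve 1 (λ e → e :* (:1 :- e) := (:1 :- e) :* (e :* :1)) refl (e⁻¹)) ⟩
        (1# - e⁻¹) * (e⁻¹ * 1#)
          ≤⟨ *-monoˡ-≤ (gap e⁻¹≤1) (psum-increasing {atom} 0≤atom {1} {suc n} (ℕ.s≤s ℕ.z≤n) ⟨≤⟩ +-identityʳ _) ⟩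
        (1# - e⁻¹) * psum atom (suc n)      ∎
        where
        _⟨≤⟩_ : ∀ {x y z} → x ≤ z → x ≈ y → y ≤ z
        x≤z ⟨≤⟩ x≈y = ≤-trans (≤-reflexive (sym x≈y)) x≤z

    -- With U and V the double partial sums of I and of the atom e⁻¹ pointMass₀,
    -- the difference of the two sides at n + 1 is
    -- (q - μ) (U (n + 1) - U n) + q (V (n + 1) - V n), where μ - q = e⁻¹ μ.
    MarkSwap≤1≽Poisson : MarkSwap≤1 μ ≽ Poisson μ
    MarkSwap≤1≽Poisson zero    = ≤-refl
    MarkSwap≤1≽Poisson (suc n) = begin
      psum² (MarkSwap≤1 μ) (suc n)
        ≈⟨ MarkSwap≤1-psum² (suc n) ⟩
      (1# - q) * (U (suc n) + V (suc n)) + q * (U n + V n)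
        ≈⟨ +-cong (*-cong (+-congˡ (-‿cong q≈)) (+-cong (psum-last (psum I₀) n) (psum-last (psum atom) n)))
            (*-congʳ q≈) ⟩
      (1# - (1# - e⁻¹) * μ) * (U n + i + (V n + a)) + (1# - e⁻¹) * μ * (U n + V n)
        ≤⟨ ≤-by (solve 6 (λ μ e u i v a → (:1 :- μ) :* (u :+ i) :+ μ :* u :+ (v :+ a) :-
            ((:1 :- (:1 :- e) :* μ) :* (u :+ i :+ (v :+ a)) :+ (:1 :- e) :* μ :* (u :+ v)) := μ :*
            ((:1 :- e) :* a :- e :* i)) refl μ (e⁻¹) (U n) (psum I₀ n) (V n) (psum atom n))
             (*-nonNeg 0≤μ (gap (psum-I≤ n))) ⟩
      (1# - μ) * (U n + i) + μ * U n + (V n + a)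
        ≈⟨ +-cong (+-congʳ (*-congˡ (psum-last (psum I₀) n))) (psum-last (psum atom) n) ⟨
      (1# - μ) * U (suc n) + μ * U n + V (suc n)
        ≈⟨ Poisson-psum² (suc n) ⟨
      psum² (Poisson μ) (suc n) ∎
      where
      i a : ℝ
      i = psum I₀ n
      a = psum atom n

  Light-· : ∀ {D} → Light D → ∀ n → Light (n · D)
  Light-· D-light zero    = Light-pointMass₀
  Light-· D-light (suc n) = Light-⊞ D-light (Light-· D-light n)

  ·-≽-Poisson : ∀ {D x} → 0# ≤ x → Light D → D ≽ Poisson x → ∀ n → n · D ≽ Poisson (fromℕ n * x)
  ·-≽-Poisson {D} {x} 0≤x D-light D≽ zero = ≽-reflexive {pointMass₀} {Poisson (0# * x)}
    (λ k → sym (trans (Poisson-cong (zeroˡ x) k) (Poisson-0 k)))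
  ·-≽-Poisson {D} {x} 0≤x D-light D≽ (suc n) =
    ≽-trans {D ⊞ n · D} {Poisson x ⊞ Poisson (fromℕ n * x)} {Poisson (fromℕ (suc n) * x)}
      (⊞-mono-≽ {D} {Poisson x} {n · D} {Poisson (fromℕ n * x)} (nonNeg D-light)
        (nonNeg (Light-Poisson (*-nonNeg (0≤fromℕ n) 0≤x))) D≽ (·-≽-Poisson 0≤x D-light D≽ n))
      (≽-reflexive {Poisson x ⊞ Poisson (fromℕ n * x)} {Poisson (fromℕ (suc n) * x)}
        (λ k → trans (Poisson-⊞ x (fromℕ n * x) k)
            (Poisson-cong (solve 2 (λ x n → x :+ n :* x := (:1 :+ n) :* x) refl x (fromℕ n)) k)))

  -- Searches downwards from an Archimedean bound; non-negativity of `x` stops the search at 0 at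
  -- the latest.
  floor-exists : ∀ {x} → 0# ≤ x → ∃ (IsFloor x)
  floor-exists {x} 0≤x = let n , x≤n = archimedean x in
    search (suc n) (≤-<-trans x≤n (fromℕ-<-suc n))
    where
    fromℕ-<-suc : ∀ n → fromℕ n < fromℕ (suc n)
    fromℕ-<-suc n = ≰⇒> λ 1+n≤n → 1≰0 (≤-by (solve 1 (λ n → :0 :- :1 := n :- (:1 :+ n)) refl (fromℕ n))
        (gap 1+n≤n))

    search : ∀ n → x < fromℕ n → ∃ (IsFloor x)
    search zero    x<0 = ⊥-elim (<⇒≱ x<0 0≤x)
    search (suc n) x<1+n with em {fromℕ n ≤ x}
    ... | yes n≤x = n , n≤x , x<1+n
    ... | no  n≰x = search n (≰⇒> n≰x)

  floor-isFloor : ∀ {x} → 0# ≤ x → IsFloor x (floor x)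
  floor-isFloor {x} 0≤x with em {∃ (IsFloor x)}
  ... | yes (n , isFloor) = isFloor
  ... | no  none          = ⊥-elim (none (floor-exists 0≤x))

  module _ {μ : ℝ} (0≤μ : 0# ≤ μ) where

    private
      n : ℕ
      n = floor μ

      0≤frac : 0# ≤ frac μ
      0≤frac = gap (proj₁ (floor-isFloor 0≤μ))

      frac≤1 : frac μ ≤ 1#
      frac≤1 = ≤-by (solve 2 (λ μ n → :1 :- (μ :- n) := :1 :+ n :- μ) refl μ (fromℕ (floor μ)))
          (gap (<⇒≤ (proj₂ (floor-isFloor 0≤μ))))

      whole fractional : Dist
      whole      = n · MarkSwap≤1 1#
      fractional = MarkSwap≤1 (frac μ)

      whole-light : Light whole
      whole-light = Light-· (MarkSwap≤1-light 1# 0≤1 ≤-refl) n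

    MarkSwap>1-light : Light (whole ⊞ fractional)
    MarkSwap>1-light = Light-⊞ whole-light (MarkSwap≤1-light (frac μ) 0≤frac frac≤1)

    MarkSwap>1≽Poisson : whole ⊞ fractional ≽ Poisson μ
    MarkSwap>1≽Poisson =
      ≽-trans {whole ⊞ fractional} {Poisson (fromℕ n * 1#) ⊞ Poisson (frac μ)} {Poisson μ}
        (⊞-mono-≽ {whole} {Poisson (fromℕ n * 1#)} {fractional} {Poisson (frac μ)}
          (nonNeg whole-light) (nonNeg (Light-Poisson 0≤frac))
          (·-≽-Poisson {MarkSwap≤1 1#} 0≤1 (MarkSwap≤1-light 1# 0≤1 ≤-refl)
              (MarkSwap≤1≽Poisson 1# 0≤1 ≤-refl) n)
          (MarkSwap≤1≽Poisson (frac μ) 0≤frac frac≤1))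
        (≽-reflexive {Poisson (fromℕ n * 1#) ⊞ Poisson (frac μ)} {Poisson μ} λ k →
          trans (Poisson-⊞ _ _ k) (Poisson-cong (solve 2 (λ μ n → n :* :1 :+ (μ :- n) := μ) refl μ
              (fromℕ (floor μ))) k))

  -- Generalising the decision to a variable lets the conditional inside `MarkSwap` reduce by
  -- matching, with the dominance statement as the motive `P`.
  if-does-elim : ∀ {X : Set} (P : Dist → Set) {D E} (X? : Dec X) → (X → P D) → (¬ X → P E) → P
      (if does X? then D else E)
  if-does-elim P (yes x) then′ else′ = then′ x
  if-does-elim P (no ¬x) then′ else′ = else′ ¬x

  MarkSwap⪰Poisson : ∀ μ → 0# ≤ μ → MarkSwap μ ⪰ Poisson μ
  MarkSwap⪰Poisson μ 0≤μ = if-does-elim (_⪰ Poisson μ) (em {μ ≤ 1#})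
    (λ μ≤1 → ≽⇒⪰ {MarkSwap≤1 μ} (total (MarkSwap≤1-light μ 0≤μ μ≤1)) (total (Light-Poisson 0≤μ))
        (MarkSwap≤1≽Poisson μ 0≤μ μ≤1))
    (λ _ → ≽⇒⪰ {floor μ · MarkSwap≤1 1# ⊞ MarkSwap≤1 (frac μ)} (total (MarkSwap>1-light 0≤μ))
        (total (Light-Poisson 0≤μ)) (MarkSwap>1≽Poisson 0≤μ))

lemma5p16 : (em : ExcludedMiddle 0ℓ) (R : CompleteOrderedField) →
    let open Probability em R in
    (μ : ℝ) → 0# ≤ μ → MarkSwap μ ⪰ Poisson μ
lemma5p16 = MarkSwapDominance.MarkSwap⪰Poisson
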